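{- Assume that $p$, $N_1$, $N_2$ are powers of $b$ with $p\mid N_1$, $p\mid N_2$, and that $N_1/p\ge B$, $N_2/p\ge B$. Then the composition of local packing, one BSP redistribution, and local unpacking (described in the context) materializes the full permutation $$\pi_m(a\mathbin{+\!\!+}c)=\pi_{m_2}(c)\mathbin{+\!\!+}\pi_{m_1}(a),$$ where $a\in[N_1]$, $c\in[N_2]$. Applied to the Phase-I physical output, it produces $$\widehat Z[u,v]=Z[v,\pi_{m_2}(u)],\qquad u\in[N_2],\ v\in[N_1],$$ which is precisely the input layout required by Phase III. Each processor $q$ performs $W^{\mathrm{arith}}_{q,\mathrm{twiddle}}=\Theta(N/p)$ twiddle arithmetic and $W^{\mathrm{rearr}}_{q,\mathrm{perm}}=O(N/p)$ local rearrangement work; its local cache complexity is $Q_{q,\mathrm{perm}}=O(N/(pB))$. The permutation uses one global redistribution round with exactly $N/p^2$ items for every source–destination processor pair. Excluding the self block, every processor sends and receives $$h=\frac Np\left(1-\frac1p\right)$$ remote items, and the aggregate remote migration volume is $$\mu=N\left(1-\frac1p\right).$$ Excluding the mandatory local input and output arrays, the auxiliary workspace is $O(N/p^2+\log N)$ items or words per processor.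
   Context: $b=2^t=O(1)$ is a fixed radix, $N=N_1N_2$, $N_1=b^{m_1}$, $N_2=b^{m_2}$, $m=m_1+m_2$; $p\ge2$ processors indexed by $[p]=\{0,\dots,p-1\}$. $\pi_\ell$ is base-$b$ digit reversal on $[b^\ell]$; $\mathbin{+\!\!+}$ is concatenation of digit fields (left operand more significant); $\omega_N=\exp(2\pi\imath/N)$. Each processor has a private fully associative ideal cache of $M$ items, block size $B$, optimal replacement, with $M=\Omega(B^2)$; one complex scalar is one item. In one BSP $h$-relation each processor sends and receives at most $h$ remote items; a global redistribution round is local packing, one BSP $h$-relation, and local unpacking. Evaluating one twiddle factor costs $O(1)$ work and no memory traffic. **Input of the stage.** Processor $q$ holds the slab of the Phase-I physical array $\widetilde A[a,c]$, $a\in[N_1]$, $c=q\frac{N_2}{p}+c_{\mathrm{loc}}$, $c_{\mathrm{loc}}\in[N_2/p]$, stored as $N_1$ contiguous rows of length $N_2/p$, where $\widetilde A[a,c]=A[\pi_{m_1}(a),c]$ and $A[k_1,j_2]$ are the logical first-stage transform values. Put $Z[v,c]=A[v,c]\,\omega_N^{ -vc}$. Phase III requires, on the processor owning column $v$ (processor $\lfloor vp/N_1\rfloor$), for each $v$ the vector $j_2\mapsto Z[v,j_2]$ stored in digit-reversed order, i.e. $Z[v,\pi_{m_2}(u)]$ at row $u$. **Procedure.** (Pack) The $N_1$ rows are treated as contiguous macro-elements and permuted in place by $\pi_{m_1}$: for each two-cycle, the two rows are swapped sequentially entry by entry with one temporary item; in the same scan the entry placed in row $v=\pi_{m_1}(a)$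 and global column $c$ is multiplied by $\omega_N^{ -vc}$. (Exchange) For each $q'$, the block of packed rows $v=q'\frac{N_1}p+v_{\mathrm{loc}}$, $v_{\mathrm{loc}}\in[N_1/p]$, of shape $\frac{N_1}p\times\frac{N_2}p$, is sent to processor $q'$ (the self block stays local), all in one BSP exchange, into a raw region of the output array indexed by source. (Unpack) Processor $q'$ transposes each received block with the cache-oblivious rectangular transpose algorithm ($O(rc)$ work and $O(1+rc/B)$ misses for an $r\times c$ block), using one reusable scratch array, so that coordinates $(v_{\mathrm{loc}},c_{\mathrm{loc}})$ become $(c_{\mathrm{loc}},v_{\mathrm{loc}})$; together with the source $q$ the rows are indexed by $c=q\frac{N_2}p+c_{\mathrm{loc}}$. It then permutes the $N_2$ rows (contiguous macro-elements of length $N_1/p$) in place by $\pi_{m_2}$, moving row $c$ to row $u=\pi_{m_2}(c)$. The resulting array is $\widehat Z[u,v]$. "Materializes $\pi_m$" means the item at $(a,c)$ ends at $(u,v)=(\pi_{m_2}(c),\pi_{m_1}(a))$ on processor $\lfloor vp/N_1\rfloor$. -}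

module Defs where

open import Algebra.Bundles using (CommutativeRing)
open import Data.Bool.Base using (if_then_else_; _∧_)
open import Data.Fin.Base as Fin using (Fin)
import Data.Fin.Properties as Fin
open import Data.Integer.Base using (+_)
open import Data.List.Base
  using (List; []; _∷_; _++_; map; concatMap; foldr; foldl; filter; length; upTo)
open import Data.Nat
open import Data.Nat.ListAction using (sum)
open import Data.Nat.Divisibility using (_∣_; quotient)
open import Data.Nat.DivMod using (_/_; _%_)
open import Data.Nat.Properties using (_≟_; m*n≢0; m^n≢0; ≤-trans)
open import Data.Product.Base using (∃-syntax; _×_; _,_; proj₁; proj₂)
import Data.Product.Properties as Product
open import Data.Rational.Base as ℚ using (ℚ; 1ℚ)
import Level
open import Relation.Binary.Definitions using (DecidableEquality)
open import Relation.Binary.PropositionalEquality.Core using (_≡_)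
open import Relation.Nullary.Decidable using (does; ¬?; _×-dec_)
open import Relation.Nullary.Negation using (¬_)

-- Reversal of the ℓ base-b digits of n; meaningful for n < b ^ ℓ.
π : (b : ℕ) .{{_ : NonZero b}} → ℕ → ℕ → ℕ
π b zero    n = 0
π b (suc ℓ) n = (n % b) * b ^ ℓ + π b ℓ (n / b)

-- Concatenation of digit fields, the right operand ranging over [n].
infixl 6 _++⟨_⟩_
_++⟨_⟩_ : ℕ → ℕ → ℕ → ℕ
x ++⟨ n ⟩ y = x * n + y

-- The number of digits that change when an ℓ-digit base-b counter is
-- advanced from n: the cost of advancing n and π b ℓ n together.
carries : (b : ℕ) .{{_ : NonZero b}} → ℕ → ℕ → ℕ
carries b zero    n = 0
carries b (suc ℓ) n = suc (if suc (n % b) ≡ᵇ b then carries b ℓ (n / b) else 0)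

Region : Set
Region = Fin 4

pattern input   = Fin.zero
pattern output  = Fin.suc Fin.zero
pattern scratch = Fin.suc (Fin.suc Fin.zero)
pattern temp    = Fin.suc (Fin.suc (Fin.suc Fin.zero))

Loc : Set
Loc = Region × ℕ

_≟ᴸ_ : DecidableEquality Loc
_≟ᴸ_ = Product.≡-dec Fin._≟_ _≟_

open import Data.List.Membership.DecPropositional _≟ᴸ_ using (_∈?_)

Mem : ∀ {x} → Set x → Set x
Mem X = Loc → X

write : ∀ {x} {X : Set x} → Loc → X → Mem X → Mem X
write l x μ l′ = if does (l′ ≟ᴸ l) then x else μ l′

-- Entry (i , j) of an array stored row-major with rows of length n.
cell : Region → (n i j : ℕ) → Loc
cell ρ n i j = ρ , i * n + j

-- Cache lines are pairs (region , line number): every region starts on a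
-- line boundary.
line : (B : ℕ) .{{_ : NonZero B}} → Loc → Loc
line B (ρ , i) = ρ , i / B

removals : ∀ {a} {A : Set a} → List A → List (List A)
removals []       = []
removals (x ∷ xs) = xs ∷ map (x ∷_) (removals xs)

-- misses k c xs: misses of an optimally managed fully associative cache with
-- room for k lines, currently holding c, on the line requests xs.  A miss
-- on a full cache may evict any line.  The base value of the minimum,
-- emptying the cache, is also a legal move; it only serves to give k = 0 a
-- meaning (every request misses).
misses : ℕ → List Loc → List Loc → ℕ
misses k c []       = 0
misses k c (x ∷ xs) =
  if does (x ∈? c) then misses k c xs
  else suc (if length c <ᵇ k then misses k (x ∷ c) xs
            else foldr _⊓_ (misses k [] xs)
                   (map (λ c′ → misses k (x ∷ c′) xs) (removals c)))

maximum : List ℕ → ℕ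
maximum = foldr _⊔_ 0

infixr 5 _⨾_

data Prog : Set where
  skip : Prog
  mov  : (dst src : Loc) → Prog
  -- dst := src · ω ^ (- e)
  twid : (dst src : Loc) (e : ℕ) → Prog
  -- n units of index arithmetic
  tick : (n : ℕ) → Prog
  _⨾_  : Prog → Prog → Prog
  -- for n f runs f 0, …, f (n - 1)
  for  : (n : ℕ) → (ℕ → Prog) → Prog
  -- a call whose activation record occupies the given number of words
  call : (frame : ℕ) → Prog → Prog

loop : ∀ {x} {X : Set x} → ℕ → (ℕ → X → X) → X → X
loop zero    f x = x
loop (suc n) f x = f n (loop n f x)

-- act e is the effect of the twiddle factor ω ^ (- e) on an item.
exec : ∀ {x} {X : Set x} → (act : ℕ → X → X) → Prog → Mem X → Mem X
exec act skip             μ = μ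
exec act (mov dst src)    μ = write dst (μ src) μ
exec act (twid dst src e) μ = write dst (act e (μ src)) μ
exec act (tick n)         μ = μ
exec act (P ⨾ Q)          μ = exec act Q (exec act P μ)
exec act (for n f)        μ = loop n (λ i → exec act (f i)) μ
exec act (call k P)       μ = exec act P μ

accesses : Prog → List Loc
accesses skip             = []
accesses (mov dst src)    = src ∷ dst ∷ []
accesses (twid dst src e) = src ∷ dst ∷ []
accesses (tick n)         = []
accesses (P ⨾ Q)          = accesses P ++ accesses Q
accesses (for n f)        = concatMap (λ i → accesses (f i)) (upTo n)
accesses (call k P)       = accesses P

-- Data movement and control; the arithmetic of twid is counted by arith.
moves : Prog → ℕ
moves skip             = 0
moves (mov dst src)    = 1
moves (twid dst src e) = 1
moves (tick n)         = n
moves (P ⨾ Q)          = moves P + moves Q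
moves (for n f)        = sum (map (λ i → suc (moves (f i))) (upTo n))
moves (call k P)       = suc (moves P)

-- One multiplication per twiddled item, plus the cost τ e of evaluating
-- ω ^ (- e).
arith : (τ : ℕ → ℕ) → Prog → ℕ
arith τ skip             = 0
arith τ (mov dst src)    = 0
arith τ (twid dst src e) = suc (τ e)
arith τ (tick n)         = 0
arith τ (P ⨾ Q)          = arith τ P + arith τ Q
arith τ (for n f)        = sum (map (λ i → arith τ (f i)) (upTo n))
arith τ (call k P)       = arith τ P

-- Loop counters and activation records simultaneously alive.
control : Prog → ℕ
control (P ⨾ Q)    = control P ⊔ control Q
control (for n f)  = suc (maximum (map (λ i → control (f i)) (upTo n)))
control (call k P) = k + control P
control _          = 0

-- One item travelling from location `from` of processor src to location
-- `to` of processor dst.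
record Msg : Set where
  constructor msg
  field
    src dst : ℕ
    from to : Loc

open Msg public

data Step : Set where
  local    : (ℕ → Prog) → Step
  exchange : List Msg → Step

Alg : Set
Alg = List Step

Global : ∀ {x} → Set x → Set x
Global X = ℕ → Mem X

-- All items are read before any is delivered.
deliver : ∀ {x} {X : Set x} → List Msg → Global X → Global X
deliver {X = X} ms G = foldl put G ms
  where
  put : Global X → Msg → Global X
  put H m q = if does (q ≟ dst m) then write (to m) (G (src m) (from m)) (H q) else H q

run : ∀ {x} {X : Set x} → (act : ℕ → X → X) → Alg → Global X → Global X
run act []                G = G
run act (local P ∷ ss)    G = run act ss (λ q → exec act (P q) (G q))
run act (exchange ms ∷ ss) G = run act ss (deliver ms G)

rounds : Alg → ℕ
rounds []                = 0
rounds (local _ ∷ ss)    = rounds ss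
rounds (exchange _ ∷ ss) = suc (rounds ss)

messages : Alg → List Msg
messages []                 = []
messages (local _ ∷ ss)     = messages ss
messages (exchange ms ∷ ss) = ms ++ messages ss

-- Every outgoing item is read and every incoming item is written through the
-- cache of the processor concerned.
endpoint : ℕ → Msg → List Loc
endpoint q m = (if does (q ≟ src m) then from m ∷ [] else [])
            ++ (if does (q ≟ dst m) then to m ∷ [] else [])

stepAccesses : ℕ → Step → List Loc
stepAccesses q (local P)     = accesses (P q)
stepAccesses q (exchange ms) = concatMap (endpoint q) ms

stepMoves : ℕ → Step → ℕ
stepMoves q (local P)     = moves (P q)
stepMoves q (exchange ms) = length (concatMap (endpoint q) ms)

stepArith : (τ : ℕ → ℕ) → ℕ → Step → ℕ
stepArith τ q (local P)     = arith τ (P q)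
stepArith τ q (exchange ms) = 0

stepControl : ℕ → Step → ℕ
stepControl q (local P)     = control (P q)
stepControl q (exchange ms) = 0

Wʳᵉᵃʳʳ : Alg → ℕ → ℕ
Wʳᵉᵃʳʳ alg q = sum (map (stepMoves q) alg)

Wᵃʳⁱᵗʰ : (τ : ℕ → ℕ) → Alg → ℕ → ℕ
Wᵃʳⁱᵗʰ τ alg q = sum (map (stepArith τ q) alg)

-- Misses of processor q, starting from an empty cache of M items organised in
-- lines of B items.
cacheMisses : (M B : ℕ) .{{_ : NonZero B}} → Alg → ℕ → ℕ
cacheMisses M B alg q =
  misses (M / B) [] (map (line B) (concatMap (stepAccesses q) alg))

-- The least size of an array in region ρ containing all requested locations.
extent : Region → List Loc → ℕ
extent ρ ls = maximum (map (λ l → if does (proj₁ l Fin.≟ ρ) then suc (proj₂ l) else 0) ls)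

-- Storage of processor q beyond an input and an output array of n items each.
workspace : (n : ℕ) → Alg → ℕ → ℕ
workspace n alg q =
  (extent input ls ∸ n) + (extent output ls ∸ n) + extent scratch ls + extent temp ls
    + maximum (map (stepControl q) alg)
  where
  ls : List Loc
  ls = concatMap (stepAccesses q) alg

-- Items travelling from q to q′ (q′ may equal q).
pairCount : Alg → (q q′ : ℕ) → ℕ
pairCount alg q q′ =
  length (filter (λ m → (src m ≟ q) ×-dec (dst m ≟ q′)) (messages alg))

remote : Alg → List Msg
remote alg = filter (λ m → ¬? (src m ≟ dst m)) (messages alg)

sent received : Alg → ℕ → ℕ
sent     alg q = length (filter (λ m → src m ≟ q) (remote alg))
received alg q = length (filter (λ m → dst m ≟ q) (remote alg))

migration : Alg → ℕ
migration alg = length (remote alg)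

fromℕ : ℕ → ℚ
fromℕ n = + n ℚ./ 1

tmp : Loc
tmp = temp , 0

-- body a (π a) for each row index a; a and π a are maintained as ℓ digits.
forRows : (b : ℕ) .{{_ : NonZero b}} → ℕ → (ℕ → ℕ → Prog) → Prog
forRows b ℓ body = call ℓ (for (b ^ ℓ) λ a → tick (carries b ℓ a) ⨾ body a (π b ℓ a))

-- c is the length of the rows and q the processor, so that local column j is
-- global column q * c + j.
pack : (b : ℕ) .{{_ : NonZero b}} → (m₁ c q : ℕ) → Prog
pack b m₁ c q = forRows b m₁ λ a v →
  if a <ᵇ v then
    for c (λ j → mov tmp (x a j)
               ⨾ twid (x a j) (x v j) (a * (q * c + j))
               ⨾ twid (x v j) tmp     (v * (q * c + j)))
  else if a ≡ᵇ v then
    for c (λ j → twid (x v j) (x v j) (v * (q * c + j)))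
  else skip
  where
  x : ℕ → ℕ → Loc
  x = cell input c

-- p processors; blocks of shape r × c, stored row-major in the order of their
-- sources.
redistribution : (p r c : ℕ) → List Msg
redistribution p r c =
  concatMap (λ q  →
  concatMap (λ q′ →
  concatMap (λ v  →
  map       (λ j  → msg q q′ (cell input c (q′ * r + v) j) (output , q * (r * c) + (v * c + j)))
  (upTo c)) (upTo r)) (upTo p)) (upTo p)

-- Cache-oblivious transposition of the r × c block at `base` of the output
-- array into the scratch array: the longer side of the current h × w subblock
-- with corner (i , j) is halved.  The first argument bounds the recursion
-- depth; h + w always suffices.  A record holds i, j, h, w and a return
-- address.
transposeRec : (base r c : ℕ) → (fuel i j h w : ℕ) → Prog
transposeRec base r c zero       i j h w = skip
transposeRec base r c (suc fuel) i j h w = call 5 (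
  if (h ≤ᵇ 1) ∧ (w ≤ᵇ 1) then mov (cell scratch r j i) (output , base + (i * c + j))
  else if w ≤ᵇ h then
    (  transposeRec base r c fuel i           j ⌊ h /2⌋ w
     ⨾ transposeRec base r c fuel (i + ⌊ h /2⌋) j ⌈ h /2⌉ w)
  else
    (  transposeRec base r c fuel i j           h ⌊ w /2⌋
     ⨾ transposeRec base r c fuel i (j + ⌊ w /2⌋) h ⌈ w /2⌉))

transpose : (base r c : ℕ) → Prog
transpose base r c =
    transposeRec base r c (r + c) 0 0 r c
  ⨾ for (r * c) (λ k → mov (output , base + k) (scratch , k))

unpack : (b : ℕ) .{{_ : NonZero b}} → (m₂ p r c : ℕ) → Prog
unpack b m₂ p r c =
    for p (λ q → transpose (q * (r * c)) r c)
  ⨾ forRows b m₂ λ a u →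
      if a <ᵇ u then
        for r (λ j → mov tmp (y a j) ⨾ mov (y a j) (y u j) ⨾ mov (y u j) tmp)
      else skip
  where
  y : ℕ → ℕ → Loc
  y = cell output r

module _ {a ℓ} (R : CommutativeRing a ℓ) where

  open CommutativeRing R renaming (Carrier to K; _*_ to _·_)
  open import Algebra.Properties.Semiring.Exp semiring using () renaming (_^_ to _^ᴷ_)

  -- An element of exact multiplicative order N, in the role of exp (2πi / N).
  record RootOfUnity (N : ℕ) : Set (a Level.⊔ ℓ) where
    field
      ω ω⁻¹     : K
      ω·ω⁻¹≈1   : ω · ω⁻¹ ≈ 1#
      ω^N≈1     : ω ^ᴷ N ≈ 1#
      order     : ∀ k → 0 < k → k < N → ¬ (ω ^ᴷ k ≈ 1#)

    twiddle : ℕ → K → K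
    twiddle e x = x · (ω⁻¹ ^ᴷ e)

-- The radix is 2 ^ t; M = Ω(B²) is B² ≤ κ M.
record Stage (t κ : ℕ) : Set where
  b : ℕ
  b = 2 ^ t

  field
    m₁ m₂ p M B : ℕ

  m : ℕ
  m = m₁ + m₂

  N₁ : ℕ
  N₁ = b ^ m₁

  N₂ : ℕ
  N₂ = b ^ m₂

  N : ℕ
  N = N₁ * N₂

  field
    1≤t     : 1 ≤ t
    2≤p     : 2 ≤ p
    p-power : ∃[ s ] p ≡ b ^ s
    p∣N₁    : p ∣ N₁
    p∣N₂    : p ∣ N₂

  N₁/p : ℕ
  N₁/p = quotient p∣N₁

  N₂/p : ℕ
  N₂/p = quotient p∣N₂

  field
    1≤B    : 1 ≤ B
    B≤N₁/p : B ≤ N₁/p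
    B≤N₂/p : B ≤ N₂/p
    tall   : B * B ≤ κ * M

  instance
    b-nonZero : NonZero b
    b-nonZero = m^n≢0 2 t

    N₁-nonZero : NonZero N₁
    N₁-nonZero = m^n≢0 b m₁

    p-nonZero : NonZero p
    p-nonZero = >-nonZero (≤-trans (s≤s z≤n) 2≤p)

    p*p-nonZero : NonZero (p * p)
    p*p-nonZero = m*n≢0 p p

    B-nonZero : NonZero B
    B-nonZero = >-nonZero 1≤B

    N₁/p-nonZero : NonZero N₁/p
    N₁/p-nonZero = >-nonZero (≤-trans 1≤B B≤N₁/p)

    N₂/p-nonZero : NonZero N₂/p
    N₂/p-nonZero = >-nonZero (≤-trans 1≤B B≤N₂/p)

  perm : Alg
  perm = local (λ q → pack b m₁ N₂/p q)
       ∷ exchange (redistribution p N₁/p N₂/p)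
       ∷ local (λ _ → unpack b m₂ p N₁/p N₂/p)
       ∷ []

  Q : ℕ → ℕ
  Q = cacheMisses M B perm

  -- The entry of the distributed N₁ × N₂ input array at row a, column c.
  inputAt : ∀ {x} {X : Set x} → Global X → (a c : ℕ) → X
  inputAt G a c = G (c / N₂/p) (cell input N₂/p a (c % N₂/p))

  -- The entry of the distributed N₂ × N₁ output array at row u, column v;
  -- column v is owned by processor ⌊ v p / N₁ ⌋.
  outputAt : ∀ {x} {X : Set x} → Global X → (u v : ℕ) → X
  outputAt G u v = G ((v * p) / N₁) (cell output N₁/p u (v % N₁/p))

  -- Both floors are exact since p divides N₁ and N₂.
  N/p : ℕ
  N/p = N / p

  N/p² : ℕ
  N/p² = N / (p * p)

  pairVolume : ℚ
  pairVolume = + N ℚ./ (p * p)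

  relationSize : ℚ
  relationSize = (+ N ℚ./ p) ℚ.* (1ℚ ℚ.- (+ 1 ℚ./ p))

  totalVolume : ℚ
  totalVolume = (+ N ℚ./ 1) ℚ.* (1ℚ ℚ.- (+ 1 ℚ./ p))

  SplitsReversal : Set
  SplitsReversal = ∀ a c → a < N₁ → c < N₂ →
    π b m (a ++⟨ N₂ ⟩ c) ≡ π b m₂ c ++⟨ N₁ ⟩ π b m₁ a

  -- G₁ is G₀ with the item at (a , c) brought to (π c , π a).
  Permuted : ∀ {x} {X : Set x} (G₀ G₁ : Global X) → Set x
  Permuted G₀ G₁ = ∀ a c → a < N₁ → c < N₂ →
    outputAt G₁ (π b m₂ c) (π b m₁ a) ≡ inputAt G₀ a c

  -- The physical output of the first phase for the logical values A.
  PhaseIOutput : ∀ {k ℓ} (R : CommutativeRing k ℓ) → let open CommutativeRing R using (Carrier) in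
                 (A : ℕ → ℕ → Carrier) → Global Carrier → Set ℓ
  PhaseIOutput R A G = ∀ a c → a < N₁ → c < N₂ → inputAt G a c ≈ A (π b m₁ a) c
    where open CommutativeRing R using (_≈_)

  -- Z v in digit-reversed order on the owner of column v.
  PhaseIIIInput : ∀ {k ℓ} (R : CommutativeRing k ℓ) → let open CommutativeRing R using (Carrier) in
                  (Z : ℕ → ℕ → Carrier) → Global Carrier → Set ℓ
  PhaseIIIInput R Z G = ∀ u v → u < N₂ → v < N₁ → outputAt G u v ≈ Z v (π b m₂ u)
    where open CommutativeRing R using (_≈_)

  -- Z v c = A v c · ω ^ (- v c)
  twiddled : ∀ {k ℓ} (R : CommutativeRing k ℓ) → let open CommutativeRing R using (Carrier) in
             RootOfUnity R N → (ℕ → ℕ → Carrier) → (ℕ → ℕ → Carrier)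
  twiddled R ρ A v c = RootOfUnity.twiddle ρ (v * c) (A v c)

{-# OPTIONS --safe #-}
module Submission where

-- The permutation.  Reversing the digits of the concatenation of a and c
-- reverses each field and exchanges the fields (π-split), and π is an
-- involution.  The procedure realizes this factor by factor.  Swapping the
-- rows a and π a at the smaller of the two indices leaves row π a at row a
-- (loop-permute), and the factor applied to the entry then belongs to its
-- final position.  Every location of an output block receives exactly one
-- message (deliver-redistribution), and the recursive transposition turns the
-- block from source q, with local coordinates (v , j), into rows q c + j of
-- the output (exec-unpack).  Together these give run-redistribute: the entry
-- at row u and column v of the output is the entry at row π v and column π u
-- of the input, multiplied by the twiddle factor with exponent v * π u.  Both
-- claims about values are instances of it.
--
-- Work.  Maintaining a counter along with its reversal costs O(1) amortized
-- per step (∑-carries), a recursion tree with r c leaves has fewer than r c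
-- inner nodes (moves-transposeRec), and everything else does O(1) per entry.
-- Every entry is twiddled exactly once, because a sum over rows is invariant
-- under π (∑-rowCount).
--
-- Cache misses.  An upper bound on the optimal number of misses is the cost of
-- one policy: empty the cache whenever it is full.  On a stretch of requests
-- confined to d lines that fit into the cache it misses at most 2 d + 1 times,
-- whatever the cache holds at the start (bounded-workingSet), so bounds for
-- consecutive stretches add up.  A scan of n entries is cut into stretches of
-- B steps, each meeting O(1) lines, and costs O(n / B) misses when n is at
-- least B (cost-scan); row swaps, message traffic and copying are scans.  For
-- the transposition a stretch is a subproblem with both sides at most T, where
-- T is of order B and subblocks of this side fit into the cache
-- (cost-transposeRec).  Such T exists because B ² = O(M); if the cache
-- has fewer than six lines, B itself is bounded and every access may miss
-- (cacheMisses-≤).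
--
-- Storage is the scratch block, the temporary item and the control words; the
-- recursion depth is logarithmic because each call halves a side
-- (control-transposeRec).  The communication volumes are double sums over
-- sources and destinations (sum-redistribution).

open import Algebra.Bundles using (CommutativeRing)
open import Data.Bool.Base as Bool using (Bool; true; false; if_then_else_; _∧_)
import Data.Fin.Properties as Fin
import Data.Integer.Base as ℤ
import Data.Integer.Properties as ℤ
open import Data.List.Base
  using (List; []; _∷_; _++_; concat; concatMap; filter; foldl; foldr; length; map; upTo)
open import Data.List.Properties
  using (++-assoc; ++-identityʳ; concatMap-++; concatMap-cong; concatMap-map; length-++; length-map;
         map-++; map-applyUpTo; map-∘)
open import Data.List.Relation.Unary.All as All using (All; []; _∷_)
import Data.List.Relation.Unary.All.Properties as All
open import Data.List.Relation.Unary.Any as Any using (Any; here; there)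
import Data.List.Relation.Unary.Any.Properties as Any
open import Data.List.Membership.Propositional.Properties
  using (∈-++⁺ˡ; ∈-++⁺ʳ; ∈-concat⁺′; ∈-map⁺; ∈-upTo⁺)
open import Data.Nat
open import Data.Nat.DivMod
open import Data.Nat.Divisibility using (_∣_; ∣-refl; n∣m*n)
open import Data.Nat.ListAction using (sum)
open import Data.Nat.ListAction.Properties using (sum-++)
open import Data.Nat.Logarithm using (⌊log₂_⌋; ⌊log₂[2^n]⌋≡n)
open import Data.Nat.Properties
open import Data.Nat.Tactic.RingSolver using (solve-∀)
open import Data.Product.Base using (∃-syntax; _×_; _,_; proj₁; proj₂)
open import Data.Product.Properties using (,-injectiveˡ; ,-injectiveʳ)
open import Data.Rational.Base as ℚ using (1ℚ)
import Data.Rational.Properties as ℚ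
open import Data.Rational.Unnormalised.Base as ℚᵘ using (mkℚᵘ; *≡*; 1ℚᵘ)
import Data.Rational.Unnormalised.Properties as ℚᵘ
open import Data.Sum.Base as Sum using (_⊎_; inj₁; inj₂)
open import Function.Base using (_∘_)
open import Relation.Binary.Definitions using (tri<; tri≈; tri>)
open import Relation.Binary.PropositionalEquality hiding (setoid)
open import Relation.Nullary.Decidable using (Dec; yes; no; does; dec-true; dec-false; ¬?; _×-dec_)
open import Relation.Nullary.Negation using (¬_; contradiction)
open import Defs
open import Data.List.Membership.DecPropositional _≟ᴸ_ using (_∈_; _∉_; _∈?_)

-- Finite sums

-- The sum of f 0, …, f (n - 1).
∑ : ℕ → (ℕ → ℕ) → ℕ
∑ n f = sum (map f (upTo n))

map-upTo-suc : ∀ {a} {A : Set a} (f : ℕ → A) n →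
  map f (upTo (suc n)) ≡ f 0 ∷ map (f ∘ suc) (upTo n)
map-upTo-suc f n = cong (f 0 ∷_)
  (trans (map-applyUpTo suc f n) (sym (map-applyUpTo (λ i → i) (f ∘ suc) n)))

∑-suc : ∀ n f → ∑ (suc n) f ≡ f 0 + ∑ n (f ∘ suc)
∑-suc n f = cong sum (map-upTo-suc f n)

∑-cong : ∀ n {f g} → (∀ i → i < n → f i ≡ g i) → ∑ n f ≡ ∑ n g
∑-cong zero    f≡g = refl
∑-cong (suc n) {f} {g} f≡g = begin
  ∑ (suc n) f         ≡⟨ ∑-suc n f ⟩
  f 0 + ∑ n (f ∘ suc) ≡⟨ cong₂ _+_ (f≡g 0 z<s) (∑-cong n λ i i<n → f≡g (suc i) (s<s i<n)) ⟩
  g 0 + ∑ n (g ∘ suc) ≡⟨ ∑-suc n g ⟨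
  ∑ (suc n) g         ∎
  where open ≡-Reasoning

∑-mono : ∀ n {f g} → (∀ i → i < n → f i ≤ g i) → ∑ n f ≤ ∑ n g
∑-mono zero    f≤g = z≤n
∑-mono (suc n) {f} {g} f≤g = begin
  ∑ (suc n) f         ≡⟨ ∑-suc n f ⟩
  f 0 + ∑ n (f ∘ suc) ≤⟨ +-mono-≤ (f≤g 0 z<s) (∑-mono n λ i i<n → f≤g (suc i) (s<s i<n)) ⟩
  g 0 + ∑ n (g ∘ suc) ≡⟨ ∑-suc n g ⟨
  ∑ (suc n) g         ∎
  where open ≤-Reasoning

∑-const : ∀ n k → ∑ n (λ _ → k) ≡ n * k
∑-const zero    k = refl
∑-const (suc n) k = trans (∑-suc n (λ _ → k)) (cong (k +_) (∑-const n k))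

∑-0 : ∀ n {f} → (∀ i → f i ≡ 0) → ∑ n f ≡ 0
∑-0 n f≡0 = trans (∑-cong n (λ i _ → f≡0 i)) (trans (∑-const n 0) (*-zeroʳ n))

∑-+ : ∀ n f g → ∑ n (λ i → f i + g i) ≡ ∑ n f + ∑ n g
∑-+ zero    f g = refl
∑-+ (suc n) f g = begin
  ∑ (suc n) (λ i → f i + g i)                       ≡⟨ ∑-suc n _ ⟩
  f 0 + g 0 + ∑ n (λ i → f (suc i) + g (suc i))     ≡⟨ cong (f 0 + g 0 +_) (∑-+ n (f ∘ suc) (g ∘ suc)) ⟩
  f 0 + g 0 + (∑ n (f ∘ suc) + ∑ n (g ∘ suc))       ≡⟨ interchange (f 0) (g 0) _ _ ⟩
  f 0 + ∑ n (f ∘ suc) + (g 0 + ∑ n (g ∘ suc))       ≡⟨ cong₂ _+_ (∑-suc n f) (∑-suc n g) ⟨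
  ∑ (suc n) f + ∑ (suc n) g                         ∎
  where
  open ≡-Reasoning
  interchange : ∀ w x y z → w + x + (y + z) ≡ w + y + (x + z)
  interchange = solve-∀

∑-*ʳ : ∀ n f k → ∑ n (λ i → f i * k) ≡ ∑ n f * k
∑-*ʳ zero    f k = refl
∑-*ʳ (suc n) f k = begin
  ∑ (suc n) (λ i → f i * k)           ≡⟨ ∑-suc n _ ⟩
  f 0 * k + ∑ n (λ i → f (suc i) * k) ≡⟨ cong (f 0 * k +_) (∑-*ʳ n (f ∘ suc) k) ⟩
  f 0 * k + ∑ n (f ∘ suc) * k         ≡⟨ *-distribʳ-+ k (f 0) _ ⟨
  (f 0 + ∑ n (f ∘ suc)) * k           ≡⟨ cong (_* k) (∑-suc n f) ⟨
  ∑ (suc n) f * k                     ∎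
  where open ≡-Reasoning

∑-swap : ∀ m n (f : ℕ → ℕ → ℕ) → ∑ m (λ i → ∑ n (f i)) ≡ ∑ n (λ j → ∑ m (λ i → f i j))
∑-swap zero    n f = sym (trans (∑-const n 0) (*-zeroʳ n))
∑-swap (suc m) n f = begin
  ∑ (suc m) (λ i → ∑ n (f i))                          ≡⟨ ∑-suc m _ ⟩
  ∑ n (f 0) + ∑ m (λ i → ∑ n (f (suc i)))              ≡⟨ cong (∑ n (f 0) +_) (∑-swap m n (f ∘ suc)) ⟩
  ∑ n (f 0) + ∑ n (λ j → ∑ m (λ i → f (suc i) j))      ≡⟨ ∑-+ n (f 0) _ ⟨
  ∑ n (λ j → f 0 j + ∑ m (λ i → f (suc i) j))          ≡⟨ ∑-cong n (λ j _ → sym (∑-suc m (λ i → f i j))) ⟩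
  ∑ n (λ j → ∑ (suc m) (λ i → f i j))                  ∎
  where open ≡-Reasoning

∑-split : ∀ m n f → ∑ (m + n) f ≡ ∑ m f + ∑ n (λ i → f (m + i))
∑-split zero    n f = refl
∑-split (suc m) n f = begin
  ∑ (suc (m + n)) f                                      ≡⟨ ∑-suc (m + n) f ⟩
  f 0 + ∑ (m + n) (f ∘ suc)                              ≡⟨ cong (f 0 +_) (∑-split m n (f ∘ suc)) ⟩
  f 0 + (∑ m (f ∘ suc) + ∑ n (λ i → f (suc m + i)))      ≡⟨ +-assoc (f 0) _ _ ⟨
  f 0 + ∑ m (f ∘ suc) + ∑ n (λ i → f (suc m + i))        ≡⟨ cong (_+ ∑ n (λ i → f (suc m + i))) (∑-suc m f) ⟨
  ∑ (suc m) f + ∑ n (λ i → f (suc m + i))                ∎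
  where open ≡-Reasoning

-- Summation along the rows of an m × n array.
∑-rows : ∀ m n f → ∑ (m * n) f ≡ ∑ m (λ i → ∑ n (λ j → f (i * n + j)))
∑-rows zero    n f = refl
∑-rows (suc m) n f = begin
  ∑ (n + m * n) f                                                  ≡⟨ ∑-split n (m * n) f ⟩
  ∑ n f + ∑ (m * n) (λ k → f (n + k))                              ≡⟨ cong (∑ n f +_) (∑-rows m n _) ⟩
  ∑ n f + ∑ m (λ i → ∑ n (λ j → f (n + (i * n + j))))
    ≡⟨ cong (∑ n f +_) (∑-cong m λ i _ → ∑-cong n λ j _ → cong f (sym (+-assoc n (i * n) j))) ⟩
  ∑ n f + ∑ m (λ i → ∑ n (λ j → f (suc i * n + j)))                ≡⟨ ∑-suc m (λ i → ∑ n (λ j → f (i * n + j))) ⟨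
  ∑ (suc m) (λ i → ∑ n (λ j → f (i * n + j)))                      ∎
  where open ≡-Reasoning

-- 1 for truth and 0 for falsity.
indicator : Bool → ℕ
indicator x = if x then 1 else 0

-- The equality indicator.
δ : ℕ → ℕ → ℕ
δ x y = indicator (does (x ≟ y))

δ-refl : ∀ x → δ x x ≡ 1
δ-refl x = cong indicator (dec-true (x ≟ x) refl)

δ-≢ : ∀ {x y} → x ≢ y → δ x y ≡ 0
δ-≢ {x} {y} x≢y = cong indicator (dec-false (x ≟ y) x≢y)

δ-sym : ∀ x y → δ x y ≡ δ y x
δ-sym x y with x ≟ y
... | yes refl = refl
... | no  x≢y  = trans (δ-≢ x≢y) (sym (δ-≢ (x≢y ∘ sym)))

∑-δ : ∀ n x (f : ℕ → ℕ) → x < n → ∑ n (λ i → δ x i * f i) ≡ f x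
∑-δ (suc n) zero f x<n = begin
  ∑ (suc n) (λ i → δ 0 i * f i)             ≡⟨ ∑-suc n _ ⟩
  f 0 + 0 + ∑ n (λ _ → 0)                   ≡⟨ cong₂ _+_ (+-identityʳ (f 0)) (trans (∑-const n 0) (*-zeroʳ n)) ⟩
  f 0 + 0                                   ≡⟨ +-identityʳ (f 0) ⟩
  f 0                                       ∎
  where open ≡-Reasoning
∑-δ (suc n) (suc x) f (s≤s x<n) = begin
  ∑ (suc n) (λ i → δ (suc x) i * f i)       ≡⟨ ∑-suc n (λ i → δ (suc x) i * f i) ⟩
  ∑ n (λ i → δ (suc x) (suc i) * f (suc i)) ≡⟨ ∑-δ n x (f ∘ suc) x<n ⟩
  f (suc x)                                 ∎
  where open ≡-Reasoning

-- The inequality indicator.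
ν : ℕ → ℕ → ℕ
ν x y = indicator (does (¬? (x ≟ y)))

ν-sym : ∀ x y → ν x y ≡ ν y x
ν-sym x y = +-cancelˡ-≡ (δ x y) _ _ (trans (complement x y) (trans (sym (complement y x)) (cong (_+ ν y x) (δ-sym y x))))
  where
  complement : ∀ x y → δ x y + ν x y ≡ 1
  complement x y with does (x ≟ y)
  ... | true  = refl
  ... | false = refl

∑-ν : ∀ {p q} → q < p → ∑ p (ν q) ≡ pred p
∑-ν {p} {q} q<p = cong pred (begin
  1 + ∑ p (ν q)                        ≡⟨ cong (_+ ∑ p (ν q)) (∑-δ p q (λ _ → 1) q<p) ⟨
  ∑ p (λ i → δ q i * 1) + ∑ p (ν q)    ≡⟨ ∑-+ p (λ i → δ q i * 1) (ν q) ⟨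
  ∑ p (λ i → δ q i * 1 + ν q i)        ≡⟨ ∑-cong p (λ i _ → complement i) ⟩
  ∑ p (λ _ → 1)                        ≡⟨ trans (∑-const p 1) (*-identityʳ p) ⟩
  p                                    ∎)
  where
  open ≡-Reasoning
  complement : ∀ i → δ q i * 1 + ν q i ≡ 1
  complement i with does (q ≟ i)
  ... | true  = refl
  ... | false = refl

-- Lists of accesses and their measures

concatMap-upTo-suc : ∀ {a} {A : Set a} (f : ℕ → List A) n →
  concatMap f (upTo (suc n)) ≡ f 0 ++ concatMap (f ∘ suc) (upTo n)
concatMap-upTo-suc f n = cong concat (map-upTo-suc f n)

concatMap-upTo-+ : ∀ {a} {A : Set a} (f : ℕ → List A) m n →
  concatMap f (upTo (m + n)) ≡ concatMap f (upTo m) ++ concatMap (λ i → f (m + i)) (upTo n)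
concatMap-upTo-+ f zero    n = refl
concatMap-upTo-+ f (suc m) n = begin
  concatMap f (upTo (suc (m + n)))
    ≡⟨ concatMap-upTo-suc f (m + n) ⟩
  f 0 ++ concatMap (f ∘ suc) (upTo (m + n))
    ≡⟨ cong (f 0 ++_) (concatMap-upTo-+ (f ∘ suc) m n) ⟩
  f 0 ++ concatMap (f ∘ suc) (upTo m) ++ concatMap (λ i → f (suc m + i)) (upTo n)
    ≡⟨ ++-assoc (f 0) _ _ ⟨
  (f 0 ++ concatMap (f ∘ suc) (upTo m)) ++ concatMap (λ i → f (suc m + i)) (upTo n)
    ≡⟨ cong (_++ concatMap (λ i → f (suc m + i)) (upTo n)) (concatMap-upTo-suc f m) ⟨
  concatMap f (upTo (suc m)) ++ concatMap (λ i → f (suc m + i)) (upTo n)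
    ∎
  where open ≡-Reasoning

All-concatMap-upTo : ∀ {a p} {A : Set a} {P : A → Set p} (f : ℕ → List A) n →
  (∀ i → i < n → All P (f i)) → All P (concatMap f (upTo n))
All-concatMap-upTo f n Pf = All.concat⁺ (All.map⁺ (All.applyUpTo⁺₁ (λ i → i) n (λ {i} → Pf i)))

length-concatMap-upTo : ∀ {a} {A : Set a} (f : ℕ → List A) n →
  length (concatMap f (upTo n)) ≡ ∑ n (length ∘ f)
length-concatMap-upTo f zero    = refl
length-concatMap-upTo f (suc n) = begin
  length (concatMap f (upTo (suc n)))                    ≡⟨ cong length (concatMap-upTo-suc f n) ⟩
  length (f 0 ++ concatMap (f ∘ suc) (upTo n))           ≡⟨ length-++ (f 0) ⟩
  length (f 0) + length (concatMap (f ∘ suc) (upTo n))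
    ≡⟨ cong (length (f 0) +_) (length-concatMap-upTo (f ∘ suc) n) ⟩
  length (f 0) + ∑ n (length ∘ f ∘ suc)                  ≡⟨ ∑-suc n (length ∘ f) ⟨
  ∑ (suc n) (length ∘ f)                                 ∎
  where open ≡-Reasoning

Any-concatMap-upTo : ∀ {a p} {A : Set a} {P : A → Set p} (f : ℕ → List A) {n i} → i < n →
  Any P (f i) → Any P (concatMap f (upTo n))
Any-concatMap-upTo f i<n Pfi = Any.concat⁺ (Any.map⁺ (Any.applyUpTo⁺ (λ i → i) Pfi i<n))

concatMap-concatMap : ∀ {a b d} {A : Set a} {B : Set b} {D : Set d} (f : B → List D) (g : A → List B) xs →
  concatMap f (concatMap g xs) ≡ concatMap (concatMap f ∘ g) xs
concatMap-concatMap f g []       = refl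
concatMap-concatMap f g (x ∷ xs) = trans (concatMap-++ f (g x) (concatMap g xs))
  (cong (concatMap f (g x) ++_) (concatMap-concatMap f g xs))

maximum-≤ : ∀ {X xs} → All (_≤ X) xs → maximum xs ≤ X
maximum-≤ []           = z≤n
maximum-≤ (x≤X ∷ xs≤X) = ⊔-lub x≤X (maximum-≤ xs≤X)

maximum-upTo-≤ : ∀ {X} f n → (∀ i → f i ≤ X) → maximum (map f (upTo n)) ≤ X
maximum-upTo-≤ f n f≤X = maximum-≤ (All.map⁺ (All.universal f≤X (upTo n)))

-- Positional notation

digit-mod : ∀ x b d .{{_ : NonZero b}} → d < b → (x * b + d) % b ≡ d
digit-mod x b d d<b = begin
  (x * b + d) % b ≡⟨ cong (_% b) (+-comm (x * b) d) ⟩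
  (d + x * b) % b ≡⟨ [m+kn]%n≡m%n d x b ⟩
  d % b           ≡⟨ m<n⇒m%n≡m d<b ⟩
  d               ∎
  where open ≡-Reasoning

digit-div : ∀ x b d .{{_ : NonZero b}} → d < b → (x * b + d) / b ≡ x
digit-div x b d d<b = begin
  (x * b + d) / b     ≡⟨ +-distrib-/-∣ˡ d (n∣m*n x) ⟩
  x * b / b + d / b   ≡⟨ cong₂ _+_ (m*n/n≡m x b) (m<n⇒m/n≡0 d<b) ⟩
  x + 0               ≡⟨ +-identityʳ x ⟩
  x                   ∎
  where open ≡-Reasoning

div-mod : ∀ n b .{{_ : NonZero b}} → n / b * b + n % b ≡ n
div-mod n b = trans (+-comm (n / b * b) (n % b)) (sym (m≡m%n+[m/n]*n n b))

row-bound : ∀ {i m j n} → i < m → j < n → i * n + j < m * n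
row-bound {i} {m} {j} {n} i<m j<n = begin-strict
  i * n + j   <⟨ +-monoʳ-< (i * n) j<n ⟩
  i * n + n   ≡⟨ +-comm (i * n) n ⟩
  suc i * n   ≤⟨ *-monoˡ-≤ n i<m ⟩
  m * n       ∎
  where open ≤-Reasoning

row-injective : ∀ i i′ {j j′ n} → j < n → j′ < n → i * n + j ≡ i′ * n + j′ → i ≡ i′ × j ≡ j′
row-injective i i′ {j} {j′} {n@(suc _)} j<n j′<n eq =
    trans (sym (digit-div i n j j<n)) (trans (cong (_/ n) eq) (digit-div i′ n j′ j′<n))
  , trans (sym (digit-mod i n j j<n)) (trans (cong (_% n) eq) (digit-mod i′ n j′ j′<n))

-- Digit reversal

module _ (b : ℕ) .{{_ : NonZero b}} where

  -- The low digits of the argument become the high digits of its reversal.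
  -- The high part a may be arbitrary: both sides ignore its digits beyond m₁.
  π-split : ∀ m₁ m₂ a c → c < b ^ m₂ →
    π b (m₁ + m₂) (a * b ^ m₂ + c) ≡ π b m₂ c * b ^ m₁ + π b m₁ a
  π-split m₁ zero a zero c<1
    rewrite +-identityʳ m₁ | *-identityʳ a | +-identityʳ a = refl
  π-split m₁ zero a (suc c) (s≤s ())
  π-split m₁ (suc m₂) a c c<b^m₂ = begin
    π b (m₁ + suc m₂) n                                      ≡⟨ cong (λ ℓ → π b ℓ n) (+-suc m₁ m₂) ⟩
    (n % b) * b ^ (m₁ + m₂) + π b (m₁ + m₂) (n / b)
      ≡⟨ cong₂ (λ d x → d * b ^ (m₁ + m₂) + π b (m₁ + m₂) x) n%b n/b ⟩
    d * b ^ (m₁ + m₂) + π b (m₁ + m₂) (a * b ^ m₂ + x)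
      ≡⟨ cong₂ _+_ (cong (d *_) (^-distribˡ-+-* b m₁ m₂)) (π-split m₁ m₂ a x x<) ⟩
    d * (b ^ m₁ * b ^ m₂) + (π b m₂ x * b ^ m₁ + π b m₁ a)   ≡⟨ regroup d (b ^ m₁) (b ^ m₂) (π b m₂ x) (π b m₁ a) ⟩
    (d * b ^ m₂ + π b m₂ x) * b ^ m₁ + π b m₁ a              ∎
    where
    open ≡-Reasoning
    n = a * b ^ suc m₂ + c
    d = c % b
    x = c / b
    digits : n ≡ (a * b ^ m₂ + x) * b + d
    digits = trans (cong (a * (b * b ^ m₂) +_) (sym (div-mod c b))) (shift a b (b ^ m₂) x d)
      where
      shift : ∀ a b e x d → a * (b * e) + (x * b + d) ≡ (a * e + x) * b + d
      shift = solve-∀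
    n%b : n % b ≡ d
    n%b = trans (cong (_% b) digits) (digit-mod (a * b ^ m₂ + x) b d (m%n<n c b))
    n/b : n / b ≡ a * b ^ m₂ + x
    n/b = trans (cong (_/ b) digits) (digit-div (a * b ^ m₂ + x) b d (m%n<n c b))
    x< : x < b ^ m₂
    x< = m<n*o⇒m/o<n (subst (c <_) (*-comm b (b ^ m₂)) c<b^m₂)
    regroup : ∀ d e f y z → d * (e * f) + (y * e + z) ≡ (d * f + y) * e + z
    regroup = solve-∀

  π-< : ∀ ℓ n → π b ℓ n < b ^ ℓ
  π-< zero    n = z<s
  π-< (suc ℓ) n = row-bound (m%n<n n b) (π-< ℓ (n / b))

  π-involutive : ∀ ℓ n → n < b ^ ℓ → π b ℓ (π b ℓ n) ≡ n
  π-involutive zero    zero    n<1 = refl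
  π-involutive zero    (suc n) (s≤s ())
  π-involutive (suc ℓ) n n< = begin
    π b (1 + ℓ) (d * b ^ ℓ + π b ℓ x)     ≡⟨ π-split 1 ℓ d (π b ℓ x) (π-< ℓ x) ⟩
    π b ℓ (π b ℓ x) * b ^ 1 + π b 1 d     ≡⟨ cong₂ (λ y e → y * e + π b 1 d) (π-involutive ℓ x x<) (*-identityʳ b) ⟩
    x * b + π b 1 d                       ≡⟨ cong (x * b +_) π₁ ⟩
    x * b + d                             ≡⟨ div-mod n b ⟩
    n                                     ∎
    where
    open ≡-Reasoning
    d = n % b
    x = n / b
    x< : x < b ^ ℓ
    x< = m<n*o⇒m/o<n (subst (n <_) (*-comm b (b ^ ℓ)) n<)
    π₁ : π b 1 d ≡ d
    π₁ = trans (+-identityʳ _) (trans (*-identityʳ _) (m<n⇒m%n≡m (m%n<n n b)))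

  -- Digit reversal permutes the range of a sum.
  ∑-π : ∀ ℓ f → ∑ (b ^ ℓ) (f ∘ π b ℓ) ≡ ∑ (b ^ ℓ) f
  ∑-π zero    f = refl
  ∑-π (suc ℓ) f = begin
    ∑ (b * b ^ ℓ) (f ∘ π b (suc ℓ))
      ≡⟨ cong (λ n → ∑ n (f ∘ π b (suc ℓ))) (*-comm b (b ^ ℓ)) ⟩
    ∑ (b ^ ℓ * b) (f ∘ π b (suc ℓ))                              ≡⟨ ∑-rows (b ^ ℓ) b _ ⟩
    ∑ (b ^ ℓ) (λ x → ∑ b (λ d → f (π b (suc ℓ) (x * b + d))))
      ≡⟨ ∑-cong (b ^ ℓ) (λ x _ → ∑-cong b λ d d<b → cong f (cong₂ (λ e y → e * b ^ ℓ + π b ℓ y) (digit-mod x b d d<b) (digit-div x b d d<b))) ⟩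
    ∑ (b ^ ℓ) (λ x → ∑ b (λ d → f (d * b ^ ℓ + π b ℓ x)))        ≡⟨ ∑-swap (b ^ ℓ) b _ ⟩
    ∑ b (λ d → ∑ (b ^ ℓ) (λ x → f (d * b ^ ℓ + π b ℓ x)))
      ≡⟨ ∑-cong b (λ d _ → ∑-π ℓ (λ y → f (d * b ^ ℓ + y))) ⟩
    ∑ b (λ d → ∑ (b ^ ℓ) (λ y → f (d * b ^ ℓ + y)))              ≡⟨ ∑-rows b (b ^ ℓ) f ⟨
    ∑ (b * b ^ ℓ) f                                              ∎
    where open ≡-Reasoning

  -- Advancing a counter through its whole range costs O(1) digits per step:
  -- the lowest digit changes always, and the others, in total, as often as
  -- in the range of the shorter counter.
  ∑-carries : ∀ ℓ → 2 ≤ b → ∑ (b ^ ℓ) (carries b ℓ) ≤ 2 * b ^ ℓ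
  ∑-carries zero    2≤b = z≤n
  ∑-carries (suc ℓ) 2≤b = begin
    ∑ (b * b ^ ℓ) (carries b (suc ℓ))
      ≡⟨ cong (λ n → ∑ n (carries b (suc ℓ))) (*-comm b (b ^ ℓ)) ⟩
    ∑ (b ^ ℓ * b) (carries b (suc ℓ))                               ≡⟨ ∑-rows (b ^ ℓ) b _ ⟩
    ∑ (b ^ ℓ) (λ x → ∑ b (λ d → carries b (suc ℓ) (x * b + d)))     ≡⟨ ∑-cong (b ^ ℓ) (λ x _ → inner x) ⟩
    ∑ (b ^ ℓ) (λ x → b * 1 + carries b ℓ x)                         ≡⟨ ∑-+ (b ^ ℓ) (λ _ → b * 1) (carries b ℓ) ⟩
    ∑ (b ^ ℓ) (λ _ → b * 1) + ∑ (b ^ ℓ) (carries b ℓ)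
      ≤⟨ +-mono-≤ (≤-reflexive (∑-const (b ^ ℓ) (b * 1))) (∑-carries ℓ 2≤b) ⟩
    b ^ ℓ * (b * 1) + 2 * b ^ ℓ
      ≤⟨ +-monoʳ-≤ (b ^ ℓ * (b * 1)) (*-monoˡ-≤ (b ^ ℓ) 2≤b) ⟩
    b ^ ℓ * (b * 1) + b * b ^ ℓ                                     ≡⟨ double b (b ^ ℓ) ⟩
    2 * (b * b ^ ℓ)                                                 ∎
    where
    open ≤-Reasoning
    double : ∀ b e → e * (b * 1) + b * e ≡ 2 * (b * e)
    double = solve-∀
    -- Only the largest digit, b - 1, causes a carry.
    last : ∀ d e → d < b → (if suc d ≡ᵇ b then e else 0) ≡ δ (pred b) d * e
    last d e d<b with suc d ≟ b
    ... | yes refl = trans (cong (if_then e else 0) (dec-true (suc d ≟ b) refl))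
                       (sym (trans (cong (_* e) (δ-refl d)) (+-identityʳ e)))
    ... | no  d≢   = trans (cong (if_then e else 0) (dec-false (suc d ≟ b) d≢))
                       (sym (cong (_* e) (δ-≢ λ b≡ → d≢ (trans (cong suc (sym b≡)) (suc-pred b)))))
    inner : ∀ x → ∑ b (λ d → carries b (suc ℓ) (x * b + d)) ≡ b * 1 + carries b ℓ x
    inner x = begin-equality
      ∑ b (λ d → carries b (suc ℓ) (x * b + d))              ≡⟨ ∑-cong b (λ d d<b → trans
                                                                  (cong₂ (λ e y → suc (if suc e ≡ᵇ b then carries b ℓ y else 0)) (digit-mod x b d d<b) (digit-div x b d d<b))
                                                                  (cong suc (last d (carries b ℓ x) d<b))) ⟩
      ∑ b (λ d → 1 + δ (pred b) d * carries b ℓ x)           ≡⟨ ∑-+ b (λ _ → 1) _ ⟩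
      ∑ b (λ _ → 1) + ∑ b (λ d → δ (pred b) d * carries b ℓ x)
        ≡⟨ cong₂ _+_ (∑-const b 1) (∑-δ b (pred b) (λ _ → carries b ℓ x) (≤-reflexive (suc-pred b))) ⟩
      b * 1 + carries b ℓ x                                  ∎

-- Optimal caching

module _ (k : ℕ) where

  foldr-⊓-≤ : ∀ e xs → foldr _⊓_ e xs ≤ e
  foldr-⊓-≤ e []       = ≤-refl
  foldr-⊓-≤ e (x ∷ xs) = ≤-trans (m⊓n≤n x (foldr _⊓_ e xs)) (foldr-⊓-≤ e xs)

  -- A request is a hit, or is loaded into a free line, or finds the cache
  -- full, in which case emptying the cache is one of the options.
  serve : ∀ c x xs →
      (x ∈ c × misses k c (x ∷ xs) ≤ misses k c xs)
    ⊎ (x ∉ c × length c < k × misses k c (x ∷ xs) ≤ suc (misses k (x ∷ c) xs))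
    ⊎ (x ∉ c × k ≤ length c × misses k c (x ∷ xs) ≤ suc (misses k [] xs))
  serve c x xs with x ∈? c
  ... | yes x∈c = inj₁ (x∈c , ≤-refl)
  ... | no  x∉c with length c <ᵇ k in eq
  ...   | true  = inj₂ (inj₁ (x∉c , <ᵇ⇒< (length c) k (subst Bool.T (sym eq) _) , ≤-refl))
  ...   | false = inj₂ (inj₂ (x∉c , ≮⇒≥ (λ c<k → subst Bool.T eq (<⇒<ᵇ c<k)) ,
    s≤s (foldr-⊓-≤ (misses k [] xs) (map (λ c′ → misses k (x ∷ c′) xs) (removals c)))))

  -- Serving xs costs at most n misses, whatever the cache holds before and
  -- whatever requests follow.  Quantifying over both makes the bounds additive
  -- under concatenation.
  record Bounded (n : ℕ) (xs : List Loc) : Set where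
    field
      prepend : ∀ ys e → (∀ c → misses k c ys ≤ e) → ∀ c → misses k c (xs ++ ys) ≤ n + e

  open Bounded

  bounded⇒misses : ∀ {n xs} → Bounded n xs → misses k [] xs ≤ n
  bounded⇒misses {n} {xs} bd = subst₂ _≤_ (cong (misses k []) (++-identityʳ xs)) (+-identityʳ n)
    (prepend bd [] 0 (λ c → z≤n) [])

  bounded-++ : ∀ {m n xs ys} → Bounded m xs → Bounded n ys → Bounded (m + n) (xs ++ ys)
  prepend (bounded-++ {m} {n} {xs} {ys} bx by) zs e bz c = begin
    misses k c ((xs ++ ys) ++ zs) ≡⟨ cong (misses k c) (++-assoc xs ys zs) ⟩
    misses k c (xs ++ ys ++ zs)   ≤⟨ prepend bx (ys ++ zs) (n + e) (prepend by zs e bz) c ⟩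
    m + (n + e)                   ≡⟨ +-assoc m n e ⟨
    m + n + e                     ∎
    where open ≤-Reasoning

  -- Each request misses at most once.
  bounded-length : ∀ xs → Bounded (length xs) xs
  prepend (bounded-length []) ys e bd c = bd c
  prepend (bounded-length (x ∷ xs)) ys e bd c with serve c x (xs ++ ys)
  ... | inj₁ (_ , hit)             = ≤-trans hit (m≤n⇒m≤1+n (prepend (bounded-length xs) ys e bd c))
  ... | inj₂ (inj₁ (_ , _ , load)) = ≤-trans load (s≤s (prepend (bounded-length xs) ys e bd (x ∷ c)))
  ... | inj₂ (inj₂ (_ , _ , flush))  = ≤-trans flush (s≤s (prepend (bounded-length xs) ys e bd []))

  -- The list without one occurrence of x.
  remove : ∀ {x} {xs : List Loc} → x ∈ xs →
    ∃[ xs′ ] (length xs ≡ suc (length xs′)) × (∀ {z} → z ∈ xs → z ≡ x ⊎ z ∈ xs′)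
  remove {x} {_ ∷ xs} (here refl) = xs , refl , λ { (here z≡x) → inj₁ z≡x ; (there z∈xs) → inj₂ z∈xs }
  remove {x} {y ∷ xs} (there x∈xs) with remove x∈xs
  ... | xs′ , len , split = y ∷ xs′ , cong suc len , λ
    { (here z≡y)   → inj₂ (here z≡y)
    ; (there z∈xs) → Sum.map₂ there (split z∈xs) }

  -- If every request is in the cache or in a list R for which there is room,
  -- then each line of R is loaded at most once.
  misses-room : ∀ {ys e} → (∀ c → misses k c ys ≤ e) → ∀ {c R} xs → length c + length R ≤ k →
    All (λ x → x ∈ c ⊎ x ∈ R) xs → misses k c (xs ++ ys) ≤ length R + e
  misses-room {ys} {e} bd {c} {R} [] room [] = ≤-trans (bd c) (m≤n+m e (length R))
  misses-room {ys} {e} bd {c} {R} (x ∷ xs) room (px ∷ pxs) with serve c x (xs ++ ys) | px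
  ... | inj₁ (_ , hit)             | _        = ≤-trans hit (misses-room bd xs room pxs)
  ... | inj₂ (inj₁ (x∉c , _))      | inj₁ x∈c = contradiction x∈c x∉c
  ... | inj₂ (inj₂ (x∉c , _))      | inj₁ x∈c = contradiction x∈c x∉c
  -- As R contains x, the room for R rules out a full cache.
  ... | inj₂ (inj₂ (_ , full , _)) | inj₂ x∈R = contradiction full (<⇒≱ (≤-trans
    (s≤s (m≤m+n (length c) _)) (subst (_≤ k) (trans (cong (length c +_) (proj₁ (proj₂ (remove x∈R)))) (+-suc (length c) _)) room)))
  ... | inj₂ (inj₁ (_ , _ , load)) | inj₂ x∈R with remove x∈R
  ...   | R′ , len , split = begin
    misses k c (x ∷ xs ++ ys)         ≤⟨ load ⟩
    suc (misses k (x ∷ c) (xs ++ ys)) ≤⟨ s≤s (misses-room bd xs room′ (All.map retain pxs)) ⟩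
    suc (length R′ + e)               ≡⟨ cong (_+ e) len ⟨
    length R + e                      ∎
    where
    open ≤-Reasoning
    room′ : suc (length c) + length R′ ≤ k
    room′ = subst (_≤ k) (trans (cong (length c +_) len) (+-suc (length c) (length R′))) room
    retain : ∀ {z} → z ∈ c ⊎ z ∈ R → z ∈ x ∷ c ⊎ z ∈ R′
    retain (inj₁ z∈c) = inj₁ (there z∈c)
    retain (inj₂ z∈R) = Sum.map₁ here (split z∈R)

  -- The same without room for R, for requests in a list D that fits into the
  -- empty cache: when the cache is full it is emptied, and this happens once.
  misses-emptying : ∀ {ys e} → (∀ c → misses k c ys ≤ e) → ∀ {D} → length D ≤ k → ∀ {c R} xs →
    All (_∈ D) xs → All (λ x → x ∈ c ⊎ x ∈ R) xs →
    misses k c (xs ++ ys) ≤ length R + (suc (length D) + e)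
  misses-emptying {ys} {e} bd {D} D≤k {c} {R} [] [] [] =
    ≤-trans (bd c) (≤-trans (m≤n+m e (suc (length D))) (m≤n+m (suc (length D) + e) (length R)))
  misses-emptying {ys} {e} bd {D} D≤k {c} {R} (x ∷ xs) (_ ∷ xs∈D) (px ∷ pxs)
    with serve c x (xs ++ ys) | px
  ... | inj₁ (_ , hit)          | _        = ≤-trans hit (misses-emptying bd D≤k xs xs∈D pxs)
  ... | inj₂ (inj₁ (x∉c , _))   | inj₁ x∈c = contradiction x∈c x∉c
  ... | inj₂ (inj₂ (_ , _ , flush)) | _ = begin
    misses k c (x ∷ xs ++ ys)       ≤⟨ flush ⟩
    suc (misses k [] (xs ++ ys))    ≤⟨ s≤s (misses-room bd xs D≤k (All.map inj₂ xs∈D)) ⟩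
    suc (length D) + e              ≤⟨ m≤n+m (suc (length D) + e) (length R) ⟩
    length R + (suc (length D) + e) ∎
    where open ≤-Reasoning
  ... | inj₂ (inj₁ (_ , _ , load)) | inj₂ x∈R with remove x∈R
  ...   | R′ , len , split = begin
    misses k c (x ∷ xs ++ ys)              ≤⟨ load ⟩
    suc (misses k (x ∷ c) (xs ++ ys))      ≤⟨ s≤s (misses-emptying bd D≤k xs xs∈D (All.map retain pxs)) ⟩
    suc (length R′ + (suc (length D) + e)) ≡⟨ cong (_+ (suc (length D) + e)) len ⟨
    length R + (suc (length D) + e)        ∎
    where
    open ≤-Reasoning
    retain : ∀ {z} → z ∈ c ⊎ z ∈ R → z ∈ x ∷ c ⊎ z ∈ R′
    retain (inj₁ z∈c) = inj₁ (there z∈c)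
    retain (inj₂ z∈R) = Sum.map₁ here (split z∈R)

  -- Requests confined to a list D of lines that fits into the cache: at most
  -- length D misses before the cache is emptied, one at that moment, and
  -- length D afterwards.
  bounded-workingSet : ∀ {D xs} → length D ≤ k → All (_∈ D) xs → Bounded (2 * length D + 1) xs
  prepend (bounded-workingSet {D} {xs} D≤k xs∈D) ys e bd c = begin
    misses k c (xs ++ ys)            ≤⟨ misses-emptying bd D≤k xs xs∈D (All.map inj₂ xs∈D) ⟩
    length D + (suc (length D) + e)  ≡⟨ regroup (length D) e ⟩
    2 * length D + 1 + e             ∎
    where
    open ≤-Reasoning
    regroup : ∀ d e → d + (suc d + e) ≡ 2 * d + 1 + e
    regroup = solve-∀

-- The cost of scans

module _ (k B : ℕ) .{{_ : NonZero B}} where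

  -- The accesses ls cost at most X / B misses in a cache of k lines of B
  -- items.  Bounding the product with B avoids rounding.
  record Cost (X : ℕ) (ls : List Loc) : Set where
    constructor cost
    field
      count       : ℕ
      count≤      : count * B ≤ X
      is-bounded  : Bounded k count (map (line B) ls)

  cost-[] : Cost 0 []
  cost-[] = cost 0 z≤n (bounded-length k [])

  cost-≤ : ∀ {X Y ls} → X ≤ Y → Cost X ls → Cost Y ls
  cost-≤ X≤Y (cost n n≤X bd) = cost n (≤-trans n≤X X≤Y) bd

  cost-++ : ∀ {X Y ls ls′} → Cost X ls → Cost Y ls′ → Cost (X + Y) (ls ++ ls′)
  cost-++ {X} {Y} {ls} {ls′} (cost m m≤X bm) (cost n n≤Y bn) = cost (m + n)
    (≤-trans (≤-reflexive (*-distribʳ-+ B m n)) (+-mono-≤ m≤X n≤Y))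
    (subst (Bounded k (m + n)) (sym (map-++ (line B) ls ls′)) (bounded-++ k bm bn))

  cost-concatMap : ∀ X f n → (∀ i → i < n → Cost (X i) (f i)) → Cost (∑ n X) (concatMap f (upTo n))
  cost-concatMap X f zero    cf = cost-[]
  cost-concatMap X f (suc n) cf = subst₂ Cost (sym (∑-suc n X)) (sym (concatMap-upTo-suc f n))
    (cost-++ (cf 0 z<s) (cost-concatMap (X ∘ suc) (f ∘ suc) n (λ i i<n → cf (suc i) (s<s i<n))))

  cost-concatMap-const : ∀ X f n → (∀ i → i < n → Cost X (f i)) → Cost (n * X) (concatMap f (upTo n))
  cost-concatMap-const X f n cf = cost-≤ (≤-reflexive (∑-const n X)) (cost-concatMap (λ _ → X) f n cf)

  cost-length : ∀ ls → Cost (length ls * B) ls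
  cost-length ls = cost (length ls) ≤-refl (subst (λ n → Bounded k n (map (line B) ls))
    (length-map (line B) ls) (bounded-length k (map (line B) ls)))

  cost-workingSet : ∀ {D ls} → length D ≤ k → All (λ l → line B l ∈ D) ls →
    Cost ((2 * length D + 1) * B) ls
  cost-workingSet {D} D≤k ls∈D = cost (2 * length D + 1) ≤-refl (bounded-workingSet k D≤k (All.map⁺ ls∈D))

  -- A line and its successor: they cover the B items from any item of the
  -- first on.
  twoLines : Loc → List Loc
  twoLines (ρ , n) = (ρ , n) ∷ (ρ , suc n) ∷ []

  line-near : ∀ ρ s i → i < B → line B (ρ , s + i) ∈ twoLines (line B (ρ , s))
  line-near ρ s i i<B with m≤n⇒m<n∨m≡n lower
    where
    lower : s / B ≤ (s + i) / B
    lower = /-monoˡ-≤ B (m≤m+n s i)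
  ... | inj₂ same = here (cong (ρ ,_) (sym same))
  ... | inj₁ next = there (here (cong (ρ ,_) (≤-antisym upper next)))
    where
    open ≤-Reasoning
    upper : (s + i) / B ≤ suc (s / B)
    upper = begin
      (s + i) / B        ≤⟨ /-monoˡ-≤ B (+-monoʳ-≤ s (<⇒≤ i<B)) ⟩
      (s + B) / B        ≡⟨ +-distrib-/-∣ʳ s ∣-refl ⟩
      s / B + B / B      ≡⟨ cong (s / B +_) (n/n≡1 B) ⟩
      s / B + 1          ≡⟨ +-comm (s / B) 1 ⟩
      suc (s / B)        ∎

  -- A stream of accesses moving through at most two lines in B steps.
  Slow : (ℕ → Loc) → Set
  Slow g = ∀ j i → i < B → line B (g (j + i)) ∈ twoLines (line B (g j))

  slow-scan : ∀ ρ s → Slow (λ j → ρ , s + j)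
  slow-scan ρ s j i i<B = subst (λ n → line B (ρ , n) ∈ twoLines (line B (ρ , s + j)))
    (+-assoc s j i) (line-near ρ (s + j) i i<B)

  slow-const : ∀ l → Slow (λ _ → l)
  slow-const l j i i<B = here refl

  slow-shift : ∀ {g} m → Slow g → Slow (g ∘ (m +_))
  slow-shift {g} m slow j i i<B = subst (λ n → line B (g n) ∈ twoLines (line B (g (m + j))))
    (+-assoc m j i) (slow (m + j) i i<B)

  -- Step j of f makes accesses only at the j-th locations of the streams σ.
  Follows : List (ℕ → Loc) → ℕ → (ℕ → List Loc) → Set
  Follows σ n f = ∀ j → j < n → All (λ l → Any (λ g → l ≡ g j) σ) (f j)

  private
    -- The lines met by the streams in their first B steps.
    heads : List (ℕ → Loc) → List Loc
    heads σ = concatMap (λ g → twoLines (line B (g 0))) σ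

    length-heads : ∀ σ → length (heads σ) ≡ 2 * length σ
    length-heads []      = refl
    length-heads (g ∷ σ) = trans (cong (2 +_) (length-heads σ)) (sym (*-suc 2 (length σ)))

    ∈-heads : ∀ {σ l j} → All Slow σ → j < B → Any (λ g → l ≡ g j) σ → line B l ∈ heads σ
    ∈-heads (slow ∷ _)         j<B (here refl) = ∈-++⁺ˡ (slow 0 _ j<B)
    ∈-heads {g ∷ σ} (_ ∷ slows) j<B (there l∈) = ∈-++⁺ʳ (twoLines (line B (g 0))) (∈-heads slows j<B l∈)

  -- A chunk of at most B steps has a working set of two lines per stream.
  cost-chunk : ∀ {σ f n} → 2 * length σ ≤ k → All Slow σ → n ≤ B → Follows σ n f →
    Cost ((4 * length σ + 1) * B) (concatMap f (upTo n))
  cost-chunk {σ} {f} {n} fits slows n≤B follows = subst (λ d → Cost ((d + 1) * B) (concatMap f (upTo n)))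
    (trans (cong (2 *_) (length-heads σ)) (sym (*-assoc 2 2 (length σ))))
    (cost-workingSet {heads σ} (subst (_≤ k) (sym (length-heads σ)) fits)
      (All-concatMap-upTo f n λ j j<n → All.map (∈-heads slows (≤-trans j<n n≤B)) (follows j j<n)))

  cost-chunks : ∀ q {σ f n} → 2 * length σ ≤ k → All Slow σ → n ≤ q * B → Follows σ n f →
    Cost (q * ((4 * length σ + 1) * B)) (concatMap f (upTo n))
  cost-chunks zero    {n = zero} fits slows n≤ follows = cost-[]
  cost-chunks (suc q) {σ} {f} {n} fits slows n≤ follows with n ≤? B
  ... | yes n≤B = cost-≤ (m≤m+n _ _) (cost-chunk fits slows n≤B follows)
  ... | no  n≰B = subst (λ n → Cost (suc q * ((4 * length σ + 1) * B)) (concatMap f (upTo n))) B+n′≡n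
    (subst (Cost _) (sym (concatMap-upTo-+ f B n′))
      (cost-++ (cost-chunk fits slows ≤-refl (λ j j<B → follows j (≤-trans j<B B≤n)))
        (subst (λ s → Cost (q * ((4 * s + 1) * B)) (concatMap (λ i → f (B + i)) (upTo n′)))
          (length-map (_∘ (B +_)) σ)
          (cost-chunks q {map (_∘ (B +_)) σ}
            (subst (λ s → 2 * s ≤ k) (sym (length-map (_∘ (B +_)) σ)) fits)
            (All.map⁺ (All.map (λ {g} → slow-shift {g} B) slows))
            (+-cancelˡ-≤ B n′ (q * B) (subst (_≤ B + q * B) (sym B+n′≡n) n≤))
            (λ j j<n′ → All.map Any.map⁺ (follows (B + j) (subst (B + j <_) B+n′≡n (+-monoʳ-< B j<n′))))))))
    where
    B≤n : B ≤ n
    B≤n = <⇒≤ (≰⇒> n≰B)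
    n′ = n ∸ B
    B+n′≡n : B + n′ ≡ n
    B+n′≡n = m+[n∸m]≡n B≤n

  -- A loop of n ≥ B steps along at most three streams: each chunk of B steps
  -- has at most six lines in its working set and so at most 13 misses, and
  -- there are at most n / B + 1 chunks, where B + n is at most 2 n.
  cost-scan : ∀ {σ f n} → length σ ≤ 3 → 6 ≤ k → All Slow σ → B ≤ n → Follows σ n f →
    Cost (26 * n) (concatMap f (upTo n))
  cost-scan {σ} {f} {n} σ≤3 6≤k slows B≤n follows = cost-≤ bound
    (cost-chunks (suc (n / B)) (≤-trans (*-monoʳ-≤ 2 σ≤3) 6≤k) slows
      (begin
        n                 ≡⟨ div-mod n B ⟨
        n / B * B + n % B ≤⟨ +-monoʳ-≤ (n / B * B) (m%n≤n n B) ⟩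
        n / B * B + B     ≡⟨ +-comm (n / B * B) B ⟩
        suc (n / B) * B   ∎)
      follows)
    where
    open ≤-Reasoning
    bound : suc (n / B) * ((4 * length σ + 1) * B) ≤ 26 * n
    bound = begin
      suc (n / B) * ((4 * length σ + 1) * B)
        ≤⟨ *-monoʳ-≤ (suc (n / B)) (*-monoˡ-≤ B (+-monoˡ-≤ 1 (*-monoʳ-≤ 4 σ≤3))) ⟩
      suc (n / B) * (13 * B)                 ≡⟨ regroup (n / B) B ⟩
      13 * (B + n / B * B)                   ≤⟨ *-monoʳ-≤ 13 (+-mono-≤ B≤n (m/n*n≤m n B)) ⟩
      13 * (n + n)                           ≡⟨ double n ⟩
      26 * n                                 ∎
      where
      regroup : ∀ x y → suc x * (13 * y) ≡ 13 * (y + x * y)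
      regroup = solve-∀
      double : ∀ n → 13 * (n + n) ≡ 26 * n
      double = solve-∀

-- Sizes of programs and their accesses

-- Every instruction that accesses memory does so twice and counts as a move.
length-accesses-≤ : ∀ P → length (accesses P) ≤ 2 * moves P
length-accesses-≤ skip             = z≤n
length-accesses-≤ (mov dst src)    = ≤-refl
length-accesses-≤ (twid dst src e) = ≤-refl
length-accesses-≤ (tick n)         = z≤n
length-accesses-≤ (P ⨾ Q)          = begin
  length (accesses P ++ accesses Q)         ≡⟨ length-++ (accesses P) ⟩
  length (accesses P) + length (accesses Q) ≤⟨ +-mono-≤ (length-accesses-≤ P) (length-accesses-≤ Q) ⟩
  2 * moves P + 2 * moves Q                 ≡⟨ *-distribˡ-+ 2 (moves P) (moves Q) ⟨
  2 * (moves P + moves Q)                   ∎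
  where open ≤-Reasoning
length-accesses-≤ (for n f)        = begin
  length (concatMap (accesses ∘ f) (upTo n)) ≡⟨ length-concatMap-upTo (accesses ∘ f) n ⟩
  ∑ n (length ∘ accesses ∘ f)
    ≤⟨ ∑-mono n (λ i _ → ≤-trans (length-accesses-≤ (f i)) (*-monoʳ-≤ 2 (n≤1+n (moves (f i))))) ⟩
  ∑ n (λ i → 2 * suc (moves (f i)))          ≡⟨ ∑-cong n (λ i _ → *-comm 2 (suc (moves (f i)))) ⟩
  ∑ n (λ i → suc (moves (f i)) * 2)          ≡⟨ ∑-*ʳ n (λ i → suc (moves (f i))) 2 ⟩
  ∑ n (λ i → suc (moves (f i))) * 2          ≡⟨ *-comm (∑ n (λ i → suc (moves (f i)))) 2 ⟩
  2 * ∑ n (λ i → suc (moves (f i)))          ∎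
  where open ≤-Reasoning
length-accesses-≤ (call k P)       = ≤-trans (length-accesses-≤ P) (*-monoʳ-≤ 2 (n≤1+n (moves P)))

-- Locations within an input and an output array of n items, a scratch array
-- of s items and the temporary item.
Within : (n s : ℕ) → Loc → Set
Within n s (input   , i) = i < n
Within n s (output  , i) = i < n
Within n s (scratch , i) = i < s
Within n s (temp    , i) = i < 1

regionSize : (n s : ℕ) → Region → ℕ
regionSize n s input   = n
regionSize n s output  = n
regionSize n s scratch = s
regionSize n s temp    = 1

extent-≤ : ∀ {n s} ρ {ls} → All (Within n s) ls → extent ρ ls ≤ regionSize n s ρ
extent-≤ {n} {s} ρ within = maximum-≤ (All.map⁺ (All.map (λ {l} → bound ρ l) within))
  where
  bound : ∀ ρ l → Within n s l → (if does (proj₁ l Fin.≟ ρ) then suc (proj₂ l) else 0) ≤ regionSize n s ρ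
  bound input   (input   , i) w = w
  bound input   (output  , i) w = z≤n
  bound input   (scratch , i) w = z≤n
  bound input   (temp    , i) w = z≤n
  bound output  (input   , i) w = z≤n
  bound output  (output  , i) w = w
  bound output  (scratch , i) w = z≤n
  bound output  (temp    , i) w = z≤n
  bound scratch (input   , i) w = z≤n
  bound scratch (output  , i) w = z≤n
  bound scratch (scratch , i) w = w
  bound scratch (temp    , i) w = z≤n
  bound temp    (input   , i) w = z≤n
  bound temp    (output  , i) w = z≤n
  bound temp    (scratch , i) w = z≤n
  bound temp    (temp    , i) w = w

-- Row permutations

-- The step of pack for rows a and v = π a.
packRow : (c q a v : ℕ) → Prog
packRow c q a v =
  if a <ᵇ v then
    for c (λ j → mov tmp (cell input c a j)
               ⨾ twid (cell input c a j) (cell input c v j) (a * (q * c + j))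
               ⨾ twid (cell input c v j) tmp                (v * (q * c + j)))
  else if a ≡ᵇ v then
    for c (λ j → twid (cell input c v j) (cell input c v j) (v * (q * c + j)))
  else skip

-- The step of unpack for rows a and u = π a.
swapRow : (r a u : ℕ) → Prog
swapRow r a u =
  if a <ᵇ u then
    for r (λ j → mov tmp (cell output r a j)
               ⨾ mov (cell output r a j) (cell output r u j)
               ⨾ mov (cell output r u j) tmp)
  else skip

packRow-< : ∀ c q {a v} → a < v → packRow c q a v ≡
  for c (λ j → mov tmp (cell input c a j)
             ⨾ twid (cell input c a j) (cell input c v j) (a * (q * c + j))
             ⨾ twid (cell input c v j) tmp                (v * (q * c + j)))
packRow-< c q {a} {v} a<v rewrite dec-true (a <? v) a<v = refl

packRow-≡ : ∀ c q a → packRow c q a a ≡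
  for c (λ j → twid (cell input c a j) (cell input c a j) (a * (q * c + j)))
packRow-≡ c q a rewrite dec-false (a <? a) (<-irrefl refl) | dec-true (a ≟ a) refl = refl

packRow-> : ∀ c q {a v} → v < a → packRow c q a v ≡ skip
packRow-> c q {a} {v} v<a rewrite dec-false (a <? v) (<-asym v<a) | dec-false (a ≟ v) (<⇒≢ v<a ∘ sym) = refl

swapRow-< : ∀ r {a u} → a < u → swapRow r a u ≡
  for r (λ j → mov tmp (cell output r a j)
             ⨾ mov (cell output r a j) (cell output r u j)
             ⨾ mov (cell output r u j) tmp)
swapRow-< r {a} {u} a<u rewrite dec-true (a <? u) a<u = refl

swapRow-≥ : ∀ r {a u} → u ≤ a → swapRow r a u ≡ skip
swapRow-≥ r {a} {u} u≤a rewrite dec-false (a <? u) (≤⇒≯ u≤a) = refl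

-- Case distinctions for proving a property of a row step.
packRow-cases : ∀ {ℓ} (P : Prog → Set ℓ) c q a v →
  (a < v → P (for c (λ j → mov tmp (cell input c a j)
             ⨾ twid (cell input c a j) (cell input c v j) (a * (q * c + j))
             ⨾ twid (cell input c v j) tmp                (v * (q * c + j))))) →
  (a ≡ v → P (for c (λ j → twid (cell input c v j) (cell input c v j) (v * (q * c + j))))) →
  (v < a → P skip) →
  P (packRow c q a v)
packRow-cases P c q a v lt eq gt with <-cmp a v
... | tri< a<v _ _  = subst P (sym (packRow-< c q a<v)) (lt a<v)
... | tri≈ _ refl _ = subst P (sym (packRow-≡ c q a)) (eq refl)
... | tri> _ _ v<a  = subst P (sym (packRow-> c q v<a)) (gt v<a)

swapRow-cases : ∀ {ℓ} (P : Prog → Set ℓ) r a u →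
  (a < u → P (for r (λ j → mov tmp (cell output r a j)
             ⨾ mov (cell output r a j) (cell output r u j)
             ⨾ mov (cell output r u j) tmp))) →
  (u ≤ a → P skip) →
  P (swapRow r a u)
swapRow-cases P r a u lt ge with a <? u
... | yes a<u = subst P (sym (swapRow-< r a<u)) (lt a<u)
... | no  a≮u = subst P (sym (swapRow-≥ r (≮⇒≥ a≮u))) (ge (≮⇒≥ a≮u))

moves-packRow : ∀ c q a v → moves (packRow c q a v) ≤ 4 * c
moves-packRow c q a v = packRow-cases (λ P → moves P ≤ 4 * c) c q a v
  (λ _ → ≤-reflexive (trans (∑-const c 4) (*-comm c 4)))
  (λ _ → ≤-trans (≤-reflexive (trans (∑-const c 2) (*-comm c 2))) (*-monoˡ-≤ c {2} {4} (s≤s (s≤s z≤n))))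
  (λ _ → z≤n)

moves-swapRow : ∀ r a u → moves (swapRow r a u) ≤ 4 * r
moves-swapRow r a u = swapRow-cases (λ P → moves P ≤ 4 * r) r a u
  (λ _ → ≤-reflexive (trans (∑-const r 4) (*-comm r 4)))
  (λ _ → z≤n)

control-packRow : ∀ c q a v → control (packRow c q a v) ≤ 1
control-packRow c q a v = packRow-cases (λ P → control P ≤ 1) c q a v
  (λ _ → s≤s (maximum-upTo-≤ _ c (λ _ → z≤n))) (λ _ → s≤s (maximum-upTo-≤ _ c (λ _ → z≤n))) (λ _ → z≤n)

control-swapRow : ∀ r a u → control (swapRow r a u) ≤ 1
control-swapRow r a u = swapRow-cases (λ P → control P ≤ 1) r a u
  (λ _ → s≤s (maximum-upTo-≤ _ r (λ _ → z≤n))) (λ _ → z≤n)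

within-packRow : ∀ {m c s} q {a v} → a < m → v < m → All (Within (m * c) s) (accesses (packRow c q a v))
within-packRow {m} {c} {s} q {a} {v} a<m v<m = packRow-cases (λ P → All (Within (m * c) s) (accesses P)) c q a v
  (λ _ → All-concatMap-upTo _ c λ j j<c →
     row-bound a<m j<c ∷ z<s ∷ row-bound v<m j<c ∷ row-bound a<m j<c ∷ z<s ∷ row-bound v<m j<c ∷ [])
  (λ _ → All-concatMap-upTo _ c λ j j<c → row-bound v<m j<c ∷ row-bound v<m j<c ∷ [])
  (λ _ → [])

within-swapRow : ∀ {m r s a u} → a < m → u < m → All (Within (m * r) s) (accesses (swapRow r a u))
within-swapRow {m} {r} {s} {a} {u} a<m u<m = swapRow-cases (λ P → All (Within (m * r) s) (accesses P)) r a u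
  (λ _ → All-concatMap-upTo _ r λ j j<r →
     row-bound a<m j<r ∷ z<s ∷ row-bound u<m j<r ∷ row-bound a<m j<r ∷ z<s ∷ row-bound u<m j<r ∷ [])
  (λ _ → [])

module _ {k B : ℕ} .{{_ : NonZero B}} (6≤k : 6 ≤ k) where

  private
    cost-rows : ∀ {ρ n a v f} → B ≤ n →
      Follows k B ((λ j → cell ρ n a j) ∷ (λ j → cell ρ n v j) ∷ (λ _ → tmp) ∷ []) n f →
      Cost k B (26 * n) (concatMap f (upTo n))
    cost-rows {ρ} {n} {a} {v} B≤n = cost-scan k B ≤-refl 6≤k
      (slow-scan k B ρ (a * n) ∷ slow-scan k B ρ (v * n) ∷ slow-const k B tmp ∷ []) B≤n

  cost-packRow : ∀ {c} q a v → B ≤ c → Cost k B (26 * c) (accesses (packRow c q a v))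
  cost-packRow {c} q a v B≤c = packRow-cases (λ P → Cost k B (26 * c) (accesses P)) c q a v
    (λ _ → cost-rows {input} {c} {a} {v} B≤c λ j _ →
       here refl ∷ there (there (here refl)) ∷ there (here refl) ∷ here refl ∷ there (there (here refl)) ∷ there (here refl) ∷ [])
    (λ _ → cost-rows {input} {c} {v} {v} B≤c λ j _ → here refl ∷ here refl ∷ [])
    (λ _ → cost-≤ k B z≤n (cost-[] k B))

  cost-swapRow : ∀ {r} a u → B ≤ r → Cost k B (26 * r) (accesses (swapRow r a u))
  cost-swapRow {r} a u B≤r = swapRow-cases (λ P → Cost k B (26 * r) (accesses P)) r a u
    (λ _ → cost-rows {output} {r} {a} {u} B≤r λ j _ →
       here refl ∷ there (there (here refl)) ∷ there (here refl) ∷ here refl ∷ there (there (here refl)) ∷ there (here refl) ∷ [])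
    (λ _ → cost-≤ k B z≤n (cost-[] k B))

module _ (b : ℕ) .{{_ : NonZero b}} (ℓ : ℕ) where

  -- Up to four moves per entry, and one iteration and at most two changes of
  -- digits per row on average.
  moves-forRows : ∀ body {n} → 2 ≤ b → 1 ≤ n → (∀ a v → moves (body a v) ≤ 4 * n) →
    moves (forRows b ℓ body) ≤ 8 * (b ^ ℓ * n)
  moves-forRows body {n} 2≤b 1≤n body≤ = begin
    suc (∑ (b ^ ℓ) (λ a → suc (carries b ℓ a + moves (body a (π b ℓ a)))))
      ≤⟨ s≤s (∑-mono (b ^ ℓ) (λ a _ → s≤s (+-monoʳ-≤ (carries b ℓ a) (body≤ a (π b ℓ a))))) ⟩
    suc (∑ (b ^ ℓ) (λ a → suc (carries b ℓ a + 4 * n)))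
      ≡⟨ cong suc (∑-cong (b ^ ℓ) (λ a _ → sym (+-suc (carries b ℓ a) (4 * n)))) ⟩
    suc (∑ (b ^ ℓ) (λ a → carries b ℓ a + suc (4 * n)))
      ≡⟨ cong suc (∑-+ (b ^ ℓ) (carries b ℓ) (λ _ → suc (4 * n))) ⟩
    suc (∑ (b ^ ℓ) (carries b ℓ) + ∑ (b ^ ℓ) (λ _ → suc (4 * n)))
      ≤⟨ s≤s (+-mono-≤ (∑-carries b ℓ 2≤b) (≤-reflexive (∑-const (b ^ ℓ) (suc (4 * n))))) ⟩
    suc (2 * e + e * suc (4 * n))
      ≡⟨ regroup e n ⟩
    1 + 3 * e + 4 * (e * n)
      ≤⟨ +-monoˡ-≤ (4 * (e * n)) (+-mono-≤ (≤-trans 1≤e e≤en) (*-monoʳ-≤ 3 e≤en)) ⟩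
    e * n + 3 * (e * n) + 4 * (e * n)
      ≡⟨ total (e * n) ⟩
    8 * (e * n)
      ∎
    where
    open ≤-Reasoning
    e = b ^ ℓ
    1≤e : 1 ≤ e
    1≤e = m^n>0 b ℓ
    e≤en : e ≤ e * n
    e≤en = subst (_≤ e * n) (*-identityʳ e) (*-monoʳ-≤ e 1≤n)
    regroup : ∀ e n → suc (2 * e + e * suc (4 * n)) ≡ 1 + 3 * e + 4 * (e * n)
    regroup = solve-∀
    total : ∀ x → x + 3 * x + 4 * x ≡ 8 * x
    total = solve-∀

  control-forRows : ∀ body → (∀ a v → control (body a v) ≤ 1) → control (forRows b ℓ body) ≤ ℓ + 2
  control-forRows body body≤ = +-monoʳ-≤ ℓ (s≤s (maximum-upTo-≤ _ (b ^ ℓ) (λ a → body≤ a (π b ℓ a))))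

  within-forRows : ∀ body {n s} → (∀ {a v} → a < b ^ ℓ → v < b ^ ℓ → All (Within n s) (accesses (body a v))) →
    All (Within n s) (accesses (forRows b ℓ body))
  within-forRows body body-within = All-concatMap-upTo _ (b ^ ℓ) λ a a< → body-within a< (π-< b ℓ a)

  cost-forRows : ∀ body {k B} .{{_ : NonZero B}} {X} → (∀ a v → Cost k B X (accesses (body a v))) →
    Cost k B (b ^ ℓ * X) (accesses (forRows b ℓ body))
  cost-forRows body {k} {B} {X} body-cost = cost-concatMap-const k B X _ (b ^ ℓ) λ a _ → body-cost a (π b ℓ a)

  -- The number of rows multiplied in the step for rows a and v = π a.
  rowCount : ℕ → ℕ → ℕ
  rowCount a v = if a <ᵇ v then 2 else if a ≡ᵇ v then 1 else 0

  -- Every row is multiplied once: a step with a < π a accounts for both rows,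
  -- and as many rows a have a < π a as have π a < a.
  ∑-rowCount : ∑ (b ^ ℓ) (λ a → rowCount a (π b ℓ a)) ≡ b ^ ℓ
  ∑-rowCount = begin
    ∑ n (λ a → rowCount a (π b ℓ a))
      ≡⟨ ∑-cong n (λ a _ → split a (π b ℓ a)) ⟩
    ∑ n (λ a → below a (π b ℓ a) + (below a (π b ℓ a) + δ a (π b ℓ a)))
      ≡⟨ ∑-+ n (λ a → below a (π b ℓ a)) (λ a → below a (π b ℓ a) + δ a (π b ℓ a)) ⟩
    ∑ n (λ a → below a (π b ℓ a)) + ∑ n (λ a → below a (π b ℓ a) + δ a (π b ℓ a))
      ≡⟨ cong (_+ ∑ n (λ a → below a (π b ℓ a) + δ a (π b ℓ a))) reflect ⟩
    ∑ n (λ a → below (π b ℓ a) a) + ∑ n (λ a → below a (π b ℓ a) + δ a (π b ℓ a))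
      ≡⟨ ∑-+ n (λ a → below (π b ℓ a) a) (λ a → below a (π b ℓ a) + δ a (π b ℓ a)) ⟨
    ∑ n (λ a → below (π b ℓ a) a + (below a (π b ℓ a) + δ a (π b ℓ a)))
      ≡⟨ ∑-cong n (λ a _ → once a (π b ℓ a)) ⟩
    ∑ n (λ _ → 1)
      ≡⟨ trans (∑-const n 1) (*-identityʳ n) ⟩
    n
      ∎
    where
    open ≡-Reasoning
    n = b ^ ℓ
    below : ℕ → ℕ → ℕ
    below x y = if x <ᵇ y then 1 else 0
    below-< : ∀ {x y} → x < y → below x y ≡ 1
    below-< {x} {y} x<y rewrite dec-true (x <? y) x<y = refl
    below-≥ : ∀ {x y} → y ≤ x → below x y ≡ 0
    below-≥ {x} {y} y≤x rewrite dec-false (x <? y) (≤⇒≯ y≤x) = refl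
    split : ∀ x y → rowCount x y ≡ below x y + (below x y + δ x y)
    split x y with <-cmp x y
    ... | tri< x<y x≢y _ rewrite dec-true (x <? y) x<y | dec-false (x ≟ y) x≢y = refl
    ... | tri≈ x≮y x≡y _ rewrite dec-false (x <? y) x≮y | dec-true (x ≟ y) x≡y = refl
    ... | tri> x≮y x≢y _ rewrite dec-false (x <? y) x≮y | dec-false (x ≟ y) x≢y = refl
    once : ∀ x y → below y x + (below x y + δ x y) ≡ 1
    once x y with <-cmp x y
    ... | tri< x<y x≢y _ = cong₂ _+_ (below-≥ (<⇒≤ x<y)) (cong₂ _+_ (below-< x<y) (δ-≢ x≢y))
    ... | tri≈ _ refl _ = cong₂ _+_ (below-≥ (≤-refl {x})) (cong₂ _+_ (below-≥ (≤-refl {x})) (δ-refl x))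
    ... | tri> _ x≢y y<x = cong₂ _+_ (below-< y<x) (cong₂ _+_ (below-≥ (<⇒≤ y<x)) (δ-≢ x≢y))
    reflect : ∑ n (λ a → below a (π b ℓ a)) ≡ ∑ n (λ a → below (π b ℓ a) a)
    reflect = begin
      ∑ n (λ a → below a (π b ℓ a))
        ≡⟨ ∑-cong n (λ a a<n → cong (λ x → below x (π b ℓ a)) (sym (π-involutive b ℓ a a<n))) ⟩
      ∑ n (λ a → below (π b ℓ (π b ℓ a)) (π b ℓ a))   ≡⟨ ∑-π b ℓ (λ v → below (π b ℓ v) v) ⟩
      ∑ n (λ a → below (π b ℓ a) a)                   ∎

  module _ (c q : ℕ) (τ : ℕ → ℕ) where

    arith-packRow-≥ : ∀ a v → rowCount a v * c ≤ arith τ (packRow c q a v)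
    arith-packRow-≥ a v with <-cmp a v
    ... | tri< a<v _ _ rewrite dec-true (a <? v) a<v = begin
      2 * c                      ≡⟨ trans (*-comm 2 c) (sym (∑-const c 2)) ⟩
      ∑ c (λ _ → 2)              ≤⟨ ∑-mono c (λ j _ → s≤s (≤-trans (s≤s z≤n) (m≤n+m _ (τ (a * (q * c + j)))))) ⟩
      ∑ c (λ j → suc (τ (a * (q * c + j))) + suc (τ (v * (q * c + j)))) ∎
      where open ≤-Reasoning
    ... | tri≈ a≮v a≡v _ rewrite dec-false (a <? v) a≮v | dec-true (a ≟ v) a≡v = begin
      1 * c                      ≡⟨ trans (*-comm 1 c) (sym (∑-const c 1)) ⟩
      ∑ c (λ _ → 1)              ≤⟨ ∑-mono c (λ j _ → s≤s z≤n) ⟩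
      ∑ c (λ j → suc (τ (v * (q * c + j)))) ∎
      where open ≤-Reasoning
    ... | tri> a≮v a≢v _ rewrite dec-false (a <? v) a≮v | dec-false (a ≟ v) a≢v = z≤n

    arith-packRow-≤ : ∀ {τmax} → (∀ e → τ e ≤ τmax) → ∀ a v → arith τ (packRow c q a v) ≤ c * (2 * suc τmax)
    arith-packRow-≤ {τmax} τ≤ a v = packRow-cases (λ P → arith τ P ≤ c * (2 * suc τmax)) c q a v
      (λ _ → ≤-trans (∑-mono c (λ j _ → +-mono-≤ (s≤s (τ≤ _)) (≤-trans (s≤s (τ≤ _)) (m≤m+n (suc τmax) 0)))) (≤-reflexive (∑-const c _)))
      (λ _ → ≤-trans (∑-mono c (λ j _ → ≤-trans (s≤s (τ≤ _)) (m≤m+n (suc τmax) _))) (≤-reflexive (∑-const c _)))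
      (λ _ → z≤n)

    arith-pack-≥ : b ^ ℓ * c ≤ arith τ (pack b ℓ c q)
    arith-pack-≥ = begin
      b ^ ℓ * c                                              ≡⟨ cong (_* c) ∑-rowCount ⟨
      ∑ (b ^ ℓ) (λ a → rowCount a (π b ℓ a)) * c             ≡⟨ ∑-*ʳ (b ^ ℓ) (λ a → rowCount a (π b ℓ a)) c ⟨
      ∑ (b ^ ℓ) (λ a → rowCount a (π b ℓ a) * c)             ≤⟨ ∑-mono (b ^ ℓ) (λ a _ → arith-packRow-≥ a (π b ℓ a)) ⟩
      ∑ (b ^ ℓ) (λ a → arith τ (packRow c q a (π b ℓ a)))    ∎
      where open ≤-Reasoning

    arith-pack-≤ : ∀ {τmax} → (∀ e → τ e ≤ τmax) → arith τ (pack b ℓ c q) ≤ 2 * suc τmax * (b ^ ℓ * c)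
    arith-pack-≤ {τmax} τ≤ = begin
      ∑ (b ^ ℓ) (λ a → arith τ (packRow c q a (π b ℓ a)))
        ≤⟨ ∑-mono (b ^ ℓ) (λ a _ → arith-packRow-≤ τ≤ a (π b ℓ a)) ⟩
      ∑ (b ^ ℓ) (λ _ → c * (2 * suc τmax))                   ≡⟨ ∑-const (b ^ ℓ) _ ⟩
      b ^ ℓ * (c * (2 * suc τmax))                           ≡⟨ regroup (b ^ ℓ) c τmax ⟩
      2 * suc τmax * (b ^ ℓ * c)                             ∎
      where
      open ≤-Reasoning
      regroup : ∀ e c t → e * (c * (2 * suc t)) ≡ 2 * suc t * (e * c)
      regroup = solve-∀

-- The recursive transposition

module _ (base r c : ℕ) where

  private
    ⌈n/2⌉≤1+⌊n/2⌋ : ∀ n → ⌈ n /2⌉ ≤ suc ⌊ n /2⌋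
    ⌈n/2⌉≤1+⌊n/2⌋ n = ⌊n/2⌋-mono (n≤1+n (suc n))

    ⌊n/2⌋+m≤ : ∀ {n m fuel} → 2 ≤ n → n + m ≤ suc fuel → ⌊ n /2⌋ + m ≤ fuel
    ⌊n/2⌋+m≤ {suc zero} (s≤s ())
    ⌊n/2⌋+m≤ {suc (suc n)} {m} _ ≤fuel = s≤s⁻¹ (≤-trans (+-monoˡ-≤ m (⌊n/2⌋<n (suc n))) ≤fuel)

    ⌈n/2⌉+m≤ : ∀ {n m fuel} → 2 ≤ n → n + m ≤ suc fuel → ⌈ n /2⌉ + m ≤ fuel
    ⌈n/2⌉+m≤ {suc zero} (s≤s ())
    ⌈n/2⌉+m≤ {suc (suc n)} {m} _ ≤fuel = s≤s⁻¹ (≤-trans (+-monoˡ-≤ m (⌈n/2⌉<n n)) ≤fuel)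

    1≤⌊n/2⌋ : ∀ {n} → 2 ≤ n → 1 ≤ ⌊ n /2⌋
    1≤⌊n/2⌋ = ⌊n/2⌋-mono

  -- Induction over the recursion tree of transposeRec, for nonempty
  -- subblocks and sufficient fuel.
  transposeRec-ind : ∀ {ℓ} (P : (i j h w : ℕ) → Prog → Set ℓ) →
    (∀ i j → P i j 1 1 (call 5 (mov (cell scratch r j i) (output , base + (i * c + j))))) →
    (∀ i j h₁ h₂ w A A′ → 1 ≤ h₁ → h₁ ≤ h₂ → h₂ ≤ suc h₁ → 1 ≤ w → w ≤ h₁ + h₂ →
       P i j h₁ w A → P (i + h₁) j h₂ w A′ → P i j (h₁ + h₂) w (call 5 (A ⨾ A′))) →
    (∀ i j h w₁ w₂ A A′ → 1 ≤ w₁ → w₁ ≤ w₂ → w₂ ≤ suc w₁ → 1 ≤ h → h ≤ w₁ + w₂ →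
       P i j h w₁ A → P i (j + w₁) h w₂ A′ → P i j h (w₁ + w₂) (call 5 (A ⨾ A′))) →
    ∀ fuel i j h w → 1 ≤ h → 1 ≤ w → h + w ≤ fuel → P i j h w (transposeRec base r c fuel i j h w)
  transposeRec-ind P leaf tall wide = go
    where
    go : ∀ fuel i j h w → 1 ≤ h → 1 ≤ w → h + w ≤ fuel → P i j h w (transposeRec base r c fuel i j h w)

    goTall : ∀ fuel i j h w → 2 ≤ h → 1 ≤ w → w ≤ h → h + w ≤ suc fuel → P i j h w
      (call 5 (transposeRec base r c fuel i j ⌊ h /2⌋ w ⨾ transposeRec base r c fuel (i + ⌊ h /2⌋) j ⌈ h /2⌉ w))
    goTall fuel i j h w 2≤h 1≤w w≤h ≤fuel =
      subst (λ n → P i j n w (call 5 (transposeRec base r c fuel i j ⌊ h /2⌋ w ⨾ transposeRec base r c fuel (i + ⌊ h /2⌋) j ⌈ h /2⌉ w)))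
        (⌊n/2⌋+⌈n/2⌉≡n h)
        (tall i j ⌊ h /2⌋ ⌈ h /2⌉ w _ _ (1≤⌊n/2⌋ 2≤h) (⌊n/2⌋≤⌈n/2⌉ h) (⌈n/2⌉≤1+⌊n/2⌋ h) 1≤w
          (subst (w ≤_) (sym (⌊n/2⌋+⌈n/2⌉≡n h)) w≤h)
          (go fuel i j ⌊ h /2⌋ w (1≤⌊n/2⌋ 2≤h) 1≤w (⌊n/2⌋+m≤ 2≤h ≤fuel))
          (go fuel (i + ⌊ h /2⌋) j ⌈ h /2⌉ w (≤-trans (1≤⌊n/2⌋ 2≤h) (⌊n/2⌋≤⌈n/2⌉ h)) 1≤w (⌈n/2⌉+m≤ 2≤h ≤fuel)))

    goWide : ∀ fuel i j h w → 1 ≤ h → 2 ≤ w → h ≤ w → h + w ≤ suc fuel → P i j h w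
      (call 5 (transposeRec base r c fuel i j h ⌊ w /2⌋ ⨾ transposeRec base r c fuel i (j + ⌊ w /2⌋) h ⌈ w /2⌉))
    goWide fuel i j h w 1≤h 2≤w h≤w ≤fuel =
      subst (λ n → P i j h n (call 5 (transposeRec base r c fuel i j h ⌊ w /2⌋ ⨾ transposeRec base r c fuel i (j + ⌊ w /2⌋) h ⌈ w /2⌉)))
        (⌊n/2⌋+⌈n/2⌉≡n w)
        (wide i j h ⌊ w /2⌋ ⌈ w /2⌉ _ _ (1≤⌊n/2⌋ 2≤w) (⌊n/2⌋≤⌈n/2⌉ w) (⌈n/2⌉≤1+⌊n/2⌋ w) 1≤h
          (subst (h ≤_) (sym (⌊n/2⌋+⌈n/2⌉≡n w)) h≤w)
          (go fuel i j h ⌊ w /2⌋ 1≤h (1≤⌊n/2⌋ 2≤w)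
            (subst (_≤ fuel) (+-comm ⌊ w /2⌋ h) (⌊n/2⌋+m≤ 2≤w w+h≤)))
          (go fuel i (j + ⌊ w /2⌋) h ⌈ w /2⌉ 1≤h (≤-trans (1≤⌊n/2⌋ 2≤w) (⌊n/2⌋≤⌈n/2⌉ w))
            (subst (_≤ fuel) (+-comm ⌈ w /2⌉ h) (⌈n/2⌉+m≤ 2≤w w+h≤))))
      where
      w+h≤ : w + h ≤ suc fuel
      w+h≤ = subst (_≤ suc fuel) (+-comm h w) ≤fuel

    go zero    i j (suc h) w 1≤h 1≤w ()
    go (suc fuel) i j 1 1 1≤h 1≤w ≤fuel = leaf i j
    go (suc fuel) i j 1 w@(suc (suc _)) 1≤h 1≤w ≤fuel =
      goWide fuel i j 1 w 1≤h (s≤s (s≤s z≤n)) 1≤w ≤fuel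
    go (suc fuel) i j h@(suc (suc _)) w 1≤h 1≤w ≤fuel with w ≤? h
    ... | yes w≤h rewrite dec-true (w ≤? h) w≤h = goTall fuel i j h w (s≤s (s≤s z≤n)) 1≤w w≤h ≤fuel
    ... | no  w≰h rewrite dec-false (w ≤? h) w≰h =
      goWide fuel i j h w 1≤h (≤-trans (s≤s (s≤s z≤n)) h≤w) h≤w ≤fuel
      where
      h≤w : h ≤ w
      h≤w = <⇒≤ (≰⇒> w≰h)

  -- The recursion tree has h w leaves and fewer inner nodes.
  moves-transposeRec : ∀ fuel i j h w → 1 ≤ h → 1 ≤ w → h + w ≤ fuel →
    suc (moves (transposeRec base r c fuel i j h w)) ≤ 3 * (h * w)
  moves-transposeRec = transposeRec-ind (λ i j h w A → suc (moves A) ≤ 3 * (h * w))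
    (λ i j → ≤-refl)
    (λ i j h₁ h₂ w A A′ _ _ _ _ _ A≤ A′≤ → ≤-trans (node (moves A) (moves A′)) (≤-trans (+-mono-≤ A≤ A′≤)
      (≤-reflexive (tall h₁ h₂ w))))
    (λ i j h w₁ w₂ A A′ _ _ _ _ _ A≤ A′≤ → ≤-trans (node (moves A) (moves A′)) (≤-trans (+-mono-≤ A≤ A′≤)
      (≤-reflexive (wide h w₁ w₂))))
    where
    node : ∀ m n → suc (suc (m + n)) ≤ suc m + suc n
    node m n = ≤-reflexive (cong suc (sym (+-suc m n)))
    tall : ∀ x y z → 3 * (x * z) + 3 * (y * z) ≡ 3 * ((x + y) * z)
    tall = solve-∀
    wide : ∀ x y z → 3 * (x * y) + 3 * (x * z) ≡ 3 * (x * (y + z))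
    wide = solve-∀

  -- Each halving of a side at most 2 ^ x leaves sides at most 2 ^ (x - 1).
  control-transposeRec : ∀ fuel i j h w → 1 ≤ h → 1 ≤ w → h + w ≤ fuel →
    ∀ x y → h ≤ 2 ^ x → w ≤ 2 ^ y → control (transposeRec base r c fuel i j h w) ≤ 5 * (1 + x + y)
  control-transposeRec = transposeRec-ind
    (λ i j h w A → ∀ x y → h ≤ 2 ^ x → w ≤ 2 ^ y → control A ≤ 5 * (1 + x + y))
    (λ i j x y _ _ → *-monoʳ-≤ 5 {1} {1 + x + y} (s≤s z≤n))
    tall wide
    where
    halve : ∀ {h₁ h₂} x → 1 ≤ h₁ → h₁ ≤ h₂ → h₂ ≤ suc h₁ → h₁ + h₂ ≤ 2 ^ x →
      ∃[ x′ ] x ≡ suc x′ × h₁ ≤ 2 ^ x′ × h₂ ≤ 2 ^ x′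
    halve {h₁} {h₂} zero 1≤h₁ h₁≤h₂ _ ≤1 =
      contradiction ≤1 (<⇒≱ (+-mono-≤ 1≤h₁ (≤-trans 1≤h₁ h₁≤h₂)))
    halve {h₁} {h₂} (suc x) 1≤h₁ h₁≤h₂ h₂≤ ≤2^x = x , refl , ≤-trans h₁≤h₂ h₂≤2^x , h₂≤2^x
      where
      open ≤-Reasoning
      h₂≤2^x : h₂ ≤ 2 ^ x
      h₂≤2^x = ≮⇒≥ λ 2^x<h₂ → <-irrefl refl (begin-strict
        h₁ + h₂             ≤⟨ ≤2^x ⟩
        2 ^ x + (2 ^ x + 0) ≡⟨ cong (2 ^ x +_) (+-identityʳ (2 ^ x)) ⟩
        2 ^ x + 2 ^ x       <⟨ +-mono-≤-< (s≤s⁻¹ (≤-trans 2^x<h₂ h₂≤)) 2^x<h₂ ⟩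
        h₁ + h₂             ∎)
    tall : ∀ i j h₁ h₂ w A A′ → 1 ≤ h₁ → h₁ ≤ h₂ → h₂ ≤ suc h₁ → 1 ≤ w → w ≤ h₁ + h₂ →
      (∀ x y → h₁ ≤ 2 ^ x → w ≤ 2 ^ y → control A ≤ 5 * (1 + x + y)) →
      (∀ x y → h₂ ≤ 2 ^ x → w ≤ 2 ^ y → control A′ ≤ 5 * (1 + x + y)) →
      ∀ x y → h₁ + h₂ ≤ 2 ^ x → w ≤ 2 ^ y → 5 + (control A ⊔ control A′) ≤ 5 * (1 + x + y)
    tall i j h₁ h₂ w A A′ 1≤ le ≤1+ _ _ A≤ A′≤ x y h≤ w≤ with halve x 1≤ le ≤1+ h≤
    ... | x′ , refl , h₁≤ , h₂≤ = ≤-trans (+-monoʳ-≤ 5 (⊔-lub (A≤ x′ y h₁≤ w≤) (A′≤ x′ y h₂≤ w≤)))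
      (≤-reflexive (sym (*-suc 5 (1 + x′ + y))))
    wide : ∀ i j h w₁ w₂ A A′ → 1 ≤ w₁ → w₁ ≤ w₂ → w₂ ≤ suc w₁ → 1 ≤ h → h ≤ w₁ + w₂ →
      (∀ x y → h ≤ 2 ^ x → w₁ ≤ 2 ^ y → control A ≤ 5 * (1 + x + y)) →
      (∀ x y → h ≤ 2 ^ x → w₂ ≤ 2 ^ y → control A′ ≤ 5 * (1 + x + y)) →
      ∀ x y → h ≤ 2 ^ x → w₁ + w₂ ≤ 2 ^ y → 5 + (control A ⊔ control A′) ≤ 5 * (1 + x + y)
    wide i j h w₁ w₂ A A′ 1≤ le ≤1+ _ _ A≤ A′≤ x y h≤ w≤ with halve y 1≤ le ≤1+ w≤
    ... | y′ , refl , w₁≤ , w₂≤ = ≤-trans (+-monoʳ-≤ 5 (⊔-lub (A≤ x y′ h≤ w₁≤) (A′≤ x y′ h≤ w₂≤)))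
      (≤-reflexive (trans (sym (*-suc 5 (1 + x + y′))) (cong (5 *_) (cong suc (sym (+-suc x y′))))))

  -- The accesses for the h × w subblock with corner (i , j) and its
  -- transpose.
  data InBlock (i j h w : ℕ) : Loc → Set where
    source : ∀ {x y} → x < h → y < w → InBlock i j h w (output , base + ((i + x) * c + (j + y)))
    target : ∀ {x y} → x < h → y < w → InBlock i j h w (cell scratch r (j + y) (i + x))

  tall₁ : ∀ {i j h₁ h₂ w l} → InBlock i j h₁ w l → InBlock i j (h₁ + h₂) w l
  tall₁ (source x< y<) = source (m≤n⇒m≤n+o _ x<) y<
  tall₁ (target x< y<) = target (m≤n⇒m≤n+o _ x<) y<

  tall₂ : ∀ {i j h₁ h₂ w l} → InBlock (i + h₁) j h₂ w l → InBlock i j (h₁ + h₂) w l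
  tall₂ {i} {j} {h₁} (source {x} {y} x< y<) rewrite +-assoc i h₁ x = source (+-monoʳ-< h₁ x<) y<
  tall₂ {i} {j} {h₁} (target {x} {y} x< y<) rewrite +-assoc i h₁ x = target (+-monoʳ-< h₁ x<) y<

  wide₁ : ∀ {i j h w₁ w₂ l} → InBlock i j h w₁ l → InBlock i j h (w₁ + w₂) l
  wide₁ (source x< y<) = source x< (m≤n⇒m≤n+o _ y<)
  wide₁ (target x< y<) = target x< (m≤n⇒m≤n+o _ y<)

  wide₂ : ∀ {i j h w₁ w₂ l} → InBlock i (j + w₁) h w₂ l → InBlock i j h (w₁ + w₂) l
  wide₂ {i} {j} {h} {w₁} (source {x} {y} x< y<) rewrite +-assoc j w₁ y = source x< (+-monoʳ-< w₁ y<)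
  wide₂ {i} {j} {h} {w₁} (target {x} {y} x< y<) rewrite +-assoc j w₁ y = target x< (+-monoʳ-< w₁ y<)

  inBlock-leaf : ∀ i j → All (InBlock i j 1 1)
    ((output , base + (i * c + j)) ∷ cell scratch r j i ∷ [])
  inBlock-leaf i j =
      subst₂ (λ x y → InBlock i j 1 1 (output , base + (x * c + y))) (+-identityʳ i) (+-identityʳ j) (source z<s z<s)
    ∷ subst₂ (λ x y → InBlock i j 1 1 (cell scratch r y x)) (+-identityʳ i) (+-identityʳ j) (target z<s z<s)
    ∷ []

  inBlock-transposeRec : ∀ fuel i j h w → 1 ≤ h → 1 ≤ w → h + w ≤ fuel →
    All (InBlock i j h w) (accesses (transposeRec base r c fuel i j h w))
  inBlock-transposeRec = transposeRec-ind (λ i j h w A → All (InBlock i j h w) (accesses A))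
    inBlock-leaf
    (λ i j h₁ h₂ w A A′ _ _ _ _ _ inA inA′ → All.++⁺ (All.map tall₁ inA) (All.map tall₂ inA′))
    (λ i j h w₁ w₂ A A′ _ _ _ _ _ inA inA′ → All.++⁺ (All.map wide₁ inA) (All.map wide₂ inA′))

  -- Caching: once both sides of a subblock are at most T, where T ≤ B and
  -- 4 T lines fit into the cache, the whole subproblem costs O(h + w) misses.
  -- As the longer side is halved, sides do not drop below T / 2 before that,
  -- so h + w is O(h w / T).
  module _ {k B T γ : ℕ} .{{_ : NonZero B}} (T≤B : T ≤ B) (4T≤k : 4 * T ≤ k) (B≤γT : B ≤ γ * T) where

    private
      sourceLines targetLines lines : (i j h w : ℕ) → List Loc
      sourceLines i j h w = concatMap (λ x → twoLines k B (line B (output , base + ((i + x) * c + j)))) (upTo h)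
      targetLines i j h w = concatMap (λ y → twoLines k B (line B (cell scratch r (j + y) i))) (upTo w)
      lines i j h w = sourceLines i j h w ++ targetLines i j h w

      length-lines : ∀ i j h w → length (lines i j h w) ≡ 2 * (h + w)
      length-lines i j h w = begin
        length (lines i j h w)         ≡⟨ length-++ (sourceLines i j h w) ⟩
        length (sourceLines i j h w) + length (targetLines i j h w)
                                       ≡⟨ cong₂ _+_ (trans (length-concatMap-upTo _ h) (∑-const h 2)) (trans (length-concatMap-upTo _ w) (∑-const w 2)) ⟩
        h * 2 + w * 2                  ≡⟨ *-distribʳ-+ 2 h w ⟨
        (h + w) * 2                    ≡⟨ *-comm (h + w) 2 ⟩
        2 * (h + w)                    ∎
        where open ≡-Reasoning

      ∈-concatMap-upTo : ∀ {l n x} {g : ℕ → List Loc} → x < n → l ∈ g x → l ∈ concatMap g (upTo n)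
      ∈-concatMap-upTo {g = g} x<n l∈ = ∈-concat⁺′ l∈ (∈-map⁺ g (∈-upTo⁺ x<n))

      ∈-lines : ∀ {i j h w l} → h ≤ B → w ≤ B → InBlock i j h w l → line B l ∈ lines i j h w
      ∈-lines {i} {j} {h} {w} h≤B w≤B (source {x} {y} x<h y<w) = ∈-++⁺ˡ (∈-concatMap-upTo x<h
        (subst (λ n → line B (output , n) ∈ twoLines k B (line B (output , base + ((i + x) * c + j))))
          (trans (+-assoc base _ y) (cong (base +_) (+-assoc ((i + x) * c) j y)))
          (line-near k B output (base + ((i + x) * c + j)) y (≤-trans y<w w≤B))))
      ∈-lines {i} {j} {h} {w} h≤B w≤B (target {x} {y} x<h y<w) =
        ∈-++⁺ʳ (sourceLines i j h w)
          (∈-concatMap-upTo y<w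
            (subst (λ n → line B (scratch , n) ∈ twoLines k B (line B (cell scratch r (j + y) i)))
              (+-assoc ((j + y) * r) i x)
              (line-near k B scratch ((j + y) * r + i) x (≤-trans x<h h≤B))))

    cost-small : ∀ {i j h w ls} → 1 ≤ h → h ≤ T → w ≤ T → T ≤ 2 * h → T ≤ 2 * w →
      All (InBlock i j h w) ls → Cost k B (20 * γ * (h * w)) ls
    cost-small {i} {j} {h} {w} {ls} 1≤h h≤T w≤T T≤2h T≤2w inBlock = cost-≤ k B bound
      (subst (λ n → Cost k B ((2 * n + 1) * B) ls) (length-lines i j h w)
        (cost-workingSet k B {lines i j h w} fits (All.map (∈-lines (≤-trans h≤T T≤B) (≤-trans w≤T T≤B)) inBlock)))
      where
      open ≤-Reasoning
      fits : length (lines i j h w) ≤ k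
      fits = begin
        length (lines i j h w) ≡⟨ length-lines i j h w ⟩
        2 * (h + w)            ≤⟨ *-monoʳ-≤ 2 (+-mono-≤ h≤T w≤T) ⟩
        2 * (T + T)            ≡⟨ four T ⟩
        4 * T                  ≤⟨ 4T≤k ⟩
        k                      ∎
        where
        four : ∀ n → 2 * (n + n) ≡ 4 * n
        four = solve-∀
      bound : (2 * (2 * (h + w)) + 1) * B ≤ 20 * γ * (h * w)
      bound = begin
        (2 * (2 * (h + w)) + 1) * B
          ≤⟨ *-mono-≤ (+-monoʳ-≤ (2 * (2 * (h + w))) (≤-trans 1≤h (m≤m+n h w))) B≤γT ⟩
        (2 * (2 * (h + w)) + (h + w)) * (γ * T) ≡⟨ expand h w γ T ⟩
        5 * γ * (h * T + w * T)
          ≤⟨ *-monoʳ-≤ (5 * γ) (+-mono-≤ (*-monoʳ-≤ h T≤2w) (*-monoʳ-≤ w T≤2h)) ⟩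
        5 * γ * (h * (2 * w) + w * (2 * h))     ≡⟨ collect h w γ ⟩
        20 * γ * (h * w)                        ∎
        where
        expand : ∀ h w γ T → (2 * (2 * (h + w)) + (h + w)) * (γ * T) ≡ 5 * γ * (h * T + w * T)
        expand = solve-∀
        collect : ∀ h w γ → 5 * γ * (h * (2 * w) + w * (2 * h)) ≡ 20 * γ * (h * w)
        collect = solve-∀

    private
      Good : (i j h w : ℕ) → Prog → Set
      Good i j h w A = All (InBlock i j h w) (accesses A) ×
        (T ≤ 2 * h → T ≤ 2 * w → Cost k B (20 * γ * (h * w)) (accesses A))

      half≥ : ∀ {h₁ h₂} → h₁ ≤ h₂ → h₂ ≤ suc h₁ → T < h₁ + h₂ → T ≤ 2 * h₁ × T ≤ 2 * h₂
      half≥ {h₁} {h₂} h₁≤h₂ h₂≤ T<h = T≤2h₁ , ≤-trans T≤2h₁ (*-monoʳ-≤ 2 h₁≤h₂)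
        where
        open ≤-Reasoning
        T≤2h₁ : T ≤ 2 * h₁
        T≤2h₁ = s≤s⁻¹ (begin
          suc T          ≤⟨ T<h ⟩
          h₁ + h₂        ≤⟨ +-monoʳ-≤ h₁ h₂≤ ⟩
          h₁ + suc h₁    ≡⟨ twice h₁ ⟩
          suc (2 * h₁)   ∎)
          where
          twice : ∀ n → n + suc n ≡ suc (2 * n)
          twice = solve-∀

    cost-transposeRec : 1 ≤ T → ∀ fuel i j h w → 1 ≤ h → 1 ≤ w → h + w ≤ fuel → T ≤ 2 * h → T ≤ 2 * w →
      Cost k B (20 * γ * (h * w)) (accesses (transposeRec base r c fuel i j h w))
    cost-transposeRec 1≤T fuel i j h w 1≤h 1≤w ≤fuel =
      proj₂ (transposeRec-ind Good leaf tall wide fuel i j h w 1≤h 1≤w ≤fuel)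
      where
      leaf : ∀ i j → Good i j 1 1 (call 5 (mov (cell scratch r j i) (output , base + (i * c + j))))
      leaf i j = inBlock-leaf i j , λ T≤2 _ → cost-small ≤-refl 1≤T 1≤T T≤2 T≤2 (inBlock-leaf i j)
      tall : ∀ i j h₁ h₂ w A A′ → 1 ≤ h₁ → h₁ ≤ h₂ → h₂ ≤ suc h₁ → 1 ≤ w → w ≤ h₁ + h₂ →
        Good i j h₁ w A → Good (i + h₁) j h₂ w A′ → Good i j (h₁ + h₂) w (call 5 (A ⨾ A′))
      tall i j h₁ h₂ w A A′ 1≤h₁ h₁≤h₂ h₂≤ 1≤w w≤h (inA , costA) (inA′ , costA′) = inBlock , costs
        where
        inBlock : All (InBlock i j (h₁ + h₂) w) (accesses A ++ accesses A′)
        inBlock = All.++⁺ (All.map tall₁ inA) (All.map tall₂ inA′)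
        costs : T ≤ 2 * (h₁ + h₂) → T ≤ 2 * w → Cost k B (20 * γ * ((h₁ + h₂) * w)) (accesses A ++ accesses A′)
        costs T≤2h T≤2w with h₁ + h₂ ≤? T
        ... | yes h≤T = cost-small (m≤n⇒m≤n+o h₂ 1≤h₁) h≤T (≤-trans w≤h h≤T) T≤2h T≤2w inBlock
        ... | no  h≰T = cost-≤ k B (≤-reflexive (add γ h₁ h₂ w))
          (cost-++ k B (costA (proj₁ (half≥ h₁≤h₂ h₂≤ (≰⇒> h≰T))) T≤2w) (costA′ (proj₂ (half≥ h₁≤h₂ h₂≤ (≰⇒> h≰T))) T≤2w))
          where
          add : ∀ g x y z → 20 * g * (x * z) + 20 * g * (y * z) ≡ 20 * g * ((x + y) * z)
          add = solve-∀
      wide : ∀ i j h w₁ w₂ A A′ → 1 ≤ w₁ → w₁ ≤ w₂ → w₂ ≤ suc w₁ → 1 ≤ h → h ≤ w₁ + w₂ →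
        Good i j h w₁ A → Good i (j + w₁) h w₂ A′ → Good i j h (w₁ + w₂) (call 5 (A ⨾ A′))
      wide i j h w₁ w₂ A A′ 1≤w₁ w₁≤w₂ w₂≤ 1≤h h≤w (inA , costA) (inA′ , costA′) = inBlock , costs
        where
        inBlock : All (InBlock i j h (w₁ + w₂)) (accesses A ++ accesses A′)
        inBlock = All.++⁺ (All.map wide₁ inA) (All.map wide₂ inA′)
        costs : T ≤ 2 * h → T ≤ 2 * (w₁ + w₂) → Cost k B (20 * γ * (h * (w₁ + w₂))) (accesses A ++ accesses A′)
        costs T≤2h T≤2w with w₁ + w₂ ≤? T
        ... | yes w≤T = cost-small 1≤h (≤-trans h≤w w≤T) w≤T T≤2h T≤2w inBlock
        ... | no  w≰T = cost-≤ k B (≤-reflexive (add γ h w₁ w₂))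
          (cost-++ k B (costA T≤2h (proj₁ (half≥ w₁≤w₂ w₂≤ (≰⇒> w≰T)))) (costA′ T≤2h (proj₂ (half≥ w₁≤w₂ w₂≤ (≰⇒> w≰T)))))
          where
          add : ∀ g x y z → 20 * g * (x * y) + 20 * g * (x * z) ≡ 20 * g * (x * (y + z))
          add = solve-∀

-- Transposition of a block

module _ (base r c : ℕ) (1≤r : 1 ≤ r) (1≤c : 1 ≤ c) where

  moves-transpose : moves (transpose base r c) ≤ 5 * (r * c)
  moves-transpose = begin
    moves (transposeRec base r c (r + c) 0 0 r c) + ∑ (r * c) (λ _ → 2)
      ≤⟨ +-mono-≤ (≤-trans (n≤1+n _) (moves-transposeRec base r c (r + c) 0 0 r c 1≤r 1≤c ≤-refl)) (≤-reflexive (∑-const (r * c) 2)) ⟩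
    3 * (r * c) + r * c * 2                                             ≡⟨ total (r * c) ⟩
    5 * (r * c)                                                         ∎
    where
    open ≤-Reasoning
    total : ∀ x → 3 * x + x * 2 ≡ 5 * x
    total = solve-∀

  control-transpose : ∀ x y → r ≤ 2 ^ x → c ≤ 2 ^ y → control (transpose base r c) ≤ 5 * (1 + x + y)
  control-transpose x y r≤ c≤ = ⊔-lub (control-transposeRec base r c (r + c) 0 0 r c 1≤r 1≤c ≤-refl x y r≤ c≤)
    (≤-trans (s≤s (maximum-upTo-≤ _ (r * c) (λ _ → z≤n))) (*-monoʳ-≤ 5 {1} {1 + x + y} (s≤s z≤n)))

  within-transpose : ∀ {n} → base + r * c ≤ n → All (Within n (r * c)) (accesses (transpose base r c))
  within-transpose {n} ≤n = All.++⁺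
    (All.map inside (inBlock-transposeRec base r c (r + c) 0 0 r c 1≤r 1≤c ≤-refl))
    (All-concatMap-upTo _ (r * c) λ k k< → k< ∷ ≤-trans (+-monoʳ-< base k<) ≤n ∷ [])
    where
    inside : ∀ {l} → InBlock base r c 0 0 r c l → Within n (r * c) l
    inside (source x< y<) = ≤-trans (+-monoʳ-< base (row-bound x< y<)) ≤n
    inside (target {x} {y} x< y<) = subst (y * r + x <_) (*-comm c r) (row-bound y< x<)

  cost-transpose : ∀ {k B T γ} .{{_ : NonZero B}} → 6 ≤ k → B ≤ r → B ≤ c →
    1 ≤ T → T ≤ B → 4 * T ≤ k → B ≤ γ * T →
    Cost k B (20 * γ * (r * c) + 26 * (r * c)) (accesses (transpose base r c))
  cost-transpose {k} {B} {T} {γ} 6≤k B≤r B≤c 1≤T T≤B 4T≤k B≤γT = cost-++ k B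
    (cost-transposeRec base r c {γ = γ} T≤B 4T≤k B≤γT 1≤T (r + c) 0 0 r c 1≤r 1≤c ≤-refl
      (≤-trans (≤-trans T≤B B≤r) (m≤m+n r _)) (≤-trans (≤-trans T≤B B≤c) (m≤m+n c _)))
    (cost-scan k B {(λ j → scratch , j) ∷ (λ j → output , base + j) ∷ []} (s≤s (s≤s z≤n)) 6≤k
      (slow-scan k B scratch 0 ∷ slow-scan k B output base ∷ [])
      (≤-trans B≤r (subst (_≤ r * c) (*-identityʳ r) (*-monoʳ-≤ r 1≤c)))
      (λ j _ → here refl ∷ there (here refl) ∷ []))

-- Counting messages

indicator-∧ : ∀ x y → indicator (x ∧ y) ≡ indicator x * indicator y
indicator-∧ true  y = sym (+-identityʳ (indicator y))
indicator-∧ false y = refl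

length-filter-indicator : ∀ {a p} {A : Set a} {P : A → Set p} (P? : ∀ x → Dec (P x)) xs →
  length (filter P? xs) ≡ sum (map (indicator ∘ does ∘ P?) xs)
length-filter-indicator P? []       = refl
length-filter-indicator P? (x ∷ xs) with does (P? x)
... | true  = cong suc (length-filter-indicator P? xs)
... | false = length-filter-indicator P? xs

-- Filtering multiplies the weights by an indicator.
sum-map-filter : ∀ {a p} {A : Set a} {P : A → Set p} (P? : ∀ x → Dec (P x)) w xs →
  sum (map w (filter P? xs)) ≡ sum (map (λ x → indicator (does (P? x)) * w x) xs)
sum-map-filter P? w []       = refl
sum-map-filter P? w (x ∷ xs) with does (P? x)
... | true  = cong₂ _+_ (sym (+-identityʳ (w x))) (sum-map-filter P? w xs)
... | false = sum-map-filter P? w xs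

length-concatMap : ∀ {a b} {A : Set a} {B : Set b} (f : A → List B) xs →
  length (concatMap f xs) ≡ sum (map (length ∘ f) xs)
length-concatMap f []       = refl
length-concatMap f (x ∷ xs) = trans (length-++ (f x)) (cong (length (f x) +_) (length-concatMap f xs))

sum-map-concatMap : ∀ {a} {A : Set a} (w : A → ℕ) (f : ℕ → List A) n →
  sum (map w (concatMap f (upTo n))) ≡ ∑ n (λ i → sum (map w (f i)))
sum-map-concatMap w f zero    = refl
sum-map-concatMap w f (suc n) = begin
  sum (map w (concatMap f (upTo (suc n))))                       ≡⟨ cong (sum ∘ map w) (concatMap-upTo-suc f n) ⟩
  sum (map w (f 0 ++ concatMap (f ∘ suc) (upTo n)))              ≡⟨ cong sum (map-++ w (f 0) _) ⟩
  sum (map w (f 0) ++ map w (concatMap (f ∘ suc) (upTo n)))      ≡⟨ sum-++ (map w (f 0)) _ ⟩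
  sum (map w (f 0)) + sum (map w (concatMap (f ∘ suc) (upTo n)))
    ≡⟨ cong (sum (map w (f 0)) +_) (sum-map-concatMap w (f ∘ suc) n) ⟩
  sum (map w (f 0)) + ∑ n (λ i → sum (map w (f (suc i))))        ≡⟨ ∑-suc n (λ i → sum (map w (f i))) ⟨
  ∑ (suc n) (λ i → sum (map w (f i)))                            ∎
  where open ≡-Reasoning

module _ (p r c : ℕ) where

  -- The item of row q′ r + v and local column j of processor q.
  message : (q q′ v j : ℕ) → Msg
  message q q′ v j = msg q q′ (cell input c (q′ * r + v) j) (output , q * (r * c) + (v * c + j))

  -- A quantity depending only on the end points of the messages.
  sum-redistribution : ∀ w (u : ℕ → ℕ → ℕ) → (∀ q q′ from to → w (msg q q′ from to) ≡ u q q′) →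
    sum (map w (redistribution p r c)) ≡ ∑ p (λ q → ∑ p (u q)) * (r * c)
  sum-redistribution w u w≡u = begin
    sum (map w (redistribution p r c))
      ≡⟨ sum-map-concatMap w _ p ⟩
    ∑ p (λ q → sum (map w (concatMap (λ q′ → concatMap (λ v → map (message q q′ v) (upTo c)) (upTo r)) (upTo p))))
      ≡⟨ ∑-cong p (λ q _ → trans (sum-map-concatMap w _ p) (trans (∑-cong p (λ q′ _ → block q q′)) (∑-*ʳ p (u q) (r * c)))) ⟩
    ∑ p (λ q → ∑ p (u q) * (r * c))
      ≡⟨ ∑-*ʳ p (λ q → ∑ p (u q)) (r * c) ⟩
    ∑ p (λ q → ∑ p (u q)) * (r * c)
      ∎
    where
    open ≡-Reasoning
    block : ∀ q q′ → sum (map w (concatMap (λ v → map (message q q′ v) (upTo c)) (upTo r))) ≡ u q q′ * (r * c)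
    block q q′ = begin
      sum (map w (concatMap (λ v → map (message q q′ v) (upTo c)) (upTo r)))
        ≡⟨ sum-map-concatMap w _ r ⟩
      ∑ r (λ v → sum (map w (map (message q q′ v) (upTo c))))
        ≡⟨ ∑-cong r (λ v _ → trans (cong sum (sym (map-∘ (upTo c)))) (trans (∑-cong c (λ j _ → w≡u q q′ _ _)) (∑-const c (u q q′)))) ⟩
      ∑ r (λ _ → c * u q q′)
        ≡⟨ ∑-const r (c * u q q′) ⟩
      r * (c * u q q′)
        ≡⟨ trans (sym (*-assoc r c (u q q′))) (*-comm (r * c) (u q q′)) ⟩
      u q q′ * (r * c)
        ∎

  count-pair : ∀ {Q Q′} → Q < p → Q′ < p →
    length (filter (λ m → (src m ≟ Q) ×-dec (dst m ≟ Q′)) (redistribution p r c)) ≡ r * c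
  count-pair {Q} {Q′} Q<p Q′<p = begin
    length (filter (λ m → (src m ≟ Q) ×-dec (dst m ≟ Q′)) (redistribution p r c))
      ≡⟨ length-filter-indicator (λ m → (src m ≟ Q) ×-dec (dst m ≟ Q′)) (redistribution p r c) ⟩
    sum (map (λ m → indicator (does ((src m ≟ Q) ×-dec (dst m ≟ Q′)))) (redistribution p r c))
      ≡⟨ sum-redistribution _ (λ q q′ → δ Q q * δ Q′ q′) (λ q q′ _ _ → trans (indicator-∧ (does (q ≟ Q)) (does (q′ ≟ Q′))) (cong₂ _*_ (δ-sym q Q) (δ-sym q′ Q′))) ⟩
    ∑ p (λ q → ∑ p (λ q′ → δ Q q * δ Q′ q′)) * (r * c)
      ≡⟨ cong (_* (r * c)) (∑-cong p (λ q _ → inner q)) ⟩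
    ∑ p (λ q → δ Q q * 1) * (r * c)
      ≡⟨ cong (_* (r * c)) (∑-δ p Q (λ _ → 1) Q<p) ⟩
    1 * (r * c)
      ≡⟨ *-identityˡ (r * c) ⟩
    r * c
      ∎
    where
    open ≡-Reasoning
    inner : ∀ q → ∑ p (λ q′ → δ Q q * δ Q′ q′) ≡ δ Q q * 1
    inner q = begin
      ∑ p (λ q′ → δ Q q * δ Q′ q′) ≡⟨ ∑-cong p (λ q′ _ → *-comm (δ Q q) (δ Q′ q′)) ⟩
      ∑ p (λ q′ → δ Q′ q′ * δ Q q) ≡⟨ ∑-δ p Q′ (λ _ → δ Q q) Q′<p ⟩
      δ Q q                        ≡⟨ *-identityʳ (δ Q q) ⟨
      δ Q q * 1                    ∎

  -- The messages between distinct processors.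
  remoteMessages : List Msg
  remoteMessages = filter (λ m → ¬? (src m ≟ dst m)) (redistribution p r c)

  private
    ∑-δ-const : ∀ {Q} k → Q < p → ∑ p (λ q → δ Q q * k) ≡ k
    ∑-δ-const {Q} k = ∑-δ p Q (λ _ → k)

  length-filter-remote : ∀ {ℓ} {P : Msg → Set ℓ} (P? : ∀ m → Dec (P m)) (u : ℕ → ℕ → ℕ) →
    (∀ q q′ from to → indicator (does (P? (msg q q′ from to))) ≡ u q q′) →
    length (filter P? remoteMessages) ≡ ∑ p (λ q → ∑ p (λ q′ → ν q q′ * u q q′)) * (r * c)
  length-filter-remote P? u P≡u = begin
    length (filter P? remoteMessages)
      ≡⟨ length-filter-indicator P? remoteMessages ⟩
    sum (map (λ m → indicator (does (P? m))) remoteMessages)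
      ≡⟨ sum-map-filter (λ m → ¬? (src m ≟ dst m)) _ (redistribution p r c) ⟩
    sum (map (λ m → ν (src m) (dst m) * indicator (does (P? m))) (redistribution p r c))
      ≡⟨ sum-redistribution _ (λ q q′ → ν q q′ * u q q′) (λ q q′ from to → cong (ν q q′ *_) (P≡u q q′ from to)) ⟩
    ∑ p (λ q → ∑ p (λ q′ → ν q q′ * u q q′)) * (r * c)
      ∎
    where open ≡-Reasoning

  count-sent : ∀ {Q} → Q < p → length (filter (λ m → src m ≟ Q) remoteMessages) ≡ pred p * (r * c)
  count-sent {Q} Q<p = trans (length-filter-remote (λ m → src m ≟ Q) (λ q q′ → δ q Q) (λ _ _ _ _ → refl))
    (cong (_* (r * c)) (begin
      ∑ p (λ q → ∑ p (λ q′ → ν q q′ * δ q Q))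
        ≡⟨ ∑-cong p (λ q q<p → trans (∑-*ʳ p (ν q) (δ q Q)) (trans (cong (_* δ q Q) (∑-ν q<p)) (trans (*-comm (pred p) (δ q Q)) (cong (_* pred p) (δ-sym q Q))))) ⟩
      ∑ p (λ q → δ Q q * pred p)              ≡⟨ ∑-δ-const (pred p) Q<p ⟩
      pred p                                  ∎))
    where open ≡-Reasoning

  count-received : ∀ {Q} → Q < p → length (filter (λ m → dst m ≟ Q) remoteMessages) ≡ pred p * (r * c)
  count-received {Q} Q<p = trans (length-filter-remote (λ m → dst m ≟ Q) (λ q q′ → δ q′ Q) (λ _ _ _ _ → refl))
    (cong (_* (r * c)) (begin
      ∑ p (λ q → ∑ p (λ q′ → ν q q′ * δ q′ Q))
        ≡⟨ ∑-cong p (λ q _ → trans (∑-cong p (λ q′ _ → trans (*-comm (ν q q′) (δ q′ Q)) (cong (_* ν q q′) (δ-sym q′ Q)))) (trans (∑-δ p Q (ν q) Q<p) (ν-sym q Q))) ⟩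
      ∑ p (ν Q)                                ≡⟨ ∑-ν Q<p ⟩
      pred p                                   ∎))
    where open ≡-Reasoning

  count-remote : length remoteMessages ≡ p * (pred p * (r * c))
  count-remote = begin
    length remoteMessages
      ≡⟨ length-filter-indicator (λ m → ¬? (src m ≟ dst m)) (redistribution p r c) ⟩
    sum (map (λ m → ν (src m) (dst m)) (redistribution p r c))
      ≡⟨ sum-redistribution _ ν (λ _ _ _ _ → refl) ⟩
    ∑ p (λ q → ∑ p (ν q)) * (r * c)
      ≡⟨ cong (_* (r * c)) (trans (∑-cong p (λ q → ∑-ν)) (∑-const p (pred p))) ⟩
    p * pred p * (r * c)
      ≡⟨ *-assoc p (pred p) (r * c) ⟩
    p * (pred p * (r * c))
      ∎
    where open ≡-Reasoning

  -- The accesses of processor Q for sending and receiving.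
  endpoints : ℕ → List Loc
  endpoints Q = concatMap (endpoint Q) (redistribution p r c)

  endpoints-nested : ∀ Q → endpoints Q ≡
    concatMap (λ q → concatMap (λ q′ → concatMap (λ v → concatMap (λ j → endpoint Q (message q q′ v j))
      (upTo c)) (upTo r)) (upTo p)) (upTo p)
  endpoints-nested Q =
    trans (concatMap-concatMap (endpoint Q) _ (upTo p)) (concatMap-cong (λ q →
    trans (concatMap-concatMap (endpoint Q) _ (upTo p)) (concatMap-cong (λ q′ →
    trans (concatMap-concatMap (endpoint Q) _ (upTo r)) (concatMap-cong (λ v →
      concatMap-map (endpoint Q) (message q q′ v) (upTo c)) (upTo r))) (upTo p))) (upTo p))

  -- Processor Q is the source of p blocks and the destination of p blocks.
  ∑-endpoints : ∀ {Q} → Q < p → ∑ p (λ q → ∑ p (λ q′ → δ Q q + δ Q q′)) ≡ p + p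
  ∑-endpoints {Q} Q<p = begin
    ∑ p (λ q → ∑ p (λ q′ → δ Q q + δ Q q′))
      ≡⟨ ∑-cong p (λ q _ → trans (∑-+ p (λ _ → δ Q q) (δ Q)) (cong₂ _+_ (trans (∑-const p (δ Q q)) (*-comm p (δ Q q))) ∑δ)) ⟩
    ∑ p (λ q → δ Q q * p + 1)               ≡⟨ ∑-+ p (λ q → δ Q q * p) (λ _ → 1) ⟩
    ∑ p (λ q → δ Q q * p) + ∑ p (λ _ → 1)   ≡⟨ cong₂ _+_ (∑-δ-const p Q<p) (trans (∑-const p 1) (*-identityʳ p)) ⟩
    p + p                                   ∎
    where
    open ≡-Reasoning
    ∑δ : ∑ p (δ Q) ≡ 1
    ∑δ = trans (∑-cong p (λ q _ → sym (*-identityʳ (δ Q q)))) (∑-δ-const 1 Q<p)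

  length-endpoints : ∀ {Q} → Q < p → length (endpoints Q) ≡ 2 * (p * (r * c))
  length-endpoints {Q} Q<p = begin
    length (endpoints Q)
      ≡⟨ length-concatMap (endpoint Q) (redistribution p r c) ⟩
    sum (map (length ∘ endpoint Q) (redistribution p r c))
      ≡⟨ sum-redistribution _ (λ q q′ → δ Q q + δ Q q′) ends ⟩
    ∑ p (λ q → ∑ p (λ q′ → δ Q q + δ Q q′)) * (r * c)           ≡⟨ cong (_* (r * c)) (∑-endpoints Q<p) ⟩
    (p + p) * (r * c)                                           ≡⟨ double p (r * c) ⟩
    2 * (p * (r * c))                                           ∎
    where
    open ≡-Reasoning
    ends : ∀ q q′ from to → length (endpoint Q (msg q q′ from to)) ≡ δ Q q + δ Q q′
    ends q q′ from to with does (Q ≟ q) | does (Q ≟ q′)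
    ... | true  | true  = refl
    ... | true  | false = refl
    ... | false | true  = refl
    ... | false | false = refl
    double : ∀ p x → (p + p) * x ≡ 2 * (p * x)
    double = solve-∀

  private
    All-endpoint : ∀ {ℓ} {P : Loc → Set ℓ} Q m → P (from m) → P (to m) → All P (endpoint Q m)
    All-endpoint Q m pf pt with does (Q ≟ src m) | does (Q ≟ dst m)
    ... | true  | true  = pf ∷ pt ∷ []
    ... | true  | false = pf ∷ []
    ... | false | true  = pt ∷ []
    ... | false | false = []

  within-endpoints : ∀ Q s → All (Within (p * (r * c)) s) (endpoints Q)
  within-endpoints Q s = subst (All (Within (p * (r * c)) s)) (sym (endpoints-nested Q))
    (All-concatMap-upTo _ p λ q q<p → All-concatMap-upTo _ p λ q′ q′<p →
     All-concatMap-upTo _ r λ v v<r → All-concatMap-upTo _ c λ j j<c →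
     All-endpoint Q (message q q′ v j)
       (subst ((q′ * r + v) * c + j <_) (*-assoc p r c) (row-bound (row-bound q′<p v<r) j<c))
       (row-bound q<p (row-bound v<r j<c)))

  -- Messages for one row of a block are invisible to Q unless Q is their source
  -- or their destination; otherwise they make Q scan an input row, an output
  -- row, or both.
  cost-endpoints : ∀ {k B Q} .{{_ : NonZero B}} → 6 ≤ k → B ≤ c → Q < p →
    Cost k B (52 * (p * (r * c))) (endpoints Q)
  cost-endpoints {k} {B} {Q} 6≤k B≤c Q<p = cost-≤ k B bound (subst (Cost k B _) (sym (endpoints-nested Q))
    (cost-concatMap k B _ _ p λ q _ → cost-concatMap k B _ _ p λ q′ _ →
     cost-concatMap-const k B ((δ Q q + δ Q q′) * (26 * c)) _ r λ v _ → row q q′ v))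
    where
    scan : ∀ q q′ v → Cost k B (26 * c) (concatMap (λ j → endpoint Q (message q q′ v j)) (upTo c))
    scan q q′ v = cost-scan k B
      {(λ j → cell input c (q′ * r + v) j) ∷ (λ j → output , q * (r * c) + v * c + j) ∷ []} (s≤s (s≤s z≤n)) 6≤k
      (slow-scan k B input ((q′ * r + v) * c) ∷ slow-scan k B output (q * (r * c) + v * c) ∷ []) B≤c
      (λ j _ → All-endpoint Q (message q q′ v j) (here refl)
        (there (here (cong (output ,_) (sym (+-assoc (q * (r * c)) (v * c) j))))))
    active : ∀ q q′ v → 1 ≤ δ Q q + δ Q q′ →
      Cost k B ((δ Q q + δ Q q′) * (26 * c)) (concatMap (λ j → endpoint Q (message q q′ v j)) (upTo c))
    active q q′ v 1≤ = cost-≤ k B (≤-trans (≤-reflexive (sym (*-identityˡ (26 * c)))) (*-monoˡ-≤ (26 * c) 1≤)) (scan q q′ v)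
    silent : ∀ q q′ v j → Q ≢ q → Q ≢ q′ → endpoint Q (message q q′ v j) ≡ []
    silent q q′ v j Q≢q Q≢q′ rewrite dec-false (Q ≟ q) Q≢q | dec-false (Q ≟ q′) Q≢q′ = refl
    row : ∀ q q′ v → Cost k B ((δ Q q + δ Q q′) * (26 * c)) (concatMap (λ j → endpoint Q (message q q′ v j)) (upTo c))
    row q q′ v with Q ≟ q | Q ≟ q′
    ... | yes refl | _        = active q q′ v (≤-trans (≤-reflexive (sym (δ-refl q))) (m≤m+n (δ q q) (δ q q′)))
    ... | no _     | yes refl = active q q′ v (≤-trans (≤-reflexive (sym (δ-refl q′))) (m≤n+m (δ q′ q′) (δ q′ q)))
    ... | no Q≢q   | no Q≢q′  = cost-≤ k B (≤-trans (≤-reflexive (*-zeroʳ c)) z≤n)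
      (cost-concatMap-const k B 0 _ c λ j _ → subst (Cost k B 0) (sym (silent q q′ v j Q≢q Q≢q′)) (cost-[] k B))
    open ≤-Reasoning
    bound : ∑ p (λ q → ∑ p (λ q′ → r * ((δ Q q + δ Q q′) * (26 * c)))) ≤ 52 * (p * (r * c))
    bound = begin
      ∑ p (λ q → ∑ p (λ q′ → r * ((δ Q q + δ Q q′) * (26 * c))))
        ≡⟨ ∑-cong p (λ q _ → trans (∑-cong p (λ q′ _ → shift r (δ Q q + δ Q q′) c)) (∑-*ʳ p (λ q′ → δ Q q + δ Q q′) (26 * (r * c)))) ⟩
      ∑ p (λ q → ∑ p (λ q′ → δ Q q + δ Q q′) * (26 * (r * c)))
        ≡⟨ ∑-*ʳ p (λ q → ∑ p (λ q′ → δ Q q + δ Q q′)) (26 * (r * c)) ⟩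
      ∑ p (λ q → ∑ p (λ q′ → δ Q q + δ Q q′)) * (26 * (r * c))
        ≡⟨ cong (_* (26 * (r * c))) (∑-endpoints Q<p) ⟩
      (p + p) * (26 * (r * c))
        ≡⟨ double p (r * c) ⟩
      52 * (p * (r * c))
        ∎
      where
      shift : ∀ r d c → r * (d * (26 * c)) ≡ d * (26 * (r * c))
      shift = solve-∀
      double : ∀ p x → (p + p) * (26 * x) ≡ 52 * (p * x)
      double = solve-∀

-- The complete redistribution

module _ (b m₁ m₂ p r c : ℕ) .{{_ : NonZero b}} where

  -- Packing, exchange and unpacking on p processors for b ^ m₁ = r p and
  -- b ^ m₂ = c p.
  redistribute : Alg
  redistribute = local (pack b m₁ c) ∷ exchange (redistribution p r c) ∷ local (λ _ → unpack b m₂ p r c) ∷ []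

  requests : ℕ → List Loc
  requests q = concatMap (stepAccesses q) redistribute

module Complexity (b m₁ m₂ p r c : ℕ) .{{_ : NonZero b}} (2≤b : 2 ≤ b) (1≤r : 1 ≤ r) (1≤c : 1 ≤ c)
                  (N₁≡ : b ^ m₁ ≡ r * p) (N₂≡ : b ^ m₂ ≡ c * p) where

  private
    procedure : Alg
    procedure = redistribute b m₁ m₂ p r c

    accessesOf : ℕ → List Loc
    accessesOf = requests b m₁ m₂ p r c

  -- The number of items per processor.
  items : ℕ
  items = p * (r * c)

  N₁c≡items : b ^ m₁ * c ≡ items
  N₁c≡items = trans (cong (_* c) N₁≡) (regroup r p c)
    where
    regroup : ∀ r p c → r * p * c ≡ p * (r * c)
    regroup = solve-∀

  N₂r≡items : b ^ m₂ * r ≡ items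
  N₂r≡items = trans (cong (_* r) N₂≡) (regroup r p c)
    where
    regroup : ∀ r p c → c * p * r ≡ p * (r * c)
    regroup = solve-∀

  p≤items : p ≤ items
  p≤items = subst (_≤ items) (*-identityʳ p) (*-monoʳ-≤ p (*-mono-≤ 1≤r 1≤c))

  moves-unpack : moves (unpack b m₂ p r c) ≤ 14 * items
  moves-unpack = begin
    ∑ p (λ q → suc (moves (transpose (q * (r * c)) r c))) + moves (forRows b m₂ (swapRow r))
      ≤⟨ +-mono-≤ (∑-mono p (λ q _ → s≤s (moves-transpose (q * (r * c)) r c 1≤r 1≤c))) (moves-forRows b m₂ (swapRow r) 2≤b 1≤r (moves-swapRow r)) ⟩
    ∑ p (λ _ → suc (5 * (r * c))) + 8 * (b ^ m₂ * r)
      ≡⟨ cong₂ _+_ (∑-const p _) (cong (8 *_) N₂r≡items) ⟩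
    p * suc (5 * (r * c)) + 8 * items
      ≡⟨ regroup p (r * c) ⟩
    p + 13 * items
      ≤⟨ +-monoˡ-≤ (13 * items) p≤items ⟩
    14 * items
      ∎
    where
    open ≤-Reasoning
    regroup : ∀ p x → p * suc (5 * x) + 8 * (p * x) ≡ p + 13 * (p * x)
    regroup = solve-∀

  Wʳᵉᵃʳʳ-≤ : ∀ {q} → q < p → Wʳᵉᵃʳʳ procedure q ≤ 24 * items
  Wʳᵉᵃʳʳ-≤ {q} q<p = begin
    moves (pack b m₁ c q) + (length (endpoints p r c q) + (moves (unpack b m₂ p r c) + 0))
      ≤⟨ +-mono-≤ (moves-forRows b m₁ (packRow c q) 2≤b 1≤c (moves-packRow c q)) (+-mono-≤ (≤-reflexive (length-endpoints p r c q<p)) (+-monoˡ-≤ 0 moves-unpack)) ⟩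
    8 * (b ^ m₁ * c) + (2 * items + (14 * items + 0))
      ≡⟨ cong (λ n → 8 * n + (2 * items + (14 * items + 0))) N₁c≡items ⟩
    8 * items + (2 * items + (14 * items + 0))
      ≡⟨ total items ⟩
    24 * items
      ∎
    where
    open ≤-Reasoning
    total : ∀ x → 8 * x + (2 * x + (14 * x + 0)) ≡ 24 * x
    total = solve-∀

  -- No twiddle factors are applied outside packing.
  arith-transposeRec : ∀ τ base fuel i j h w → arith τ (transposeRec base r c fuel i j h w) ≡ 0
  arith-transposeRec τ base zero       i j h w = refl
  arith-transposeRec τ base (suc fuel) i j h w with (h ≤ᵇ 1) ∧ (w ≤ᵇ 1) | w ≤ᵇ h
  ... | true  | _     = refl
  ... | false | true  = cong₂ _+_ (arith-transposeRec τ base fuel i j _ w) (arith-transposeRec τ base fuel _ j _ w)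
  ... | false | false = cong₂ _+_ (arith-transposeRec τ base fuel i j h _) (arith-transposeRec τ base fuel i _ h _)

  arith-unpack : ∀ τ → arith τ (unpack b m₂ p r c) ≡ 0
  arith-unpack τ = cong₂ _+_
    (∑-0 p λ q → cong₂ _+_ (arith-transposeRec τ (q * (r * c)) (r + c) 0 0 r c) (∑-0 (r * c) λ _ → refl))
    (∑-0 (b ^ m₂) λ a → swapRow-cases (λ P → arith τ P ≡ 0) r a (π b m₂ a) (λ _ → ∑-0 r λ _ → refl) (λ _ → refl))

  Wᵃʳⁱᵗʰ≡ : ∀ τ q → Wᵃʳⁱᵗʰ τ procedure q ≡ arith τ (pack b m₁ c q)
  Wᵃʳⁱᵗʰ≡ τ q = trans (cong (λ n → arith τ (pack b m₁ c q) + (n + 0)) (arith-unpack τ)) (+-identityʳ _)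

  Wᵃʳⁱᵗʰ-≥ : ∀ τ q → items ≤ Wᵃʳⁱᵗʰ τ procedure q
  Wᵃʳⁱᵗʰ-≥ τ q = subst₂ _≤_ N₁c≡items (sym (Wᵃʳⁱᵗʰ≡ τ q)) (arith-pack-≥ b m₁ c q τ)

  Wᵃʳⁱᵗʰ-≤ : ∀ {τ τmax} → (∀ e → τ e ≤ τmax) → ∀ q → Wᵃʳⁱᵗʰ τ procedure q ≤ 2 * suc τmax * items
  Wᵃʳⁱᵗʰ-≤ {τ} {τmax} τ≤ q = subst₂ (λ w n → w ≤ 2 * suc τmax * n) (sym (Wᵃʳⁱᵗʰ≡ τ q)) N₁c≡items (arith-pack-≤ b m₁ c q τ τ≤)

  -- Storage

  -- No location outside the input and output arrays, a scratch block and the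
  -- temporary item is used.
  within-requests : ∀ q → All (Within items (r * c)) (accessesOf q)
  within-requests q =
    All.++⁺ (subst (λ n → All (Within n (r * c)) (accesses (pack b m₁ c q))) N₁c≡items
              (within-forRows b m₁ (packRow c q) (within-packRow q)))
    (All.++⁺ (within-endpoints p r c q (r * c))
    (All.++⁺ (All.++⁺
      (All-concatMap-upTo _ p λ q q<p → within-transpose (q * (r * c)) r c 1≤r 1≤c (block-end q q<p))
      (subst (λ n → All (Within n (r * c)) (accesses (forRows b m₂ (swapRow r)))) N₂r≡items
              (within-forRows b m₂ (swapRow r) within-swapRow))) []))
    where
    block-end : ∀ q → q < p → q * (r * c) + r * c ≤ items
    block-end q q<p = subst (_≤ items) (+-comm (r * c) (q * (r * c))) (*-monoˡ-≤ (r * c) q<p)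

  control-unpack : ∀ x y → r ≤ 2 ^ x → c ≤ 2 ^ y → m₂ ≤ y → control (unpack b m₂ p r c) ≤ 6 + 5 * (x + y)
  control-unpack x y r≤ c≤ m₂≤y = ⊔-lub
    (≤-trans (s≤s (maximum-upTo-≤ _ p (λ q → control-transpose (q * (r * c)) r c 1≤r 1≤c x y r≤ c≤))) (≤-reflexive (cong suc (*-suc 5 (x + y)))))
    (≤-trans (control-forRows b m₂ (swapRow r) (control-swapRow r)) (≤-trans (≤-reflexive (+-comm m₂ 2)) (+-mono-≤ {2} {6} (s≤s (s≤s z≤n)) (≤-trans m₂≤y (≤-trans (m≤n+m y x) (m≤m+n (x + y) _))))))

  workspace-≤ : ∀ x y → r ≤ 2 ^ x → c ≤ 2 ^ y → m₁ ≤ x → m₂ ≤ y → ∀ q →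
    workspace items procedure q ≤ 8 * (r * c + (x + y))
  workspace-≤ x y r≤ c≤ m₁≤x m₂≤y q = begin
    (extent input (accessesOf q) ∸ items) + (extent output (accessesOf q) ∸ items) + extent scratch (accessesOf q)
      + extent temp (accessesOf q) + (control (pack b m₁ c q) ⊔ (0 ⊔ (control (unpack b m₂ p r c) ⊔ 0)))
      ≤⟨ +-mono-≤ (+-mono-≤ (+-mono-≤ (+-mono-≤
           (≤-reflexive (m≤n⇒m∸n≡0 (extent-≤ input (within-requests q))))
           (≤-reflexive (m≤n⇒m∸n≡0 (extent-≤ output (within-requests q)))))
           (extent-≤ scratch (within-requests q))) (extent-≤ temp (within-requests q)))
           (⊔-lub control-pack (⊔-lub z≤n (⊔-lub (control-unpack x y r≤ c≤ m₂≤y) z≤n))) ⟩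
    0 + 0 + r * c + 1 + (6 + 5 * (x + y))
      ≡⟨ regroup (r * c) (x + y) ⟩
    r * c + 7 * 1 + 5 * (x + y)
      ≤⟨ +-mono-≤ (+-monoʳ-≤ (r * c) (*-monoʳ-≤ 7 (*-mono-≤ 1≤r 1≤c))) (*-monoˡ-≤ (x + y) {5} {8} (s≤s (s≤s (s≤s (s≤s (s≤s z≤n)))))) ⟩
    r * c + 7 * (r * c) + 8 * (x + y)
      ≡⟨ total (r * c) (x + y) ⟩
    8 * (r * c + (x + y))
      ∎
    where
    open ≤-Reasoning
    control-pack : control (pack b m₁ c q) ≤ 6 + 5 * (x + y)
    control-pack = ≤-trans (control-forRows b m₁ (packRow c q) (control-packRow c q)) (≤-trans (≤-reflexive (+-comm m₁ 2)) (+-mono-≤ {2} {6} (s≤s (s≤s z≤n)) (≤-trans m₁≤x (≤-trans (m≤m+n x y) (m≤m+n (x + y) _)))))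
    regroup : ∀ x y → 0 + 0 + x + 1 + (6 + 5 * y) ≡ x + 7 * 1 + 5 * y
    regroup = solve-∀
    total : ∀ x y → x + 7 * x + 8 * y ≡ 8 * (x + y)
    total = solve-∀

  -- Cache misses

  -- The trivial bound on misses.
  length-requests : ∀ {q} → q < p → length (accessesOf q) ≤ 48 * items
  length-requests {q} q<p = begin
    length (accessesOf q)
      ≡⟨ length-concatMap (stepAccesses q) procedure ⟩
    length (accesses (pack b m₁ c q)) + (length (endpoints p r c q) + (length (accesses (unpack b m₂ p r c)) + 0))
      ≤⟨ +-mono-≤ (length-accesses-≤ (pack b m₁ c q)) (+-mono-≤ (m≤m+n (length (endpoints p r c q)) _) (+-monoˡ-≤ 0 (length-accesses-≤ (unpack b m₂ p r c)))) ⟩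
    2 * moves (pack b m₁ c q) + (2 * length (endpoints p r c q) + (2 * moves (unpack b m₂ p r c) + 0))
      ≡⟨ regroup (moves (pack b m₁ c q)) (length (endpoints p r c q)) (moves (unpack b m₂ p r c)) ⟩
    2 * Wʳᵉᵃʳʳ procedure q
      ≤⟨ *-monoʳ-≤ 2 (Wʳᵉᵃʳʳ-≤ q<p) ⟩
    2 * (24 * items)
      ≡⟨ *-assoc 2 24 items ⟨
    48 * items
      ∎
    where
    open ≤-Reasoning
    regroup : ∀ x y z → 2 * x + (2 * y + (2 * z + 0)) ≡ 2 * (x + (y + (z + 0)))
    regroup = solve-∀

  cost-requests : ∀ {k B T γ q} .{{_ : NonZero B}} → 6 ≤ k → B ≤ r → B ≤ c →
    1 ≤ T → T ≤ B → 4 * T ≤ k → B ≤ γ * T → q < p →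
    Cost k B ((130 + 20 * γ) * items) (accessesOf q)
  cost-requests {k} {B} {T} {γ} {q} 6≤k B≤r B≤c 1≤T T≤B 4T≤k B≤γT q<p = cost-≤ k B bound
    (cost-++ k B (cost-forRows b m₁ (packRow c q) (λ a v → cost-packRow 6≤k q a v B≤c))
    (cost-++ k B (cost-endpoints p r c 6≤k B≤c q<p)
    (cost-++ k B (cost-++ k B
      (cost-concatMap-const k B _ _ p λ q _ → cost-transpose (q * (r * c)) r c 1≤r 1≤c {γ = γ} 6≤k B≤r B≤c 1≤T T≤B 4T≤k B≤γT)
      (cost-forRows b m₂ (swapRow r) (λ a u → cost-swapRow 6≤k a u B≤r)))
      (cost-[] k B))))
    where
    open ≤-Reasoning
    bound : b ^ m₁ * (26 * c) + (52 * items + (p * (20 * γ * (r * c) + 26 * (r * c)) + b ^ m₂ * (26 * r) + 0))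
              ≤ (130 + 20 * γ) * items
    bound = begin
      b ^ m₁ * (26 * c) + (52 * items + (p * (20 * γ * (r * c) + 26 * (r * c)) + b ^ m₂ * (26 * r) + 0))
        ≡⟨ cong₂ (λ x y → x + (52 * items + (p * (20 * γ * (r * c) + 26 * (r * c)) + y + 0)))
             (trans (swap (b ^ m₁) c) (cong (26 *_) N₁c≡items)) (trans (swap (b ^ m₂) r) (cong (26 *_) N₂r≡items)) ⟩
      26 * items + (52 * items + (p * (20 * γ * (r * c) + 26 * (r * c)) + 26 * items + 0))
        ≡⟨ total γ p (r * c) ⟩
      (130 + 20 * γ) * items
        ∎
      where
      swap : ∀ x y → x * (26 * y) ≡ 26 * (x * y)
      swap = solve-∀
      total : ∀ g p x → 26 * (p * x) + (52 * (p * x) + (p * (20 * g * x + 26 * x) + 26 * (p * x) + 0)) ≡ (130 + 20 * g) * (p * x)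
      total = solve-∀

  -- With fewer than six lines in the cache, B ² = O(M) = O(B) forces
  -- B = O(1), and counting every access as a miss suffices.  Otherwise
  -- subblocks of side T = min (B , k / 4) serve for the transposition, and
  -- B ² = O(M) gives B = O(T).
  cacheMisses-≤ : ∀ {κ M B q} .{{_ : NonZero B}} → B * B ≤ κ * M → B ≤ r → B ≤ c → q < p →
    cacheMisses M B procedure q * B ≤ (150 + 288 * κ) * items
  cacheMisses-≤ {κ} {M} {B} {q} B²≤κM B≤r B≤c q<p with 6 ≤? M / B
  ... | yes 6≤k = ≤-trans (*-monoˡ-≤ B (bounded⇒misses k (Cost.is-bounded total))) (≤-trans (Cost.count≤ total) enough)
    where
    open ≤-Reasoning
    k = M / B
    -- A T × T subproblem meets at most 4 T lines.
    x = k / 4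
    T = B ⊓ x
    γ = 1 + 8 * κ
    1≤B : 1 ≤ B
    1≤B = >-nonZero⁻¹ B
    1≤x : 1 ≤ x
    1≤x = m≥n⇒m/n>0 (≤-trans (s≤s (s≤s (s≤s (s≤s z≤n)))) 6≤k)
    k<8x : suc k ≤ 8 * x
    k<8x = begin
      suc k                 ≡⟨ cong suc (div-mod k 4) ⟨
      suc (x * 4 + k % 4)   ≡⟨ +-suc (x * 4) (k % 4) ⟨
      x * 4 + suc (k % 4)   ≤⟨ +-monoʳ-≤ (x * 4) (≤-trans (m%n<n k 4) (*-monoʳ-≤ 4 1≤x)) ⟩
      x * 4 + 4 * x         ≡⟨ twice x ⟩
      8 * x                 ∎
      where
      twice : ∀ x → x * 4 + 4 * x ≡ 8 * x
      twice = solve-∀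
    B≤8κx : B ≤ 8 * κ * x
    B≤8κx = *-cancelʳ-≤ B (8 * κ * x) B (begin
      B * B                   ≤⟨ B²≤κM ⟩
      κ * M                   ≡⟨ cong (κ *_) (div-mod M B) ⟨
      κ * (k * B + M % B)     ≤⟨ *-monoʳ-≤ κ (+-monoʳ-≤ (k * B) (m%n≤n M B)) ⟩
      κ * (k * B + B)         ≡⟨ cong (κ *_) (+-comm (k * B) B) ⟩
      κ * (suc k * B)         ≤⟨ *-monoʳ-≤ κ (*-monoˡ-≤ B k<8x) ⟩
      κ * (8 * x * B)         ≡⟨ regroup κ x B ⟩
      8 * κ * x * B           ∎)
      where
      regroup : ∀ κ x b → κ * (8 * x * b) ≡ 8 * κ * x * b
      regroup = solve-∀
    B≤γT : B ≤ γ * T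
    B≤γT with ⊓-sel B x
    ... | inj₁ T≡B = subst (λ n → B ≤ γ * n) (sym T≡B) (m≤m+n B _)
    ... | inj₂ T≡x = subst (λ n → B ≤ γ * n) (sym T≡x) (≤-trans B≤8κx (m≤n+m _ x))
    total : Cost k B ((130 + 20 * γ) * items) (accessesOf q)
    total = cost-requests {k} {B} {T} {γ} 6≤k B≤r B≤c (⊓-glb 1≤B 1≤x) (m⊓n≤m B x)
      (≤-trans (*-monoʳ-≤ 4 (m⊓n≤n B x)) (≤-trans (≤-reflexive (*-comm 4 x)) (m/n*n≤m k 4))) B≤γT q<p
    enough : (130 + 20 * γ) * items ≤ (150 + 288 * κ) * items
    enough = *-monoˡ-≤ items (begin
      130 + 20 * γ          ≡⟨ expand κ ⟩
      150 + 160 * κ         ≤⟨ +-monoʳ-≤ 150 (*-monoˡ-≤ κ (m≤m+n 160 128)) ⟩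
      150 + 288 * κ         ∎)
      where
      expand : ∀ κ → 130 + 20 * (1 + 8 * κ) ≡ 150 + 160 * κ
      expand = solve-∀
  ... | no 6≰k = begin
    cacheMisses M B procedure q * B
      ≤⟨ *-monoˡ-≤ B (bounded⇒misses k (Cost.is-bounded (cost-length k B (accessesOf q)))) ⟩
    length (accessesOf q) * B                  ≤⟨ *-mono-≤ (length-requests q<p) B≤6κ ⟩
    48 * items * (6 * κ)                     ≡⟨ regroup items κ ⟩
    288 * κ * items                          ≤⟨ *-monoˡ-≤ items (m≤n+m (288 * κ) 150) ⟩
    (150 + 288 * κ) * items                  ∎
    where
    open ≤-Reasoning
    k = M / B
    regroup : ∀ n κ → 48 * n * (6 * κ) ≡ 288 * κ * n
    regroup = solve-∀
    B≤6κ : B ≤ 6 * κ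
    B≤6κ = *-cancelʳ-≤ B (6 * κ) B (begin
      B * B               ≤⟨ B²≤κM ⟩
      κ * M               ≡⟨ cong (κ *_) (div-mod M B) ⟨
      κ * (k * B + M % B) ≤⟨ *-monoʳ-≤ κ (+-monoʳ-≤ (k * B) (m%n≤n M B)) ⟩
      κ * (k * B + B)     ≡⟨ cong (κ *_) (+-comm (k * B) B) ⟩
      κ * (suc k * B)     ≤⟨ *-monoʳ-≤ κ (*-monoˡ-≤ B (≰⇒> 6≰k)) ⟩
      κ * (6 * B)         ≡⟨ swap κ B ⟩
      6 * κ * B           ∎)
      where
      swap : ∀ κ b → κ * (6 * b) ≡ 6 * κ * b
      swap = solve-∀

-- Memory and loops

loop-invariant : ∀ {a ℓ} {A : Set a} (I : ℕ → A → Set ℓ) n f {y} → I 0 y →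
  (∀ i y → i < n → I i y → I (suc i) (f i y)) → I n (loop n f y)
loop-invariant I zero    f base step = base
loop-invariant I (suc n) f base step =
  step n _ ≤-refl (loop-invariant I n f base λ i y i<n → step i y (m<n⇒m<1+n i<n))

module _ {x} {X : Set x} where

  write-same : ∀ l (y : X) μ → write l y μ l ≡ y
  write-same l y μ = cong (if_then y else μ l) (dec-true (l ≟ᴸ l) refl)

  write-other : ∀ l l′ (y : X) μ → l′ ≢ l → write l y μ l′ ≡ μ l′
  write-other l l′ y μ l′≢l = cong (if_then y else μ l′) (dec-false (l′ ≟ᴸ l) l′≢l)

  -- If step i changes none of the locations L i′ s with i′ ≢ i, then the loop
  -- affects the locations L i s as step i alone does, run in a state that
  -- agrees on them with the initial one.
  loop-independent : ∀ {s} {S : Set s} (L : ℕ → S → Loc) n (f : ℕ → Mem X → Mem X) μ →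
    (∀ i i′ s μ → i < n → i′ < n → i′ ≢ i → f i μ (L i′ s) ≡ μ (L i′ s)) →
    ∀ i → i < n → ∃[ μ′ ] (∀ s → μ′ (L i s) ≡ μ (L i s)) × (∀ s → loop n f μ (L i s) ≡ f i μ′ (L i s))
  loop-independent {S = S} L n f μ indep i i<n = proj₁ (loop-invariant I n f start step) i<n
    where
    Done : Mem X → Set _
    Done μ₁ = ∃[ μ′ ] (∀ s → μ′ (L i s) ≡ μ (L i s)) × (∀ s → μ₁ (L i s) ≡ f i μ′ (L i s))
    I : ℕ → Mem X → Set _
    I k μ₁ = (i < k → Done μ₁) × (k ≤ i → ∀ s → μ₁ (L i s) ≡ μ (L i s))
    start : I 0 μ
    start = (λ ()) , (λ _ s → refl)
    step : ∀ k μ₁ → k < n → I k μ₁ → I (suc k) (f k μ₁)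
    step k μ₁ k<n (done , same) = done′ , same′
      where
      done′ : i < suc k → Done (f k μ₁)
      done′ (s≤s i≤k) with m≤n⇒m<n∨m≡n i≤k
      ... | inj₂ refl = μ₁ , same ≤-refl , λ s → refl
      ... | inj₁ i<k with done i<k
      ...   | μ′ , agree , effect = μ′ , agree , λ s → trans (indep k i s μ₁ k<n i<n (<⇒≢ i<k)) (effect s)
      same′ : suc k ≤ i → ∀ s → f k μ₁ (L i s) ≡ μ (L i s)
      same′ k<i s = trans (indep k i s μ₁ k<n i<n (<⇒≢ k<i ∘ sym)) (same (<⇒≤ k<i) s)

  loop-unchanged : ∀ n (f : ℕ → Mem X → Mem X) μ l → (∀ i μ → i < n → f i μ l ≡ μ l) → loop n f μ l ≡ μ l
  loop-unchanged n f μ l same = loop-invariant (λ _ μ′ → μ′ l ≡ μ l) n f refl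
    (λ i μ′ i<n eq → trans (same i μ′ i<n) eq)

cell-injective : ∀ {ρ n} x x′ {j j′} → j < n → j′ < n → cell ρ n x j ≡ cell ρ n x′ j′ → x ≡ x′ × j ≡ j′
cell-injective x x′ j<n j′<n eq = row-injective x x′ j<n j′<n (,-injectiveʳ eq)

-- In-place row permutation

-- The entries of an array with rows of length n in region ρ are permuted; F w j
-- is applied to an item arriving at row w and column j.
module _ {x} {X : Set x} (ρ : Region) (ρ≢temp : ρ ≢ temp) (n : ℕ) (F : (a j : ℕ) → X → X) where

  private
    at : ℕ → ℕ → Loc
    at = cell ρ n

  private
    -- The memory after saving the entry of row a, and after replacing it.
    save replace : (a v j : ℕ) → Mem X → Mem X
    save    a v j μ = write tmp (μ (at a j)) μ
    replace a v j μ = write (at a j) (F a j (save a v j μ (at v j))) (save a v j μ)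

  -- Entry j of the rows a and v is interchanged by way of the temporary item,
  -- and F applied.
  swapEntry : (a v j : ℕ) → Mem X → Mem X
  swapEntry a v j μ = write (at v j) (F v j (replace a v j μ tmp)) (replace a v j μ)

  swapEntry-a : ∀ {a v j} → a ≢ v → j < n → ∀ μ → swapEntry a v j μ (at a j) ≡ F a j (μ (at v j))
  swapEntry-a {a} {v} {j} a≢v j<n μ = begin
    swapEntry a v j μ (at a j)
      ≡⟨ write-other (at v j) (at a j) _ (replace a v j μ) (a≢v ∘ proj₁ ∘ cell-injective a v j<n j<n) ⟩
    replace a v j μ (at a j)          ≡⟨ write-same (at a j) _ (save a v j μ) ⟩
    F a j (save a v j μ (at v j))
      ≡⟨ cong (F a j) (write-other tmp (at v j) (μ (at a j)) μ (ρ≢temp ∘ ,-injectiveˡ)) ⟩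
    F a j (μ (at v j))                ∎
    where open ≡-Reasoning

  swapEntry-v : ∀ {a v j} μ → swapEntry a v j μ (at v j) ≡ F v j (μ (at a j))
  swapEntry-v {a} {v} {j} μ = begin
    swapEntry a v j μ (at v j)        ≡⟨ write-same (at v j) _ (replace a v j μ) ⟩
    F v j (replace a v j μ tmp)
      ≡⟨ cong (F v j) (write-other (at a j) tmp _ (save a v j μ) (ρ≢temp ∘ sym ∘ ,-injectiveˡ)) ⟩
    F v j (save a v j μ tmp)          ≡⟨ cong (F v j) (write-same tmp (μ (at a j)) μ) ⟩
    F v j (μ (at a j))                ∎
    where open ≡-Reasoning

  swapEntry-other : ∀ a v j x j′ μ → at x j′ ≢ at a j → at x j′ ≢ at v j →
    swapEntry a v j μ (at x j′) ≡ μ (at x j′)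
  swapEntry-other a v j x j′ μ ≢a ≢v = begin
    swapEntry a v j μ (at x j′)       ≡⟨ write-other (at v j) (at x j′) _ (replace a v j μ) ≢v ⟩
    replace a v j μ (at x j′)         ≡⟨ write-other (at a j) (at x j′) _ (save a v j μ) ≢a ⟩
    save a v j μ (at x j′)            ≡⟨ write-other tmp (at x j′) (μ (at a j)) μ (ρ≢temp ∘ ,-injectiveˡ) ⟩
    μ (at x j′)                       ∎
    where open ≡-Reasoning

  -- μ′ arises from μ by interchanging the rows a and v, with F applied.
  record Swapped (a v : ℕ) (μ μ′ : Mem X) : Set x where
    field
      row-a : ∀ {j} → j < n → μ′ (at a j) ≡ F a j (μ (at v j))
      row-v : ∀ {j} → j < n → μ′ (at v j) ≡ F v j (μ (at a j))
      other : ∀ {x j} → j < n → x ≢ a → x ≢ v → μ′ (at x j) ≡ μ (at x j)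

  open Swapped

  private
    columns : (f : ℕ → Mem X → Mem X) →
      (∀ j j′ x μ → j < n → j′ < n → j′ ≢ j → f j μ (at x j′) ≡ μ (at x j′)) → ∀ μ j → j < n →
      ∃[ μ′ ] (∀ x → μ′ (at x j) ≡ μ (at x j)) × (∀ x → loop n f μ (at x j) ≡ f j μ′ (at x j))
    columns f indep μ = loop-independent (λ j x → at x j) n f μ indep

  loop-swapEntry : ∀ {a v} → a ≢ v → ∀ μ → Swapped a v μ (loop n (swapEntry a v) μ)
  loop-swapEntry {a} {v} a≢v μ = record
    { row-a = λ {j} j<n → let μ′ , agree , effect = column j j<n in
        trans (effect a) (trans (swapEntry-a a≢v j<n μ′) (cong (F a j) (agree v)))
    ; row-v = λ {j} j<n → let μ′ , agree , effect = column j j<n in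
        trans (effect v) (trans (swapEntry-v μ′) (cong (F v j) (agree a)))
    ; other = λ {x} {j} j<n x≢a x≢v → let μ′ , agree , effect = column j j<n in
        trans (effect x) (trans (swapEntry-other a v j x j μ′ (x≢a ∘ proj₁ ∘ cell-injective x a j<n j<n) (x≢v ∘ proj₁ ∘ cell-injective x v j<n j<n)) (agree x))
    }
    where
    column = columns (swapEntry a v) (λ j j′ x μ j<n j′<n j′≢j →
      swapEntry-other a v j x j′ μ (j′≢j ∘ proj₂ ∘ cell-injective x a j′<n j<n) (j′≢j ∘ proj₂ ∘ cell-injective x v j′<n j<n)) μ

  -- A fixed row is a degenerate interchange.
  loop-scaleEntry : ∀ v μ → Swapped v v μ (loop n (λ j μ → write (at v j) (F v j (μ (at v j))) μ) μ)
  loop-scaleEntry v μ = record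
    { row-a = scaled
    ; row-v = scaled
    ; other = λ {x} {j} j<n x≢v _ → let μ′ , agree , effect = column j j<n in
        trans (effect x) (trans (write-other (at v j) (at x j) _ μ′ (x≢v ∘ proj₁ ∘ cell-injective x v j<n j<n)) (agree x))
    }
    where
    column = columns (λ j μ → write (at v j) (F v j (μ (at v j))) μ) (λ j j′ x μ j<n j′<n j′≢j →
      write-other (at v j) (at x j′) _ μ (j′≢j ∘ proj₂ ∘ cell-injective x v j′<n j<n)) μ
    scaled : ∀ {j} → j < n → loop n (λ j μ → write (at v j) (F v j (μ (at v j))) μ) μ (at v j) ≡ F v j (μ (at v j))
    scaled {j} j<n = let μ′ , agree , effect = column j j<n in
      trans (effect v) (trans (write-same (at v j) _ μ′) (cong (F v j) (agree v)))

  -- The step for row a of a permutation by an involution taking a to v: for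
  -- a ≤ v the rows are swapped and F is applied, also if they coincide; for
  -- v < a nothing changes.
  RowStep : (a v : ℕ) → (Mem X → Mem X) → Set x
  RowStep a v f = ∀ μ →
    (a ≤ v → Swapped a v μ (f μ)) × (v < a → ∀ x {j} → j < n → f μ (at x j) ≡ μ (at x j))

  -- Performing these steps for all rows moves row σ x to row x and applies F to
  -- each entry once.
  loop-permute : ∀ N (σ : ℕ → ℕ) → (∀ a → a < N → σ a < N) → (∀ a → a < N → σ (σ a) ≡ a) →
    ∀ f → (∀ a → a < N → RowStep a (σ a) (f a)) →
    ∀ μ {x j} → x < N → j < n → loop N f μ (at x j) ≡ F x j (μ (at (σ x) j))
  loop-permute N σ σ< σσ f steps μ x<N j<n = proj₁ (loop-invariant I N f {μ} start step _ x<N j<n) (inj₁ x<N)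
    where
    -- Before step i the rows x with x < i or σ x < i are final, the others
    -- untouched.
    I : ℕ → Mem X → Set x
    I i μ₁ = ∀ x → x < N → ∀ {j} → j < n →
      (x < i ⊎ σ x < i → μ₁ (at x j) ≡ F x j (μ (at (σ x) j))) ×
      (i ≤ x → i ≤ σ x → μ₁ (at x j) ≡ μ (at x j))
    start : I 0 μ
    start x x<N j<n = (λ { (inj₁ ()) ; (inj₂ ()) }) , (λ _ _ → refl)
    step : ∀ i μ₁ → i < N → I i μ₁ → I (suc i) (f i μ₁)
    step i μ₁ i<N inv x x<N {j} j<n with i ≤? σ i
    ... | no i≰σi = final , λ i<x i<σx → trans (idle x j<n) (proj₂ (inv x x<N j<n) (<⇒≤ i<x) (<⇒≤ i<σx))
      where
      σi<i : σ i < i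
      σi<i = ≰⇒> i≰σi
      idle = proj₂ (steps i i<N μ₁) σi<i
      earlier : x < suc i ⊎ σ x < suc i → x < i ⊎ σ x < i
      earlier (inj₁ (s≤s x≤i)) with m≤n⇒m<n∨m≡n x≤i
      ... | inj₁ x<i  = inj₁ x<i
      ... | inj₂ refl = inj₂ σi<i
      earlier (inj₂ (s≤s σx≤i)) with m≤n⇒m<n∨m≡n σx≤i
      ... | inj₁ σx<i = inj₂ σx<i
      ... | inj₂ refl = inj₁ (subst (_< σ x) (σσ x x<N) σi<i)
      final : x < suc i ⊎ σ x < suc i → f i μ₁ (at x j) ≡ F x j (μ (at (σ x) j))
      final early = trans (idle x j<n) (proj₁ (inv x x<N j<n) (earlier early))
    ... | yes i≤σi = final , untouched
      where
      swapped = proj₁ (steps i i<N μ₁) i≤σi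
      elsewhere : x ≢ i → σ x ≢ i → f i μ₁ (at x j) ≡ μ₁ (at x j)
      elsewhere x≢i σx≢i = other swapped j<n x≢i λ { refl → σx≢i (σσ i i<N) }
      final : x < suc i ⊎ σ x < suc i → f i μ₁ (at x j) ≡ F x j (μ (at (σ x) j))
      final early with x ≟ i | σ x ≟ i
      ... | yes refl | _ = trans (row-a swapped j<n) (cong (F x j)
        (proj₂ (inv (σ x) (σ< x x<N) j<n) i≤σi (≤-reflexive (sym (σσ x x<N)))))
      ... | no x≢i | yes refl = begin
        f i μ₁ (at x j)            ≡⟨ cong (λ z → f i μ₁ (at z j)) (σσ x x<N) ⟨
        f i μ₁ (at (σ i) j)        ≡⟨ row-v swapped j<n ⟩
        F (σ i) j (μ₁ (at i j))    ≡⟨ cong₂ (λ z y → F z j y) (σσ x x<N) (proj₂ (inv i i<N j<n) ≤-refl i≤σi) ⟩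
        F x j (μ (at i j))         ∎
        where open ≡-Reasoning
      ... | no x≢i | no σx≢i = trans (elsewhere x≢i σx≢i) (proj₁ (inv x x<N j<n)
        (Sum.map (λ x≤i → ≤∧≢⇒< (s≤s⁻¹ x≤i) x≢i) (λ σx≤i → ≤∧≢⇒< (s≤s⁻¹ σx≤i) σx≢i) early))
      untouched : suc i ≤ x → suc i ≤ σ x → f i μ₁ (at x j) ≡ μ (at x j)
      untouched i<x i<σx = trans (elsewhere (<⇒≢ i<x ∘ sym) (<⇒≢ i<σx ∘ sym)) (proj₂ (inv x x<N j<n) (<⇒≤ i<x) (<⇒≤ i<σx))

-- Execution of packing and unpacking

module _ {x} {X : Set x} (act : ℕ → X → X) where

  packRow-step : ∀ c q a v → RowStep input (λ ()) c (λ w j → act (w * (q * c + j))) a v (exec act (packRow c q a v))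
  packRow-step c q a v = packRow-cases (λ P → RowStep input (λ ()) c (λ w j → act (w * (q * c + j))) a v (exec act P)) c q a v
    (λ a<v μ → (λ _ → loop-swapEntry input (λ ()) c (λ w j → act (w * (q * c + j))) (<⇒≢ a<v) μ) , λ v<a → contradiction v<a (<-asym a<v))
    (λ { refl μ → (λ _ → loop-scaleEntry input (λ ()) c (λ w j → act (w * (q * c + j))) a μ) , λ a<a → contradiction refl (<⇒≢ a<a) })
    (λ v<a μ → (λ a≤v → contradiction a≤v (<⇒≱ v<a)) , λ _ x j<n → refl)

  swapRow-step : ∀ r a u → RowStep output (λ ()) r (λ _ _ y → y) a u (exec act (swapRow r a u))
  swapRow-step r a u = swapRow-cases (λ P → RowStep output (λ ()) r (λ _ _ y → y) a u (exec act P)) r a u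
    (λ a<u μ → (λ _ → loop-swapEntry output (λ ()) r (λ _ _ y → y) (<⇒≢ a<u) μ) , λ u<a → contradiction u<a (<-asym a<u))
    (λ u≤a μ → (λ a≤u → fixed (≤-antisym a≤u u≤a) μ) , λ _ x j<n → refl)
    where
    fixed : a ≡ u → ∀ μ → Swapped output (λ ()) r (λ _ _ y → y) a u μ μ
    fixed refl μ = record { row-a = λ _ → refl ; row-v = λ _ → refl ; other = λ _ _ _ → refl }

  module _ (b : ℕ) .{{_ : NonZero b}} (ℓ : ℕ) where

    exec-pack : ∀ c q μ {v j} → v < b ^ ℓ → j < c →
      exec act (pack b ℓ c q) μ (cell input c v j) ≡ act (v * (q * c + j)) (μ (cell input c (π b ℓ v) j))
    exec-pack c q = loop-permute input (λ ()) c (λ w j → act (w * (q * c + j))) (b ^ ℓ) (π b ℓ)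
      (λ a _ → π-< b ℓ a) (π-involutive b ℓ) _ (λ a _ → packRow-step c q a (π b ℓ a))

    exec-swapRows : ∀ r μ {u j} → u < b ^ ℓ → j < r →
      exec act (forRows b ℓ (swapRow r)) μ (cell output r u j) ≡ μ (cell output r (π b ℓ u) j)
    exec-swapRows r = loop-permute output (λ ()) r (λ _ _ y → y) (b ^ ℓ) (π b ℓ)
      (λ a _ → π-< b ℓ a) (π-involutive b ℓ) _ (λ a _ → swapRow-step r a (π b ℓ a))

  module _ (base r c : ℕ) where

    -- A brings the transpose of the h × w subblock with corner (i , j) to the
    -- scratch array and changes nothing else.
    record Transposed (i j h w : ℕ) (A : Prog) (μ : Mem X) : Set x where
      field
        entry : ∀ {x y} → x < h → y < w →
          exec act A μ (cell scratch r (j + y) (i + x)) ≡ μ (output , base + ((i + x) * c + (j + y)))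
        frame : ∀ l → (∀ {x y} → x < h → y < w → l ≢ cell scratch r (j + y) (i + x)) → exec act A μ l ≡ μ l

    open Transposed

    exec-transposeRec : ∀ fuel i j h w → 1 ≤ h → 1 ≤ w → h + w ≤ fuel →
      i + h ≤ r → ∀ μ → Transposed i j h w (transposeRec base r c fuel i j h w) μ
    exec-transposeRec = transposeRec-ind base r c (λ i j h w A → i + h ≤ r → ∀ μ → Transposed i j h w A μ)
      leaf tall wide
      where
      leaf : ∀ i j → i + 1 ≤ r → ∀ μ → Transposed i j 1 1 (call 5 (mov (cell scratch r j i) (output , base + (i * c + j)))) μ
      entry (leaf i j _ μ) {zero} {zero} _ _ rewrite +-identityʳ i | +-identityʳ j =
        write-same (cell scratch r j i) (μ (output , base + (i * c + j))) μ
      entry (leaf i j _ μ) {suc x} {y} (s≤s ()) _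
      entry (leaf i j _ μ) {zero} {suc y} _ (s≤s ())
      frame (leaf i j _ μ) l l≢ = write-other (cell scratch r j i) l _ μ λ l≡ → l≢ (s≤s z≤n) (s≤s z≤n)
        (trans l≡ (cong₂ (cell scratch r) (sym (+-identityʳ j)) (sym (+-identityʳ i))))
      tall : ∀ i j h₁ h₂ w A A′ → 1 ≤ h₁ → h₁ ≤ h₂ → h₂ ≤ suc h₁ → 1 ≤ w → w ≤ h₁ + h₂ →
        (i + h₁ ≤ r → ∀ μ → Transposed i j h₁ w A μ) →
        ((i + h₁) + h₂ ≤ r → ∀ μ → Transposed (i + h₁) j h₂ w A′ μ) →
        i + (h₁ + h₂) ≤ r → ∀ μ → Transposed i j (h₁ + h₂) w (call 5 (A ⨾ A′)) μ
      tall i j h₁ h₂ w A A′ _ _ _ _ _ execA execA′ ≤r μ = record { entry = entry′ ; frame = frame′ }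
        where
        ≤r′ : (i + h₁) + h₂ ≤ r
        ≤r′ = subst (_≤ r) (sym (+-assoc i h₁ h₂)) ≤r
        tA  = execA (≤-trans (m≤m+n (i + h₁) h₂) ≤r′) μ
        tA′ = execA′ ≤r′ (exec act A μ)
        <r : ∀ {x} → x < h₁ + h₂ → i + x < r
        <r x< = ≤-trans (+-monoʳ-< i x<) ≤r
        entry′ : ∀ {x y} → x < h₁ + h₂ → y < w →
          exec act A′ (exec act A μ) (cell scratch r (j + y) (i + x)) ≡ μ (output , base + ((i + x) * c + (j + y)))
        entry′ {x} {y} x< y< with x <? h₁
        ... | yes x<h₁ = trans (frame tA′ _ (λ {x′} {y′} x′< y′< eq → <-irrefl
                (+-cancelˡ-≡ i x (h₁ + x′) (trans (proj₂ (cell-injective (j + y) (j + y′) (<r x<) (subst (_< r) (sym (+-assoc i h₁ x′)) (<r (+-monoʳ-< h₁ x′<))) eq)) (+-assoc i h₁ x′)))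
                (≤-trans x<h₁ (m≤m+n h₁ x′))))
                (entry tA x<h₁ y<)
        ... | no  x≮h₁ = subst (λ z → exec act A′ (exec act A μ) (cell scratch r (j + y) z) ≡ μ (output , base + (z * c + (j + y))))
                (trans (+-assoc i h₁ (x ∸ h₁)) (cong (i +_) (m+[n∸m]≡n (≮⇒≥ x≮h₁))))
                (trans (entry tA′ {x ∸ h₁} {y} (+-cancelˡ-< h₁ (x ∸ h₁) h₂ (subst (_< h₁ + h₂) (sym (m+[n∸m]≡n (≮⇒≥ x≮h₁))) x<)) y<)
                  (frame tA _ (λ _ _ ())))
        frame′ : ∀ l → (∀ {x y} → x < h₁ + h₂ → y < w → l ≢ cell scratch r (j + y) (i + x)) →
          exec act A′ (exec act A μ) l ≡ μ l
        frame′ l l≢ = trans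
          (frame tA′ l (λ {x} {y} x< y< l≡ → l≢ (+-monoʳ-< h₁ x<) y< (trans l≡ (cong (cell scratch r (j + y)) (+-assoc i h₁ x)))))
          (frame tA l (λ x< y< → l≢ (m≤n⇒m≤n+o h₂ x<) y<))
      wide : ∀ i j h w₁ w₂ A A′ → 1 ≤ w₁ → w₁ ≤ w₂ → w₂ ≤ suc w₁ → 1 ≤ h → h ≤ w₁ + w₂ →
        (i + h ≤ r → ∀ μ → Transposed i j h w₁ A μ) →
        (i + h ≤ r → ∀ μ → Transposed i (j + w₁) h w₂ A′ μ) →
        i + h ≤ r → ∀ μ → Transposed i j h (w₁ + w₂) (call 5 (A ⨾ A′)) μ
      wide i j h w₁ w₂ A A′ _ _ _ _ _ execA execA′ ≤r μ = record { entry = entry′ ; frame = frame′ }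
        where
        tA  = execA ≤r μ
        tA′ = execA′ ≤r (exec act A μ)
        <r : ∀ {x} → x < h → i + x < r
        <r x< = ≤-trans (+-monoʳ-< i x<) ≤r
        entry′ : ∀ {x y} → x < h → y < w₁ + w₂ →
          exec act A′ (exec act A μ) (cell scratch r (j + y) (i + x)) ≡ μ (output , base + ((i + x) * c + (j + y)))
        entry′ {x} {y} x< y< with y <? w₁
        ... | yes y<w₁ = trans (frame tA′ _ (λ {x′} {y′} x′< y′< eq → <-irrefl
                (+-cancelˡ-≡ j y (w₁ + y′) (trans (proj₁ (cell-injective (j + y) (j + w₁ + y′) (<r x<) (<r x′<) eq)) (+-assoc j w₁ y′)))
                (≤-trans y<w₁ (m≤m+n w₁ y′))))
                (entry tA x< y<w₁)
        ... | no  y≮w₁ = subst (λ z → exec act A′ (exec act A μ) (cell scratch r z (i + x)) ≡ μ (output , base + ((i + x) * c + z)))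
                (trans (+-assoc j w₁ (y ∸ w₁)) (cong (j +_) (m+[n∸m]≡n (≮⇒≥ y≮w₁))))
                (trans (entry tA′ {x} {y ∸ w₁} x< (+-cancelˡ-< w₁ (y ∸ w₁) w₂ (subst (_< w₁ + w₂) (sym (m+[n∸m]≡n (≮⇒≥ y≮w₁))) y<)))
                  (frame tA _ (λ _ _ ())))
        frame′ : ∀ l → (∀ {x y} → x < h → y < w₁ + w₂ → l ≢ cell scratch r (j + y) (i + x)) →
          exec act A′ (exec act A μ) l ≡ μ l
        frame′ l l≢ = trans
          (frame tA′ l (λ {x} {y} x< y< l≡ → l≢ x< (+-monoʳ-< w₁ y<) (trans l≡ (cong (λ z → cell scratch r z (i + x)) (+-assoc j w₁ y)))))
          (frame tA l (λ x< y< → l≢ x< (m≤n⇒m≤n+o w₂ y<)))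

    module _ (1≤r : 1 ≤ r) (1≤c : 1 ≤ c) (μ : Mem X) where

      private
        μ₁ : Mem X
        μ₁ = exec act (transposeRec base r c (r + c) 0 0 r c) μ

        rec = exec-transposeRec (r + c) 0 0 r c 1≤r 1≤c ≤-refl ≤-refl μ

        copy : ℕ → Mem X → Mem X
        copy k μ = write (output , base + k) (μ (scratch , k)) μ

        -- The locations involved in copying item k.
        involved : ℕ → Bool → Loc
        involved k true  = output , base + k
        involved k false = scratch , k

        copied : ∀ k → k < r * c → loop (r * c) copy μ₁ (output , base + k) ≡ μ₁ (scratch , k)
        copied k k< with loop-independent involved (r * c) copy μ₁ indep k k<
          where
          indep : ∀ i i′ s μ → i < r * c → i′ < r * c → i′ ≢ i → copy i μ (involved i′ s) ≡ μ (involved i′ s)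
          indep i i′ true  μ _ _ i′≢i = write-other (output , base + i) (output , base + i′) _ μ λ eq → i′≢i (+-cancelˡ-≡ base i′ i (,-injectiveʳ eq))
          indep i i′ false μ _ _ i′≢i = write-other (output , base + i) (scratch , i′) (μ (scratch , i)) μ λ ()
        ... | μ′ , agree , effect = trans (effect true) (trans (write-same (output , base + k) _ μ′) (agree false))

      exec-transpose : ∀ {x y} → x < r → y < c →
        exec act (transpose base r c) μ (output , base + (y * r + x)) ≡ μ (output , base + (x * c + y))
      exec-transpose {x} {y} x<r y<c = trans
        (copied (y * r + x) (subst (y * r + x <_) (*-comm c r) (row-bound y<c x<r)))
        (entry rec x<r y<c)

      -- Other locations of the output array are unchanged.
      exec-transpose-frame : ∀ k → (∀ i → i < r * c → k ≢ base + i) →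
        exec act (transpose base r c) μ (output , k) ≡ μ (output , k)
      exec-transpose-frame k k≢ = trans
        (loop-unchanged (r * c) copy μ₁ (output , k) λ i μ i< → write-other (output , base + i) (output , k) _ μ (k≢ i i< ∘ ,-injectiveʳ))
        (frame rec (output , k) λ _ _ ())

  -- Entry (x , y) of the block from source q ends in the row u for which
  -- π u = q c + y.
  exec-unpack : ∀ b .{{_ : NonZero b}} m₂ p r c → 1 ≤ r → 1 ≤ c → ∀ μ {q x y u} →
    q < p → x < r → y < c → u < b ^ m₂ → π b m₂ u ≡ q * c + y →
    exec act (unpack b m₂ p r c) μ (cell output r u x) ≡ μ (output , q * (r * c) + (x * c + y))
  exec-unpack b m₂ p r c 1≤r 1≤c μ {q} {x} {y} {u} q<p x<r y<c u< πu≡ = begin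
    exec act (forRows b m₂ (swapRow r)) μ₁ (cell output r u x) ≡⟨ exec-swapRows b m₂ r μ₁ u< x<r ⟩
    μ₁ (cell output r (π b m₂ u) x)
      ≡⟨ cong (λ n → μ₁ (output , n)) (trans (cong (λ z → z * r + x) πu≡) (regroup q c y r x)) ⟩
    μ₁ (output , q * (r * c) + (y * r + x))                    ≡⟨ transposed ⟩
    μ (output , q * (r * c) + (x * c + y))                     ∎
    where
    open ≡-Reasoning
    step : ℕ → Mem X → Mem X
    step q = exec act (transpose (q * (r * c)) r c)
    μ₁ : Mem X
    μ₁ = loop p step μ
    regroup : ∀ q c y r x → (q * c + y) * r + x ≡ q * (r * c) + (y * r + x)
    regroup = solve-∀
    -- The locations of block q.
    block : ℕ → (∃[ k ] k < r * c) → Loc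
    block q (k , _) = output , q * (r * c) + k
    indep : ∀ i i′ s μ → i < p → i′ < p → i′ ≢ i → step i μ (block i′ s) ≡ μ (block i′ s)
    indep i i′ (k , k<) μ _ _ i′≢i = exec-transpose-frame (i * (r * c)) r c 1≤r 1≤c μ (i′ * (r * c) + k)
      λ k′ k′< eq → i′≢i (proj₁ (row-injective i′ i k< k′< eq))
    transposed : μ₁ (output , q * (r * c) + (y * r + x)) ≡ μ (output , q * (r * c) + (x * c + y))
    transposed with loop-independent block p step μ indep q q<p
    ... | μ′ , agree , effect = trans
      (effect (y * r + x , subst (y * r + x <_) (*-comm c r) (row-bound y<c x<r)))
      (trans (exec-transpose (q * (r * c)) r c 1≤r 1≤c μ′ x<r y<c) (agree (x * c + y , row-bound x<r y<c)))

-- Message delivery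

module _ {x} {X : Set x} (G : Global X) (q : ℕ) (l : Loc) (y : X) where

  -- The message, if it is addressed to location l of processor q, carries y.
  Consistent : Msg → Set x
  Consistent m = q ≡ dst m → to m ≡ l → G (src m) (from m) ≡ y

  private
    -- The memory of processor q after delivery of one message.
    putAt : Global X → Msg → Mem X
    putAt H m = if does (q ≟ dst m) then write (to m) (G (src m) (from m)) (H q) else H q

    putAt-hit : ∀ H {m} → Consistent m → q ≡ dst m → to m ≡ l → putAt H m l ≡ y
    putAt-hit H {m} consistent q≡ l≡ rewrite dec-true (q ≟ dst m) q≡ =
      trans (cong (λ z → write z (G (src m) (from m)) (H q) l) l≡) (trans (write-same l _ (H q)) (consistent q≡ l≡))

    putAt-keep : ∀ H {m} → Consistent m → H q l ≡ y → putAt H m l ≡ y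
    putAt-keep H {m} consistent Hl≡ with q ≟ dst m | to m ≟ᴸ l
    ... | yes q≡ | yes l≡ = putAt-hit H consistent q≡ l≡
    ... | yes q≡ | no  l≢ rewrite dec-true (q ≟ dst m) q≡ = trans (write-other (to m) l _ (H q) (l≢ ∘ sym)) Hl≡
    ... | no  q≢ | _      rewrite dec-false (q ≟ dst m) q≢ = Hl≡

    -- f stands for the delivery of one message.
    module _ (f : Global X → Msg → Global X) (f≡ : ∀ H m → f H m q ≡ putAt H m) where

      foldl-keep : ∀ ms H → All Consistent ms → H q l ≡ y → foldl f H ms q l ≡ y
      foldl-keep []       H []       Hl≡ = Hl≡
      foldl-keep (m ∷ ms) H (c ∷ cs) Hl≡ = foldl-keep ms (f H m) cs
        (trans (cong (λ μ → μ l) (f≡ H m)) (putAt-keep H c Hl≡))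

      foldl-hit : ∀ ms H → All Consistent ms → Any (λ m → q ≡ dst m × to m ≡ l) ms → foldl f H ms q l ≡ y
      foldl-hit (m ∷ ms) H (c ∷ cs) (here (q≡ , l≡)) = foldl-keep ms (f H m) cs
        (trans (cong (λ μ → μ l) (f≡ H m)) (putAt-hit H c q≡ l≡))
      foldl-hit (m ∷ ms) H (c ∷ cs) (there hit)      = foldl-hit ms (f H m) cs hit

  -- If some message goes to location l of processor q, and all such messages
  -- carry y, then y is delivered, in whatever order.
  deliver-hit : ∀ ms → All Consistent ms → Any (λ m → q ≡ dst m × to m ≡ l) ms → deliver ms G q l ≡ y
  deliver-hit ms = foldl-hit _ (λ H m → refl) ms G

module _ {x} {X : Set x} (p r c : ℕ) (G : Global X) where

  deliver-redistribution : ∀ {q q′ v j} → q < p → q′ < p → v < r → j < c →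
    deliver (redistribution p r c) G q′ (output , q * (r * c) + (v * c + j)) ≡ G q (cell input c (q′ * r + v) j)
  deliver-redistribution {q} {q′} {v} {j} q<p q′<p v<r j<c = deliver-hit G q′ _ _ (redistribution p r c)
    (All-concatMap-upTo _ p λ q₁ q₁<p → All-concatMap-upTo _ p λ q₁′ q₁′<p →
     All-concatMap-upTo _ r λ v₁ v₁<r → All.map⁺ (All.applyUpTo⁺₁ (λ i → i) c λ {j₁} j₁<c →
     consistent q₁ q₁′ v₁ j₁ v₁<r j₁<c))
    (Any-concatMap-upTo _ q<p (Any-concatMap-upTo _ q′<p (Any-concatMap-upTo _ v<r
      (Any.map⁺ (Any.applyUpTo⁺ (λ i → i) (refl , refl) j<c)))))
    where
    consistent : ∀ q₁ q₁′ v₁ j₁ → v₁ < r → j₁ < c →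
      Consistent G q′ (output , q * (r * c) + (v * c + j)) (G q (cell input c (q′ * r + v) j)) (message p r c q₁ q₁′ v₁ j₁)
    consistent q₁ q₁′ v₁ j₁ v₁<r j₁<c refl eq with row-injective q₁ q (row-bound v₁<r j₁<c) (row-bound v<r j<c) (,-injectiveʳ eq)
    ... | refl , eq′ with row-injective v₁ v j₁<c j<c eq′
    ...   | refl , refl = refl

-- The effect of the redistribution on column q′ r + v of the output: its entry
-- in the row u with π u = q c + j stems from column q c + j of the input.
run-redistribute : ∀ {x} {X : Set x} (act : ℕ → X → X) b m₁ m₂ p r c .{{_ : NonZero b}} →
  1 ≤ r → 1 ≤ c → b ^ m₁ ≡ r * p →
  ∀ (G : Global X) {q q′ v j u} → q < p → q′ < p → v < r → j < c → u < b ^ m₂ → π b m₂ u ≡ q * c + j →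
  run act (redistribute b m₁ m₂ p r c) G q′ (cell output r u v) ≡
    act ((q′ * r + v) * (q * c + j)) (G q (cell input c (π b m₁ (q′ * r + v)) j))
run-redistribute act b m₁ m₂ p r c 1≤r 1≤c N₁≡ G {q} {q′} {v} {j} {u} q<p q′<p v<r j<c u< πu≡ = begin
  exec act (unpack b m₂ p r c) (G₂ q′) (cell output r u v)
    ≡⟨ exec-unpack act b m₂ p r c 1≤r 1≤c (G₂ q′) q<p v<r j<c u< πu≡ ⟩
  G₂ q′ (output , q * (r * c) + (v * c + j))
    ≡⟨ deliver-redistribution p r c G₁ q<p q′<p v<r j<c ⟩
  G₁ q (cell input c (q′ * r + v) j)
    ≡⟨ exec-pack act b m₁ c q (G q) (subst (q′ * r + v <_) (trans (*-comm p r) (sym N₁≡)) (row-bound q′<p v<r)) j<c ⟩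
  act ((q′ * r + v) * (q * c + j)) (G q (cell input c (π b m₁ (q′ * r + v)) j)) ∎
  where
  open ≡-Reasoning
  G₁ G₂ : Global _
  G₁ q = exec act (pack b m₁ c q) (G q)
  G₂ = deliver (redistribution p r c) G₁

-- Rational volumes

open import Data.Integer.Base using (+_)

fromℕ-quotient : ∀ {n m d} .{{_ : NonZero d}} → n * d ≡ m → fromℕ n ≡ + m ℚ./ d
fromℕ-quotient {n} {m} {d@(suc d′)} n*d≡m = ℚ.fromℚᵘ-cong {mkℚᵘ (+ n) 0} {mkℚᵘ (+ m) d′} (*≡* (begin
  + n ℤ.* + d ≡⟨ ℤ.pos-* n d ⟨
  + (n * d)   ≡⟨ cong +_ n*d≡m ⟩
  + m         ≡⟨ ℤ.*-identityʳ (+ m) ⟨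
  + m ℤ.* + 1 ∎))
  where open ≡-Reasoning

-- Removing one of p equal shares.
fromℕ-remote : ∀ y p .{{_ : NonZero p}} → fromℕ (y * p) ℚ.* (1ℚ ℚ.- (+ 1 ℚ./ p)) ≡ fromℕ (y * pred p)
fromℕ-remote y p@(suc p′) = ℚ.toℚᵘ-injective (begin
  ℚ.toℚᵘ (fromℕ (y * p) ℚ.* (1ℚ ℚ.- (+ 1 ℚ./ p)))
    ≈⟨ ℚ.toℚᵘ-homo-* (fromℕ (y * p)) (1ℚ ℚ.- (+ 1 ℚ./ p)) ⟩
  ℚ.toℚᵘ (fromℕ (y * p)) ℚᵘ.* ℚ.toℚᵘ (1ℚ ℚ.- (+ 1 ℚ./ p))
    ≈⟨ ℚᵘ.*-cong (ℚ.toℚᵘ-fromℚᵘ (mkℚᵘ (+ (y * p)) 0)) difference ⟩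
  mkℚᵘ (+ (y * p)) 0 ℚᵘ.* (1ℚᵘ ℚᵘ.- mkℚᵘ (+ 1) p′)
    ≈⟨ *≡* numerators ⟩
  mkℚᵘ (+ (y * p′)) 0
    ≈⟨ ℚ.toℚᵘ-fromℚᵘ (mkℚᵘ (+ (y * p′)) 0) ⟨
  ℚ.toℚᵘ (fromℕ (y * p′))
    ∎)
  where
  open ℚᵘ.≃-Reasoning
  difference : ℚ.toℚᵘ (1ℚ ℚ.- (+ 1 ℚ./ p)) ℚᵘ.≃ 1ℚᵘ ℚᵘ.- mkℚᵘ (+ 1) p′
  difference = begin
    ℚ.toℚᵘ (1ℚ ℚ.- (+ 1 ℚ./ p))                ≈⟨ ℚ.toℚᵘ-homo-+ 1ℚ (ℚ.- (+ 1 ℚ./ p)) ⟩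
    1ℚᵘ ℚᵘ.+ ℚ.toℚᵘ (ℚ.- (+ 1 ℚ./ p))          ≈⟨ ℚᵘ.+-congʳ 1ℚᵘ (ℚ.toℚᵘ-homo‿- (+ 1 ℚ./ p)) ⟩
    1ℚᵘ ℚᵘ.- ℚ.toℚᵘ (+ 1 ℚ./ p)                ≈⟨ ℚᵘ.+-congʳ 1ℚᵘ (ℚᵘ.-‿cong (ℚ.toℚᵘ-fromℚᵘ (mkℚᵘ (+ 1) p′))) ⟩
    1ℚᵘ ℚᵘ.- mkℚᵘ (+ 1) p′                     ∎
  numerators : (+ (y * p) ℤ.* (+ (p′ + 0))) ℤ.* + 1 ≡ + (y * p′) ℤ.* + (suc (p′ + 0 + 0))
  numerators = trans (ℤ.*-identityʳ (+ (y * p) ℤ.* (+ (p′ + 0))))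
    (trans (sym (ℤ.pos-* (y * p) (p′ + 0))) (trans (cong +_ (swap y p′)) (ℤ.pos-* (y * p′) (suc (p′ + 0 + 0)))))
    where
    swap : ∀ y p → y * suc p * (p + 0) ≡ y * p * suc (p + 0 + 0)
    swap = solve-∀

-- The stage

-- r × c is the shape of the blocks exchanged between two processors.
module _ {t κ : ℕ} (S : Stage t κ) where

  open Stage S

  private
    r c : ℕ
    r = N₁/p
    c = N₂/p

    N₁≡ : N₁ ≡ r * p
    N₁≡ = _∣_.equality p∣N₁

    N₂≡ : N₂ ≡ c * p
    N₂≡ = _∣_.equality p∣N₂

    1≤r : 1 ≤ r
    1≤r = ≤-trans 1≤B B≤N₁/p

    1≤c : 1 ≤ c
    1≤c = ≤-trans 1≤B B≤N₂/p

    2≤b : 2 ≤ b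
    2≤b = ^-monoʳ-≤ 2 1≤t

    N≡items*p : N ≡ p * (r * c) * p
    N≡items*p = trans (cong₂ _*_ N₁≡ N₂≡) (regroup r c p)
      where
      regroup : ∀ r c p → r * p * (c * p) ≡ p * (r * c) * p
      regroup = solve-∀

    N≡block*p² : N ≡ r * c * (p * p)
    N≡block*p² = trans N≡items*p (regroup (r * c) p)
      where
      regroup : ∀ x p → p * x * p ≡ x * (p * p)
      regroup = solve-∀

    N/p≡items : N/p ≡ p * (r * c)
    N/p≡items = trans (cong (_/ p) N≡items*p) (m*n/n≡m (p * (r * c)) p)

    N/p²≡block : N/p² ≡ r * c
    N/p²≡block = trans (cong (_/ (p * p)) N≡block*p²) (m*n/n≡m (r * c) (p * p))

    open Complexity b m₁ m₂ p r c 2≤b 1≤r 1≤c N₁≡ N₂≡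

    power : ∀ ℓ → b ^ ℓ ≡ 2 ^ (t * ℓ)
    power ℓ = ^-*-assoc 2 t ℓ

    log₂N : ⌊log₂ N ⌋ ≡ t * m₁ + t * m₂
    log₂N = trans (cong ⌊log₂_⌋ (trans (cong₂ _*_ (power m₁) (power m₂)) (sym (^-distribˡ-+-* 2 (t * m₁) (t * m₂)))))
      (⌊log₂[2^n]⌋≡n (t * m₁ + t * m₂))

  splitsReversal : SplitsReversal
  splitsReversal a c _ c< = π-split b m₁ m₂ a c c<

  -- Row u and column v of the output come from row π v and column π u of the
  -- input.
  outputAt-run : ∀ {x} {X : Set x} (act : ℕ → X → X) (G : Global X) {u v} → u < N₂ → v < N₁ →
    outputAt (run act perm G) u v ≡ act (v * π b m₂ u) (inputAt G (π b m₁ v) (π b m₂ u))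
  outputAt-run act G {u} {v} u< v< = begin
    run act perm G ((v * p) / N₁) (cell output r u (v % r))
      ≡⟨ cong (λ q → run act perm G q (cell output r u (v % r))) owner ⟩
    run act perm G (v / r) (cell output r u (v % r))
      ≡⟨ run-redistribute act b m₁ m₂ p r c 1≤r 1≤c N₁≡ G
           (m<n*o⇒m/o<n (subst (w <_) (trans N₂≡ (*-comm c p)) (π-< b m₂ u)))
           (m<n*o⇒m/o<n (subst (v <_) (trans N₁≡ (*-comm r p)) v<))
           (m%n<n v r) (m%n<n w c) u< (sym (div-mod w c)) ⟩
    act ((v / r * r + v % r) * (w / c * c + w % c)) (G (w / c) (cell input c (π b m₁ (v / r * r + v % r)) (w % c)))
      ≡⟨ cong₂ (λ y z → act (y * z) (G (w / c) (cell input c (π b m₁ y) (w % c)))) (div-mod v r) (div-mod w c) ⟩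
    act (v * w) (G (w / c) (cell input c (π b m₁ v) (w % c)))
      ∎
    where
    open ≡-Reasoning
    w = π b m₂ u
    instance
      r*p≢0 : NonZero (r * p)
      r*p≢0 = m*n≢0 r p
    owner : (v * p) / N₁ ≡ v / r
    owner = trans (/-congʳ {m = v * p} N₁≡) (m*n/o*n≡m/o v p r)

  permuted : ∀ {x} {X : Set x} (G : Global X) → Permuted G (run (λ e y → y) perm G)
  permuted G a c a< c< = trans (outputAt-run (λ e y → y) G (π-< b m₂ c) (π-< b m₁ a))
    (cong₂ (inputAt G) (π-involutive b m₁ a a<) (π-involutive b m₂ c c<))

  twiddledValues : ∀ {k ℓ} (R : CommutativeRing k ℓ) (ρ : RootOfUnity R N) → let open CommutativeRing R using (Carrier) in
    (A : ℕ → ℕ → Carrier) (G : Global Carrier) → PhaseIOutput R A G →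
    PhaseIIIInput R (twiddled R ρ A) (run (RootOfUnity.twiddle ρ) perm G)
  twiddledValues R ρ A G phaseI u v u< v< = begin
    outputAt (run twiddle perm G) u v                            ≡⟨ outputAt-run twiddle G u< v< ⟩
    twiddle (v * π b m₂ u) (inputAt G (π b m₁ v) (π b m₂ u))
      ≈⟨ *-congʳ (phaseI (π b m₁ v) (π b m₂ u) (π-< b m₁ v) (π-< b m₂ u)) ⟩
    twiddle (v * π b m₂ u) (A (π b m₁ (π b m₁ v)) (π b m₂ u))
      ≡⟨ cong (λ w → twiddle (v * π b m₂ u) (A w (π b m₂ u))) (π-involutive b m₁ v v<) ⟩
    twiddle (v * π b m₂ u) (A v (π b m₂ u))                      ∎
    where
    open CommutativeRing R using (setoid; *-congʳ)
    open RootOfUnity ρ using (twiddle)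
    open import Relation.Binary.Reasoning.Setoid setoid

  arith-lower : ∀ τ q → N/p ≤ Wᵃʳⁱᵗʰ τ perm q
  arith-lower τ q = subst (_≤ Wᵃʳⁱᵗʰ τ perm q) (sym N/p≡items) (Wᵃʳⁱᵗʰ-≥ τ q)

  arith-upper : ∀ {τ τmax} → (∀ e → τ e ≤ τmax) → ∀ q → Wᵃʳⁱᵗʰ τ perm q ≤ 2 * suc τmax * N/p
  arith-upper {τ} {τmax} τ≤ q = subst (λ n → Wᵃʳⁱᵗʰ τ perm q ≤ 2 * suc τmax * n) (sym N/p≡items) (Wᵃʳⁱᵗʰ-≤ τ≤ q)

  rearrangement : ∀ {q} → q < p → Wʳᵉᵃʳʳ perm q ≤ 24 * N/p
  rearrangement {q} q<p = subst (λ n → Wʳᵉᵃʳʳ perm q ≤ 24 * n) (sym N/p≡items) (Wʳᵉᵃʳʳ-≤ q<p)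

  caching : ∀ {q} → q < p → Q q * (p * B) ≤ (150 + 288 * κ) * N
  caching {q} q<p = begin
    Q q * (p * B)                           ≡⟨ swap (Q q) p B ⟩
    Q q * B * p                             ≤⟨ *-monoˡ-≤ p (cacheMisses-≤ {κ} {M} tall B≤N₁/p B≤N₂/p q<p) ⟩
    (150 + 288 * κ) * (p * (r * c)) * p     ≡⟨ *-assoc (150 + 288 * κ) (p * (r * c)) p ⟩
    (150 + 288 * κ) * (p * (r * c) * p)     ≡⟨ cong ((150 + 288 * κ) *_) N≡items*p ⟨
    (150 + 288 * κ) * N                     ∎
    where
    open ≤-Reasoning
    swap : ∀ x y z → x * (y * z) ≡ x * z * y
    swap = solve-∀

  storage : ∀ q → workspace N/p perm q ≤ 8 * (N/p² + ⌊log₂ N ⌋)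
  storage q = begin
    workspace N/p perm q                  ≡⟨ cong (λ n → workspace n perm q) N/p≡items ⟩
    workspace (p * (r * c)) perm q
      ≤⟨ workspace-≤ (t * m₁) (t * m₂) (side m₁ N₁≡) (side m₂ N₂≡) (digits m₁) (digits m₂) q ⟩
    8 * (r * c + (t * m₁ + t * m₂))       ≡⟨ cong (8 *_) (cong₂ _+_ N/p²≡block log₂N) ⟨
    8 * (N/p² + ⌊log₂ N ⌋)                ∎
    where
    open ≤-Reasoning
    side : ∀ ℓ {n} → b ^ ℓ ≡ n * p → n ≤ 2 ^ (t * ℓ)
    side ℓ {n} b^ℓ≡ = begin
      n           ≤⟨ m≤m*n n p ⟩
      n * p       ≡⟨ b^ℓ≡ ⟨
      b ^ ℓ       ≡⟨ power ℓ ⟩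
      2 ^ (t * ℓ) ∎
    digits : ∀ ℓ → ℓ ≤ t * ℓ
    digits ℓ = subst (_≤ t * ℓ) (*-identityˡ ℓ) (*-monoˡ-≤ ℓ 1≤t)

  messages≡ : messages perm ≡ redistribution p r c
  messages≡ = ++-identityʳ (redistribution p r c)

  remote≡ : remote perm ≡ remoteMessages p r c
  remote≡ = cong (filter _) messages≡

  pairs : ∀ {q q′} → q < p → q′ < p → fromℕ (pairCount perm q q′) ≡ pairVolume
  pairs {q} {q′} q<p q′<p = fromℕ-quotient {pairCount perm q q′} {N} {p * p} (trans
    (cong (_* (p * p)) (trans (cong (λ ms → length (filter _ ms)) messages≡) (count-pair p r c q<p q′<p)))
    (sym N≡block*p²))

  remote-share : fromℕ (pred p * (r * c)) ≡ relationSize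
  remote-share = begin
    fromℕ (pred p * (r * c))                            ≡⟨ cong fromℕ (*-comm (pred p) (r * c)) ⟩
    fromℕ (r * c * pred p)                              ≡⟨ fromℕ-remote (r * c) p ⟨
    fromℕ (r * c * p) ℚ.* (1ℚ ℚ.- (+ 1 ℚ./ p))
      ≡⟨ cong (ℚ._* (1ℚ ℚ.- (+ 1 ℚ./ p))) (fromℕ-quotient {r * c * p} {N} {p} (trans (cong (_* p) (*-comm (r * c) p)) (sym N≡items*p))) ⟩
    relationSize                                        ∎
    where open ≡-Reasoning

  relation : ∀ {q} → q < p → (fromℕ (sent perm q) ≡ relationSize) × (fromℕ (received perm q) ≡ relationSize)
  relation {q} q<p =
      trans (cong fromℕ (trans (cong (λ ms → length (filter _ ms)) remote≡) (count-sent p r c q<p))) remote-share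
    , trans (cong fromℕ (trans (cong (λ ms → length (filter _ ms)) remote≡) (count-received p r c q<p))) remote-share

  migrationVolume : fromℕ (migration perm) ≡ totalVolume
  migrationVolume = begin
    fromℕ (migration perm)
      ≡⟨ cong fromℕ (trans (cong length remote≡) (count-remote p r c)) ⟩
    fromℕ (p * (pred p * (r * c)))                      ≡⟨ cong fromℕ (regroup p (pred p) (r * c)) ⟩
    fromℕ (p * (r * c) * pred p)                        ≡⟨ fromℕ-remote (p * (r * c)) p ⟨
    fromℕ (p * (r * c) * p) ℚ.* (1ℚ ℚ.- (+ 1 ℚ./ p))    ≡⟨ cong (λ n → fromℕ n ℚ.* (1ℚ ℚ.- (+ 1 ℚ./ p))) N≡items*p ⟨
    totalVolume                                         ∎
    where
    open ≡-Reasoning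
    regroup : ∀ p p′ x → p * (p′ * x) ≡ p * x * p′
    regroup = solve-∀

open Stage

theorem4 : ∀ {x k ℓ} (t κ τmax : ℕ) →
  ∃[ C ] ((S : Stage t κ) →

    -- the permutation
    SplitsReversal S
    × ((X : Set x) (G : Global X) → Permuted S G (run (λ e y → y) (perm S) G))

    -- the values
    × ((R : CommutativeRing k ℓ) (ρ : RootOfUnity R (N S)) →
       (A : ℕ → ℕ → CommutativeRing.Carrier R) (G : Global (CommutativeRing.Carrier R)) →
       PhaseIOutput S R A G →
       PhaseIIIInput S R (twiddled S R ρ A) (run (RootOfUnity.twiddle ρ) (perm S) G))

    -- local work, cache misses and storage
    × (∀ q → q < p S →
       (∀ (τ : ℕ → ℕ) → (∀ e → τ e ≤ τmax) →
          (N/p S ≤ C * Wᵃʳⁱᵗʰ τ (perm S) q) × (Wᵃʳⁱᵗʰ τ (perm S) q ≤ C * N/p S))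
       × (Wʳᵉᵃʳʳ (perm S) q ≤ C * N/p S)
       × (Q S q * (p S * B S) ≤ C * N S)
       × (workspace (N/p S) (perm S) q ≤ C * (N/p² S + ⌊log₂ N S ⌋)))

    -- communication
    × (rounds (perm S) ≡ 1)
    × (∀ q q′ → q < p S → q′ < p S → fromℕ (pairCount (perm S) q q′) ≡ pairVolume S)
    × (∀ q → q < p S →
       (fromℕ (sent (perm S) q) ≡ relationSize S) × (fromℕ (received (perm S) q) ≡ relationSize S))
    × (fromℕ (migration (perm S)) ≡ totalVolume S))
theorem4 t κ τmax = C , λ S →
    splitsReversal S
  , (λ X → permuted S)
  , twiddledValues S
  , (λ q q<p →
        (λ τ τ≤ → ≤-trans (arith-lower S τ q) (m≤n*m _ C)
                , ≤-trans (arith-upper S τ≤ q) (*-monoˡ-≤ (N/p S) (m≤m+n (2 * suc τmax) _)))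
      , ≤-trans (rearrangement S q<p) (*-monoˡ-≤ (N/p S) 24≤C)
      , ≤-trans (caching S q<p) (*-monoˡ-≤ (N S) (≤-trans (m≤m+n (150 + 288 * κ) 24) (m≤n+m _ (2 * suc τmax))))
      , ≤-trans (storage S q) (*-monoˡ-≤ (N/p² S + ⌊log₂ N S ⌋) (≤-trans (m≤m+n 8 16) 24≤C)))
  , refl
  , (λ q q′ → pairs S)
  , (λ q → relation S)
  , migrationVolume S
  where
  C : ℕ
  C = 2 * suc τmax + (150 + 288 * κ + 24)
  24≤C : 24 ≤ C
  24≤C = ≤-trans (m≤n+m 24 (150 + 288 * κ)) (m≤n+m _ (2 * suc τmax))
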